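{- Let $k \geq 2$ be an integer, and let $f_k(n)$ denote the number of abelian squares of length $2n$ over an alphabet with $k$ letters. Then, as $n \to \infty$, $$ f_k(n) \sim k^{2n + k/2} \, (4\pi n)^{(1-k)/2}, $$ i.e., the ratio of the two sides tends to $1$ as $n \to \infty$ with $k$ fixed.
   Context: An abelian square of length $2n$ ($n>0$) is a string of the form $x x'$ where $|x| = |x'| = n$ and $x'$ is a permutation (rearrangement) of the symbols of $x$; equivalently, every letter of the alphabet occurs the same number of times in $x$ as in $x'$. (The rearrangement may be the identity, so ordinary squares $xx$ are included.) The quantity $f_k(n)$ is the number of such strings over the alphabet $\{1, 2, \ldots, k\}$. -}

module Defs where

open import Data.Bool using (if_then_else_)
open import Data.Fin using (Fin)
import Data.Fin.Properties as Fin
import Data.Integer as ℤ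
import Data.Integer.Properties as ℤ
open import Data.Integer using (ℤ; +_; -[1+_])
open import Data.List using (List; []; _∷_; length; filter; cartesianProductWith; allFin)
open import Data.List.Membership.Propositional using (_∈_)
open import Data.List.Membership.Propositional.Properties using (∈-∃++)
import Data.List.Membership.DecPropositional as DecMembership
open import Data.List.Relation.Unary.Any using (here)
open import Data.List.Relation.Binary.Permutation.Propositional
  using (_↭_; ↭-refl; ↭-sym; ↭-trans; prep)
open import Data.List.Relation.Binary.Permutation.Propositional.Properties
  using (shift; drop-∷; ∈-resp-↭; ¬x∷xs↭[])
open import Data.Nat as ℕ using (ℕ; zero; suc; NonZero)
import Data.Nat.Properties as ℕ
open import Data.Product using (Σ; ∃; ∃-syntax; _×_; _,_; proj₁; proj₂)
open import Data.Rational as ℚ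
  using (ℚ; 0ℚ; 1ℚ; ½; _+_; _*_; _-_; -_; _≤_; _<_; ∣_∣; _⊔_; _⊓_; _/_; 1/_; toℚᵘ; Positive; positive)
import Data.Rational.Properties as ℚ
open import Data.Rational.Solver using (module +-*-Solver)
import Data.Rational.Unnormalised as ℚᵘ
import Data.Rational.Unnormalised.Properties as ℚᵘ
open import Data.Sum using (_⊎_; inj₁; inj₂)
open import Data.Vec using (Vec; []; _∷_; _++_; toList; splitAt)
import Data.Vec.Properties as Vec
open import Function using (_∘_)
open import Relation.Binary.Definitions using (DecidableEquality)
open import Relation.Binary.PropositionalEquality
  using (_≡_; refl; sym; trans; cong; cong₂; subst; subst₂; module ≡-Reasoning)
open import Relation.Nullary using (Dec; yes; no; does; ¬_; contradiction)

AbelianSquare : (k n : ℕ) → Vec (Fin k) (n ℕ.+ n) → Set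
AbelianSquare k n w =
  Σ (Vec (Fin k) n) λ x → Σ (Vec (Fin k) n) λ x′ → w ≡ x ++ x′ × toList x′ ↭ toList x

words : (k m : ℕ) → List (Vec (Fin k) m)
words k zero    = [] ∷ []
words k (suc m) = cartesianProductWith _∷_ (allFin k) (words k m)

module _ {A : Set} (_≟_ : DecidableEquality A) where

  open DecMembership _≟_ using (_∈?_)

  ↭-dec : (xs ys : List A) → Dec (xs ↭ ys)
  ↭-dec []       []       = yes ↭-refl
  ↭-dec []       (y ∷ ys) = no λ p → ¬x∷xs↭[] (↭-sym p)
  ↭-dec (x ∷ xs) ys with x ∈? ys
  ... | no x∉ys = no λ p → x∉ys (∈-resp-↭ p (here refl))
  ... | yes x∈ys with ∈-∃++ x∈ys
  ... | as , bs , refl with ↭-dec xs (as Data.List.++ bs)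
  ... | yes p = yes (↭-trans (prep x p) (↭-sym (shift x as bs)))
  ... | no ¬p = no λ q → ¬p (drop-∷ (↭-trans q (shift x as bs)))

abelianSquare? : (k n : ℕ) (w : Vec (Fin k) (n ℕ.+ n)) → Dec (AbelianSquare k n w)
abelianSquare? k n w with splitAt n w
... | x , x′ , refl with ↭-dec Fin._≟_ (toList x′) (toList x)
... | yes p = yes (x , x′ , refl , p)
... | no ¬p = no λ (y , y′ , eq , p) →
  let x≡y , x′≡y′ = Vec.++-injective x y eq
  in ¬p (subst₂ (λ a b → toList a ↭ toList b) (sym x′≡y′) (sym x≡y) p)

abelianSquares : (k n : ℕ) → ℕ
abelianSquares k n = length (filter (abelianSquare? k n) (words k (n ℕ.+ n)))

*-pos : ∀ {p q} → 0ℚ < p → 0ℚ < q → 0ℚ < p * q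
*-pos {p} {q} 0<p 0<q =
  ℚ.positive⁻¹ (p * q) {{ℚ.pos*pos⇒pos p {{positive 0<p}} q {{positive 0<q}}}}

*-monoʳ-≤ : ∀ r {p q} → 0ℚ ≤ r → p ≤ q → r * p ≤ r * q
*-monoʳ-≤ r 0≤r = ℚ.*-monoˡ-≤-nonNeg r {{ℚ.nonNegative 0≤r}}

*-monoˡ-≤ : ∀ r {p q} → 0ℚ ≤ r → p ≤ q → p * r ≤ q * r
*-monoˡ-≤ r 0≤r = ℚ.*-monoʳ-≤-nonNeg r {{ℚ.nonNegative 0≤r}}

*-mono-≤ : ∀ {p q r s} → 0ℚ ≤ p → 0ℚ ≤ r → p ≤ q → r ≤ s → p * r ≤ q * s
*-mono-≤ {q = q} {r = r} 0≤p 0≤r p≤q r≤s =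
  ℚ.≤-trans (*-monoˡ-≤ r 0≤r p≤q) (*-monoʳ-≤ q (ℚ.≤-trans 0≤p p≤q) r≤s)

*-monoʳ-< : ∀ r {p q} → 0ℚ < r → p < q → r * p < r * q
*-monoʳ-< r 0<r = ℚ.*-monoʳ-<-pos r {{positive 0<r}}

sq-cancel-< : ∀ {p q} → 0ℚ ≤ q → p * p < q * q → p < q
sq-cancel-< {p} {q} 0≤q p²<q² with p ℚ.<? q
... | yes p<q = p<q
... | no p≮q = contradiction (ℚ.<-≤-trans p²<q² (*-mono-≤ 0≤q 0≤q q≤p q≤p)) (ℚ.<-irrefl refl)
  where q≤p = ℚ.≮⇒≥ p≮q

½-pos : ∀ {ε} → 0ℚ < ε → 0ℚ < ½ * ε
½-pos = *-pos (ℚ.positive⁻¹ ½)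

½+½ : ∀ ε → ½ * ε + ½ * ε ≡ ε
½+½ ε = trans (sym (ℚ.*-distribʳ-+ ε ½ ½)) (ℚ.*-identityˡ ε)

inv : ∀ p → 0ℚ < p → ℚ
inv p 0<p = 1/_ p {{ℚ.>-nonZero 0<p}}

p*inv : ∀ p (0<p : 0ℚ < p) → p * inv p 0<p ≡ 1ℚ
p*inv p 0<p = ℚ.*-inverseʳ p {{ℚ.>-nonZero 0<p}}

inv-pos : ∀ p (0<p : 0ℚ < p) → 0ℚ < inv p 0<p
inv-pos p 0<p = ℚ.positive⁻¹ (inv p 0<p) {{ℚ.1/pos⇒pos p {{positive 0<p}}}}

inv-anti : ∀ {p q} (0<p : 0ℚ < p) (0<q : 0ℚ < q) → p ≤ q → inv q 0<q ≤ inv p 0<p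
inv-anti {p} {q} 0<p 0<q p≤q = begin
  j            ≡⟨ ℚ.*-identityʳ j ⟨
  j * 1ℚ       ≡⟨ cong (j *_) (p*inv p 0<p) ⟨
  j * (p * i)  ≤⟨ *-monoʳ-≤ j (ℚ.<⇒≤ (inv-pos q 0<q)) (*-monoˡ-≤ i (ℚ.<⇒≤ (inv-pos p 0<p)) p≤q) ⟩
  j * (q * i)  ≡⟨ solve 3 (λ i j q → j :* (q :* i) := (q :* j) :* i) refl i j q ⟩
  (q * j) * i  ≡⟨ cong (_* i) (p*inv q 0<q) ⟩
  1ℚ * i       ≡⟨ ℚ.*-identityˡ i ⟩
  i            ∎
  where
  open ℚ.≤-Reasoning
  open +-*-Solver
  i = inv p 0<p
  j = inv q 0<q

∣∣-swap : ∀ p q → ∣ p - q ∣ ≡ ∣ q - p ∣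
∣∣-swap p q = trans (cong ∣_∣ (solve 2 (λ p q → p :- q := :- (q :- p)) refl p q)) (ℚ.∣-p∣≡∣p∣ (q - p))
  where open +-*-Solver

p≤∣p∣ : ∀ p → p ≤ ∣ p ∣
p≤∣p∣ p with ℚ.≤-total 0ℚ p
... | inj₁ 0≤p = ℚ.≤-reflexive (sym (ℚ.0≤p⇒∣p∣≡p 0≤p))
... | inj₂ p≤0 = ℚ.≤-trans p≤0 (ℚ.0≤∣p∣ p)

p≤∣p-q∣+q : ∀ p q → p ≤ ∣ p - q ∣ + q
p≤∣p-q∣+q p q = begin
  p              ≡⟨ solve 2 (λ p q → p := (p :- q) :+ q) refl p q ⟩
  (p - q) + q    ≤⟨ ℚ.+-monoˡ-≤ q (p≤∣p∣ (p - q)) ⟩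
  ∣ p - q ∣ + q  ∎
  where
  open ℚ.≤-Reasoning
  open +-*-Solver

∣p∣≤∣p-q∣+∣q∣ : ∀ p q → ∣ p ∣ ≤ ∣ p - q ∣ + ∣ q ∣
∣p∣≤∣p-q∣+∣q∣ p q = begin
  ∣ p ∣              ≡⟨ cong ∣_∣ (solve 2 (λ p q → p := (p :- q) :+ q) refl p q) ⟩
  ∣ (p - q) + q ∣    ≤⟨ ℚ.∣p+q∣≤∣p∣+∣q∣ (p - q) q ⟩
  ∣ p - q ∣ + ∣ q ∣  ∎
  where
  open ℚ.≤-Reasoning
  open +-*-Solver

<+⇒∣-∣< : ∀ {p q ε} → p < q + ε → q < p + ε → ∣ p - q ∣ < ε
<+⇒∣-∣< {p} {q} {ε} p<q+ε q<p+ε with ℚ.∣p∣≡p∨∣p∣≡-p (p - q)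
... | inj₁ eq = subst₂ _<_ (sym eq) (solve 2 (λ q ε → (q :+ ε) :- q := ε) refl q ε)
  (ℚ.+-monoˡ-< (- q) p<q+ε)
  where open +-*-Solver
... | inj₂ eq = subst₂ _<_
  (trans (solve 2 (λ p q → q :- p := :- (p :- q)) refl p q) (sym eq))
  (solve 2 (λ p ε → (p :+ ε) :- p := ε) refl p ε)
  (ℚ.+-monoˡ-< (- p) q<p+ε)
  where open +-*-Solver

∣∣p∣-∣q∣∣≤∣p-q∣ : ∀ p q → ∣ ∣ p ∣ - ∣ q ∣ ∣ ≤ ∣ p - q ∣
∣∣p∣-∣q∣∣≤∣p-q∣ p q with ℚ.∣p∣≡p∨∣p∣≡-p (∣ p ∣ - ∣ q ∣)
... | inj₁ eq = subst₂ _≤_ (sym eq) (solve 2 (λ d b → (d :+ b) :- b := d) refl ∣ p - q ∣ ∣ q ∣)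
  (ℚ.+-monoˡ-≤ (- ∣ q ∣) (∣p∣≤∣p-q∣+∣q∣ p q))
  where open +-*-Solver
... | inj₂ eq = subst₂ _≤_
  (trans (solve 2 (λ a b → b :- a := :- (a :- b)) refl ∣ p ∣ ∣ q ∣) (sym eq))
  (trans (solve 2 (λ d a → (d :+ a) :- a := d) refl ∣ q - p ∣ ∣ p ∣) (∣∣-swap q p))
  (ℚ.+-monoˡ-≤ (- ∣ p ∣) (∣p∣≤∣p-q∣+∣q∣ q p))
  where open +-*-Solver

/-mono-≤ : ∀ a b m n .{{_ : NonZero m}} .{{_ : NonZero n}} →
           a ℕ.* n ℕ.≤ b ℕ.* m → + a / m ≤ + b / n
/-mono-≤ a b m@(suc _) n@(suc _) an≤bm = ℚ.toℚᵘ-cancel-≤ (begin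
  toℚᵘ (+ a / m)  ≃⟨ ℚ.toℚᵘ-fromℚᵘ (+ a ℚᵘ./ m) ⟩
  + a ℚᵘ./ m      ≤⟨ ℚᵘ.*≤* (subst₂ ℤ._≤_ (ℤ.pos-* a n) (ℤ.pos-* b m) (ℤ.+≤+ an≤bm)) ⟩
  + b ℚᵘ./ n      ≃⟨ ℚᵘ.≃-sym (ℚ.toℚᵘ-fromℚᵘ (+ b ℚᵘ./ n)) ⟩
  toℚᵘ (+ b / n)  ∎)
  where open ℚᵘ.≤-Reasoning

/-* : ∀ a b m n .{{_ : NonZero m}} .{{_ : NonZero n}} .{{_ : NonZero (m ℕ.* n)}} →
      (+ a / m) * (+ b / n) ≡ + (a ℕ.* b) / (m ℕ.* n)
/-* a b m@(suc _) n@(suc _) = ℚ.toℚᵘ-injective (begin-equality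
  toℚᵘ ((+ a / m) * (+ b / n))               ≃⟨ ℚ.toℚᵘ-homo-* (+ a / m) (+ b / n) ⟩
  toℚᵘ (+ a / m) ℚᵘ.* toℚᵘ (+ b / n)         ≃⟨ ℚᵘ.*-cong (ℚ.toℚᵘ-fromℚᵘ (+ a ℚᵘ./ m)) (ℚ.toℚᵘ-fromℚᵘ (+ b ℚᵘ./ n)) ⟩
  (+ a ℚᵘ./ m) ℚᵘ.* (+ b ℚᵘ./ n)             ≡⟨ cong (λ i → i ℚᵘ./ (m ℕ.* n)) (sym (ℤ.pos-* a b)) ⟩
  + (a ℕ.* b) ℚᵘ./ (m ℕ.* n)                 ≃⟨ ℚᵘ.≃-sym (ℚ.toℚᵘ-fromℚᵘ (+ (a ℕ.* b) ℚᵘ./ (m ℕ.* n))) ⟩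
  toℚᵘ (+ (a ℕ.* b) / (m ℕ.* n))             ∎)
  where open ℚᵘ.≤-Reasoning

/-+ : ∀ a b m .{{_ : NonZero m}} → (+ a / m) + (+ b / m) ≡ + (a ℕ.+ b) / m
/-+ a b m@(suc _) = ℚ.toℚᵘ-injective (begin-equality
  toℚᵘ ((+ a / m) + (+ b / m))        ≃⟨ ℚ.toℚᵘ-homo-+ (+ a / m) (+ b / m) ⟩
  toℚᵘ (+ a / m) ℚᵘ.+ toℚᵘ (+ b / m)  ≃⟨ ℚᵘ.+-cong (ℚ.toℚᵘ-fromℚᵘ (+ a ℚᵘ./ m)) (ℚ.toℚᵘ-fromℚᵘ (+ b ℚᵘ./ m)) ⟩
  (+ a ℚᵘ./ m) ℚᵘ.+ (+ b ℚᵘ./ m)      ≃⟨ ℚᵘ.*≡* eq ⟩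
  + (a ℕ.+ b) ℚᵘ./ m                  ≃⟨ ℚᵘ.≃-sym (ℚ.toℚᵘ-fromℚᵘ (+ (a ℕ.+ b) ℚᵘ./ m)) ⟩
  toℚᵘ (+ (a ℕ.+ b) / m)              ∎)
  where
  open ℚᵘ.≤-Reasoning
  eq : (+ a ℤ.* + m ℤ.+ + b ℤ.* + m) ℤ.* + m ≡ + (a ℕ.+ b) ℤ.* + (m ℕ.* m)
  eq = trans (cong (ℤ._* + m) (trans (sym (ℤ.*-distribʳ-+ (+ m) (+ a) (+ b))) refl))
       (trans (ℤ.*-assoc (+ (a ℕ.+ b)) (+ m) (+ m))
              (cong (+ (a ℕ.+ b) ℤ.*_) (sym (ℤ.pos-* m m))))

n/n≡1 : ∀ n .{{_ : NonZero n}} → + n / n ≡ 1ℚ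
n/n≡1 n = ℚ.≤-antisym (/-mono-≤ n 1 n 1 (ℕ.≤-reflexive (ℕ.*-comm n 1)))
                      (/-mono-≤ 1 n 1 n (ℕ.≤-reflexive (ℕ.*-comm 1 n)))

1/suc-pos : ∀ n → 0ℚ < + 1 / suc n
1/suc-pos n = ℚ.positive⁻¹ (+ 1 / suc n) {{ℚ.normalize-pos 1 (suc n)}}

∣p∣≤∣↥p∣ : ∀ p → ∣ p ∣ ≤ + ℤ.∣ ℚ.↥ p ∣ / 1
∣p∣≤∣↥p∣ p = subst (_≤ + ℤ.∣ ℚ.↥ p ∣ / 1) (sym (∣p∣≡ p))
  (/-mono-≤ a a (ℚ.↧ₙ p) 1 (ℕ.*-monoʳ-≤ a (ℕ.s≤s ℕ.z≤n)))
  where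
  a = ℤ.∣ ℚ.↥ p ∣
  ∣p∣≡ : ∀ p → ∣ p ∣ ≡ + ℤ.∣ ℚ.↥ p ∣ / ℚ.↧ₙ p
  ∣p∣≡ p@record{} = sym (ℚ.↥p/↧p≡p ∣ p ∣)

archimedean : ∀ ε → 0ℚ < ε → ∃[ N ] ∀ n → N ℕ.≤ n → + 1 / suc n < ε
archimedean ε 0<ε = N , λ n N≤n → ℚ.≤-<-trans (/-mono-≤ 1 1 (suc n) (suc N)
    (ℕ.*-monoʳ-≤ 1 (ℕ.s≤s N≤n))) 1/N<ε
  where
  i = inv ε 0<ε
  N = ℤ.∣ ℚ.↥ i ∣
  u = + 1 / suc N
  i<sucN : i < + suc N / 1
  i<sucN = begin-strict
    i                    ≤⟨ p≤∣p∣ i ⟩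
    ∣ i ∣                ≤⟨ ∣p∣≤∣↥p∣ i ⟩
    + N / 1              ≡⟨ ℚ.+-identityʳ (+ N / 1) ⟨
    + N / 1 + 0ℚ         <⟨ ℚ.+-monoʳ-< (+ N / 1) (1/suc-pos 0) ⟩
    + N / 1 + 1ℚ         ≡⟨ /-+ N 1 1 ⟩
    + (N ℕ.+ 1) / 1      ≡⟨ cong (λ k → + k / 1) (ℕ.+-comm N 1) ⟩
    + suc N / 1          ∎
    where open ℚ.≤-Reasoning
  1/N<ε : u < ε
  1/N<ε = begin-strict
    u                        ≡⟨ ℚ.*-identityˡ u ⟨
    1ℚ * u                   ≡⟨ cong (_* u) (p*inv ε 0<ε) ⟨
    ε * i * u                ≡⟨ solve 3 (λ e i u → e :* i :* u := (e :* u) :* i) refl ε i u ⟩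
    ε * u * i                <⟨ *-monoʳ-< (ε * u) (*-pos 0<ε (1/suc-pos N)) i<sucN ⟩
    ε * u * (+ suc N / 1)    ≡⟨ ℚ.*-assoc ε u (+ suc N / 1) ⟩
    ε * (u * (+ suc N / 1))  ≡⟨ cong (ε *_) (/-* 1 (suc N) (suc N) 1) ⟩
    ε * (+ (1 ℕ.* suc N) / (suc N ℕ.* 1))
                             ≡⟨ cong (ε *_) (ℚ.≤-antisym
                                  (/-mono-≤ (1 ℕ.* suc N) 1 (suc N ℕ.* 1) 1 (ℕ.≤-reflexive (e₁ (suc N))))
                                  (/-mono-≤ 1 (1 ℕ.* suc N) 1 (suc N ℕ.* 1) (ℕ.≤-reflexive (sym (e₁ (suc N)))))) ⟩
    ε * 1ℚ                   ≡⟨ ℚ.*-identityʳ ε ⟩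
    ε                        ∎
    where
    open ℚ.≤-Reasoning
    open +-*-Solver
    e₁ : ∀ m → 1 ℕ.* m ℕ.* 1 ≡ 1 ℕ.* (m ℕ.* 1)
    e₁ m = ℕ.*-assoc 1 m 1

record ℝ : Set where
  constructor mkℝ
  field
    seq    : ℕ → ℚ
    cauchy : ∀ ε → 0ℚ < ε → ∃[ N ] ∀ m n → N ℕ.≤ m → N ℕ.≤ n → ∣ seq m - seq n ∣ < ε

open ℝ public

Pos : ℝ → Set
Pos x = ∃[ δ ] 0ℚ < δ × ∃[ N ] ∀ n → N ℕ.≤ n → δ ≤ seq x n

fromℚ : ℚ → ℝ
fromℚ q = mkℝ (λ _ → q) λ ε 0<ε →
  0 , λ _ _ _ _ → subst (λ d → ∣ d ∣ < ε) (sym (ℚ.+-inverseʳ q)) 0<ε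

fromℕ : ℕ → ℝ
fromℕ n = fromℚ (+ n / 1)

infixl 6 _-ℝ_
_-ℝ_ : ℝ → ℝ → ℝ
x -ℝ y = mkℝ (λ n → seq x n - seq y n) λ ε 0<ε →
  let N₁ , h₁ = cauchy x (½ * ε) (½-pos 0<ε)
      N₂ , h₂ = cauchy y (½ * ε) (½-pos 0<ε)
  in N₁ ℕ.⊔ N₂ , λ m n N≤m N≤n →
    let open ℚ.≤-Reasoning
        open +-*-Solver
        a = seq x m ; b = seq x n ; c = seq y m ; d = seq y n
    in begin-strict
      ∣ (a - c) - (b - d) ∣    ≡⟨ cong ∣_∣ (solve 4 (λ a b c d → (a :- c) :- (b :- d) := (a :- b) :- (c :- d)) refl a b c d) ⟩
      ∣ (a - b) - (c - d) ∣    ≤⟨ ℚ.∣p-q∣≤∣p∣+∣q∣ (a - b) (c - d) ⟩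
      ∣ a - b ∣ + ∣ c - d ∣    <⟨ ℚ.+-mono-< (h₁ m n (ℕ.m⊔n≤o⇒m≤o N₁ N₂ N≤m) (ℕ.m⊔n≤o⇒m≤o N₁ N₂ N≤n))
                                            (h₂ m n (ℕ.m⊔n≤o⇒n≤o N₁ N₂ N≤m) (ℕ.m⊔n≤o⇒n≤o N₁ N₂ N≤n)) ⟩
      ½ * ε + ½ * ε            ≡⟨ ½+½ ε ⟩
      ε                        ∎

∣_∣ℝ : ℝ → ℝ
∣ x ∣ℝ = mkℝ (λ n → ∣ seq x n ∣) λ ε 0<ε →
  let N , h = cauchy x ε 0<ε
  in N , λ m n N≤m N≤n → ℚ.≤-<-trans (∣∣p∣-∣q∣∣≤∣p-q∣ (seq x m) (seq x n)) (h m n N≤m N≤n)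

infix 4 _<ℝ_
_<ℝ_ : ℝ → ℝ → Set
x <ℝ y = Pos (y -ℝ x)

bounded : ∀ x → ∃[ b ] 0ℚ < b × ∃[ N ] ∀ n → N ℕ.≤ n → ∣ seq x n ∣ ≤ b
bounded x = b , 0<b , N , λ n N≤n → begin
    ∣ seq x n ∣                          ≤⟨ ∣p∣≤∣p-q∣+∣q∣ (seq x n) (seq x N) ⟩
    ∣ seq x n - seq x N ∣ + ∣ seq x N ∣  ≤⟨ ℚ.+-monoˡ-≤ ∣ seq x N ∣ (ℚ.<⇒≤ (h n N N≤n ℕ.≤-refl)) ⟩
    1ℚ + ∣ seq x N ∣                     ∎
  where
  open ℚ.≤-Reasoning
  c = cauchy x 1ℚ (ℚ.positive⁻¹ 1ℚ)
  N = proj₁ c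
  h = proj₂ c
  b = 1ℚ + ∣ seq x N ∣
  0<b : 0ℚ < b
  0<b = ℚ.+-mono-<-≤ (ℚ.positive⁻¹ 1ℚ) (ℚ.0≤∣p∣ (seq x N))

infixl 7 _*ℝ_
_*ℝ_ : ℝ → ℝ → ℝ
x *ℝ y = mkℝ (λ n → seq x n * seq y n) go
  where
  bx  = proj₁ (bounded x)
  by  = proj₁ (bounded y)
  0<bx = proj₁ (proj₂ (bounded x))
  0<by = proj₁ (proj₂ (bounded y))
  Nx  = proj₁ (proj₂ (proj₂ (bounded x)))
  Ny  = proj₁ (proj₂ (proj₂ (bounded y)))
  hx  = proj₂ (proj₂ (proj₂ (bounded x)))
  hy  = proj₂ (proj₂ (proj₂ (bounded y)))
  part : ∀ {b} (0<b : 0ℚ < b) ε p q → ∣ p ∣ ≤ b → ∣ q ∣ < ε * inv b 0<b → ∣ p * q ∣ < ε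
  part {b} 0<b ε p q p≤b q< = begin-strict
    ∣ p * q ∣            ≡⟨ ℚ.∣p*q∣≡∣p∣*∣q∣ p q ⟩
    ∣ p ∣ * ∣ q ∣        ≤⟨ *-monoˡ-≤ ∣ q ∣ (ℚ.0≤∣p∣ q) p≤b ⟩
    b * ∣ q ∣            <⟨ *-monoʳ-< b 0<b q< ⟩
    b * (ε * inv b 0<b)  ≡⟨ solve 3 (λ b e i → b :* (e :* i) := e :* (b :* i)) refl b ε (inv b 0<b) ⟩
    ε * (b * inv b 0<b)  ≡⟨ cong (ε *_) (p*inv b 0<b) ⟩
    ε * 1ℚ               ≡⟨ ℚ.*-identityʳ ε ⟩
    ε                    ∎
    where
    open ℚ.≤-Reasoning
    open +-*-Solver
  go : ∀ ε → 0ℚ < ε → ∃[ N ] ∀ m n → N ℕ.≤ m → N ℕ.≤ n →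
       ∣ seq x m * seq y m - seq x n * seq y n ∣ < ε
  go ε 0<ε =
    let e = ½ * ε
        N₁ , h₁ = cauchy x (e * inv by 0<by) (*-pos (½-pos 0<ε) (inv-pos by 0<by))
        N₂ , h₂ = cauchy y (e * inv bx 0<bx) (*-pos (½-pos 0<ε) (inv-pos bx 0<bx))
        M₁ = N₁ ℕ.⊔ N₂
        M₂ = Nx ℕ.⊔ Ny
    in M₁ ℕ.⊔ M₂ , λ m n N≤m N≤n →
      let open ℚ.≤-Reasoning
          open +-*-Solver
          a = seq x m ; b = seq x n ; c = seq y m ; d = seq y n
          M₁≤m = ℕ.m⊔n≤o⇒m≤o M₁ M₂ N≤m
          M₁≤n = ℕ.m⊔n≤o⇒m≤o M₁ M₂ N≤n
          M₂≤m = ℕ.m⊔n≤o⇒n≤o M₁ M₂ N≤m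
          M₂≤n = ℕ.m⊔n≤o⇒n≤o M₁ M₂ N≤n
      in begin-strict
        ∣ a * c - b * d ∣                      ≡⟨ cong ∣_∣ (solve 4 (λ a b c d → a :* c :- b :* d := a :* (c :- d) :+ d :* (a :- b)) refl a b c d) ⟩
        ∣ a * (c - d) + d * (a - b) ∣          ≤⟨ ℚ.∣p+q∣≤∣p∣+∣q∣ (a * (c - d)) (d * (a - b)) ⟩
        ∣ a * (c - d) ∣ + ∣ d * (a - b) ∣      <⟨ ℚ.+-mono-<
             (part 0<bx e a (c - d) (hx m (ℕ.m⊔n≤o⇒m≤o Nx Ny M₂≤m))
                (h₂ m n (ℕ.m⊔n≤o⇒n≤o N₁ N₂ M₁≤m) (ℕ.m⊔n≤o⇒n≤o N₁ N₂ M₁≤n)))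
             (part 0<by e d (a - b) (hy n (ℕ.m⊔n≤o⇒n≤o Nx Ny M₂≤n))
                (h₁ m n (ℕ.m⊔n≤o⇒m≤o N₁ N₂ M₁≤m) (ℕ.m⊔n≤o⇒m≤o N₁ N₂ M₁≤n))) ⟩
        e + e                                  ≡⟨ ½+½ ε ⟩
        ε                                      ∎

record ℝ⁺ : Set where
  constructor mkℝ⁺
  field
    val : ℝ
    pos : Pos val

open ℝ⁺ public

fromℕ⁺ : (n : ℕ) .{{_ : NonZero n}} → ℝ⁺
fromℕ⁺ n@(suc _) = mkℝ⁺ (fromℕ n)
  (+ n / 1 , ℚ.positive⁻¹ (+ n / 1) {{ℚ.normalize-pos n 1}} , 0 , λ _ _ → ℚ.≤-refl)

infixl 7 _*⁺_
_*⁺_ : ℝ⁺ → ℝ⁺ → ℝ⁺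
mkℝ⁺ x (δ , 0<δ , N , h) *⁺ mkℝ⁺ y (δ′ , 0<δ′ , N′ , h′) = mkℝ⁺ (x *ℝ y)
  (δ * δ′ , *-pos 0<δ 0<δ′ , N ℕ.⊔ N′ , λ n N≤n →
    *-mono-≤ (ℚ.<⇒≤ 0<δ) (ℚ.<⇒≤ 0<δ′)
      (h n (ℕ.m⊔n≤o⇒m≤o N N′ N≤n)) (h′ n (ℕ.m⊔n≤o⇒n≤o N N′ N≤n)))

-- The n-th term is 1 / xₙ as soon as xₙ is at least the positive lower bound δ
-- of x; taking the maximum with δ makes the sequence total.
infix 8 _⁻¹
_⁻¹ : ℝ⁺ → ℝ⁺
mkℝ⁺ x (δ , 0<δ , N , h) ⁻¹ = mkℝ⁺ (mkℝ s cau)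
  ( inv b 0<b , inv-pos b 0<b , N ℕ.⊔ Nb , λ n N≤n →
      inv-anti (0<⊔ n) 0<b (subst (_≤ b) (sym (ℚ.p≥q⇒p⊔q≡p (h n (ℕ.m⊔n≤o⇒m≤o N Nb N≤n))))
        (ℚ.≤-trans (p≤∣p∣ (seq x n)) (hb n (ℕ.m⊔n≤o⇒n≤o N Nb N≤n)))))
  where
  b   = proj₁ (bounded x)
  0<b = proj₁ (proj₂ (bounded x))
  Nb  = proj₁ (proj₂ (proj₂ (bounded x)))
  hb  = proj₂ (proj₂ (proj₂ (bounded x)))
  0<⊔ : ∀ n → 0ℚ < seq x n ⊔ δ
  0<⊔ n = ℚ.<-≤-trans 0<δ (ℚ.p≤q⊔p (seq x n) δ)
  s : ℕ → ℚ
  s n = inv (seq x n ⊔ δ) (0<⊔ n)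
  i = inv δ 0<δ
  0<i = inv-pos δ 0<δ
  s≤i : ∀ n → s n ≤ i
  s≤i n = inv-anti 0<δ (0<⊔ n) (ℚ.p≤q⊔p (seq x n) δ)
  0≤s : ∀ n → 0ℚ ≤ s n
  0≤s n = ℚ.<⇒≤ (inv-pos (seq x n ⊔ δ) (0<⊔ n))
  cau : ∀ ε → 0ℚ < ε → ∃[ N ] ∀ m n → N ℕ.≤ m → N ℕ.≤ n → ∣ s m - s n ∣ < ε
  cau ε 0<ε =
    let M , k = cauchy x (ε * (δ * δ)) (*-pos 0<ε (*-pos 0<δ 0<δ))
    in N ℕ.⊔ M , λ m n N≤m N≤n →
      let open ℚ.≤-Reasoning
          open +-*-Solver
          a = seq x m ; c = seq x n ; a′ = a ⊔ δ ; c′ = c ⊔ δ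
          p = s m ; q = s n
      in begin-strict
        ∣ p - q ∣                    ≡⟨ cong₂ (λ p q → ∣ p - q ∣) (sym (ℚ.*-identityʳ p)) (sym (ℚ.*-identityʳ q)) ⟩
        ∣ p * 1ℚ - q * 1ℚ ∣          ≡⟨ cong₂ (λ u v → ∣ p * u - q * v ∣) (sym (p*inv c′ (0<⊔ n))) (sym (p*inv a′ (0<⊔ m))) ⟩
        ∣ p * (c′ * q) - q * (a′ * p) ∣
                                     ≡⟨ cong ∣_∣ (solve 4 (λ a c p q → p :* (c :* q) :- q :* (a :* p) := (p :* q) :* (c :- a)) refl a′ c′ p q) ⟩
        ∣ (p * q) * (c′ - a′) ∣      ≡⟨ ℚ.∣p*q∣≡∣p∣*∣q∣ (p * q) (c′ - a′) ⟩
        ∣ p * q ∣ * ∣ c′ - a′ ∣      ≡⟨ cong (_* ∣ c′ - a′ ∣) (ℚ.0≤p⇒∣p∣≡p (subst (_≤ p * q) (ℚ.*-zeroˡ 0ℚ)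
                                          (*-mono-≤ ℚ.≤-refl ℚ.≤-refl (0≤s m) (0≤s n)))) ⟩
        (p * q) * ∣ c′ - a′ ∣        ≤⟨ *-monoˡ-≤ ∣ c′ - a′ ∣ (ℚ.0≤∣p∣ (c′ - a′)) (*-mono-≤ (0≤s m) (0≤s n) (s≤i m) (s≤i n)) ⟩
        (i * i) * ∣ c′ - a′ ∣        ≡⟨ cong₂ (λ u v → (i * i) * ∣ u - v ∣) (ℚ.p≥q⇒p⊔q≡p (h n (ℕ.m⊔n≤o⇒m≤o N M N≤n))) (ℚ.p≥q⇒p⊔q≡p (h m (ℕ.m⊔n≤o⇒m≤o N M N≤m))) ⟩
        (i * i) * ∣ c - a ∣          <⟨ *-monoʳ-< (i * i) (*-pos 0<i 0<i) (k n m (ℕ.m⊔n≤o⇒n≤o N M N≤n) (ℕ.m⊔n≤o⇒n≤o N M N≤m)) ⟩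
        (i * i) * (ε * (δ * δ))      ≡⟨ solve 3 (λ i e d → (i :* i) :* (e :* (d :* d)) := e :* ((d :* i) :* (d :* i))) refl i ε δ ⟩
        ε * ((δ * i) * (δ * i))      ≡⟨ cong (λ u → ε * (u * u)) (p*inv δ 0<δ) ⟩
        ε * (1ℚ * 1ℚ)                ≡⟨ ℚ.*-identityʳ ε ⟩
        ε                            ∎

-- The largest s ≤ b with s² ≤ q, for q ≥ 0.
sqrtBelow : ℕ → ℚ → ℕ
sqrtBelow zero    q = 0
sqrtBelow (suc b) q =
  if does ((+ (suc b ℕ.* suc b) / 1) ℚ.≤? q) then suc b else sqrtBelow b q

-- The largest s with s² ≤ |q|; the absolute value of the numerator of q is an
-- upper bound for it.
⌊√∣_∣⌋ : ℚ → ℕ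
⌊√∣ q ∣⌋ = sqrtBelow ℤ.∣ ℚ.↥ q ∣ ∣ q ∣

if-elim : ∀ {A : Set} {x y : ℕ} (P : ℕ → Set) (a? : Dec A) →
          (A → P x) → (¬ A → P y) → P (if does a? then x else y)
if-elim P (yes a) f g = f a
if-elim P (no ¬a) f g = g ¬a

sqrtBelow-lower : ∀ b q → 0ℚ ≤ q → let s = sqrtBelow b q in + (s ℕ.* s) / 1 ≤ q
sqrtBelow-lower zero    q 0≤q = 0≤q
sqrtBelow-lower (suc b) q 0≤q = if-elim (λ s → + (s ℕ.* s) / 1 ≤ q)
  ((+ (suc b ℕ.* suc b) / 1) ℚ.≤? q) (λ p → p) (λ _ → sqrtBelow-lower b q 0≤q)

sqrtBelow-upper : ∀ b q → q < + (suc b ℕ.* suc b) / 1 →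
                  let s = suc (sqrtBelow b q) in q < + (s ℕ.* s) / 1
sqrtBelow-upper zero    q q< = q<
sqrtBelow-upper (suc b) q q< = if-elim (λ s → q < + (suc s ℕ.* suc s) / 1)
  ((+ (suc b ℕ.* suc b) / 1) ℚ.≤? q) (λ _ → q<) (λ ¬p → sqrtBelow-upper b q (ℚ.≰⇒> ¬p))

sqrtApprox : ℚ → ℕ → ℚ
sqrtApprox q n = + ⌊√∣ q * (+ (suc n ℕ.* suc n) / 1) ∣⌋ / suc n

module SqrtApprox (q : ℚ) (n : ℕ) where

  private
    M  = suc n
    M² = + (M ℕ.* M) / 1
    s  = ⌊√∣ q * M² ∣⌋
    v  = + 1 / (M ℕ.* M)

  M²v≡1 : M² * v ≡ 1ℚ
  M²v≡1 = trans (/-* (M ℕ.* M) 1 1 (M ℕ.* M))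
    (trans (ℚ./-cong (cong +_ (ℕ.*-identityʳ (M ℕ.* M))) (ℕ.*-identityˡ (M ℕ.* M))) (n/n≡1 (M ℕ.* M)))

  scale : ∀ t → (+ t / M) * (+ t / M) ≡ (+ (t ℕ.* t) / 1) * v
  scale t = trans (/-* t t M M)
    (sym (trans (/-* (t ℕ.* t) 1 1 (M ℕ.* M))
      (ℚ./-cong (cong +_ (ℕ.*-identityʳ (t ℕ.* t))) (ℕ.*-identityˡ (M ℕ.* M)))))

  0<v : 0ℚ < v
  0<v = 1/suc-pos (n ℕ.+ n ℕ.* suc n)

  ∣q∣≡ : ∣ q * M² ∣ * v ≡ ∣ q ∣
  ∣q∣≡ = begin
    ∣ q * M² ∣ * v     ≡⟨ cong (_* v) (ℚ.∣p*q∣≡∣p∣*∣q∣ q M²) ⟩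
    ∣ q ∣ * ∣ M² ∣ * v ≡⟨ cong (λ m → ∣ q ∣ * m * v) (ℚ.0≤p⇒∣p∣≡p 0≤M²) ⟩
    ∣ q ∣ * M² * v     ≡⟨ ℚ.*-assoc ∣ q ∣ M² v ⟩
    ∣ q ∣ * (M² * v)   ≡⟨ cong (∣ q ∣ *_) M²v≡1 ⟩
    ∣ q ∣ * 1ℚ         ≡⟨ ℚ.*-identityʳ ∣ q ∣ ⟩
    ∣ q ∣              ∎
    where
    open ≡-Reasoning
    0≤M² : 0ℚ ≤ M²
    0≤M² = /-mono-≤ 0 (M ℕ.* M) 1 1 ℕ.z≤n

  nonNeg : 0ℚ ≤ sqrtApprox q n
  nonNeg = /-mono-≤ 0 s 1 M ℕ.z≤n

  lower : sqrtApprox q n * sqrtApprox q n ≤ ∣ q ∣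
  lower = subst₂ _≤_ (sym (scale s)) ∣q∣≡
    (*-monoˡ-≤ v (ℚ.<⇒≤ 0<v) (sqrtBelow-lower ℤ.∣ ℚ.↥ (q * M²) ∣ ∣ q * M² ∣ (ℚ.0≤∣p∣ (q * M²))))

  upper : ∣ q ∣ < (sqrtApprox q n + (+ 1 / M)) * (sqrtApprox q n + (+ 1 / M))
  upper = subst₂ _<_ ∣q∣≡ eq (ℚ.*-monoˡ-<-pos v {{positive 0<v}} (sqrtBelow-upper b ∣ q * M² ∣ b<))
    where
    b = ℤ.∣ ℚ.↥ (q * M²) ∣
    b< : ∣ q * M² ∣ < + (suc b ℕ.* suc b) / 1
    b< = begin-strict
      ∣ q * M² ∣                 ≤⟨ ∣p∣≤∣↥p∣ (q * M²) ⟩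
      + b / 1                    ≡⟨ ℚ.+-identityʳ (+ b / 1) ⟨
      + b / 1 + 0ℚ               <⟨ ℚ.+-monoʳ-< (+ b / 1) (1/suc-pos 0) ⟩
      + b / 1 + 1ℚ               ≡⟨ /-+ b 1 1 ⟩
      + (b ℕ.+ 1) / 1            ≤⟨ /-mono-≤ (b ℕ.+ 1) (suc b ℕ.* suc b) 1 1
                                      (ℕ.*-monoˡ-≤ 1 (ℕ.≤-trans (ℕ.≤-reflexive (ℕ.+-comm b 1)) (ℕ.m≤m*n (suc b) (suc b)))) ⟩
      + (suc b ℕ.* suc b) / 1    ∎
      where open ℚ.≤-Reasoning
    eq : (+ (suc s ℕ.* suc s) / 1) * v ≡ (sqrtApprox q n + (+ 1 / M)) * (sqrtApprox q n + (+ 1 / M))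
    eq = trans (sym (scale (suc s))) (cong (λ r → r * r)
      (sym (trans (/-+ s 1 M) (cong (λ k → + k / M) (ℕ.+-comm s 1)))))

module _ (x : ℝ) where

  private
    r : ℕ → ℚ
    r n = sqrtApprox (seq x n) n
    u : ℕ → ℚ
    u n = + 1 / suc n

  sqrtℝ-close : ∀ c → 0ℚ < c → ∀ m n → ∣ seq x m - seq x n ∣ < c * c → u n < c → r m < r n + (c + c)
  sqrtℝ-close c 0<c m n d< u<c = ℚ.<-trans r< (ℚ.+-monoʳ-< (r n) (ℚ.+-monoˡ-< c u<c))
    where
    open ℚ.≤-Reasoning
    open +-*-Solver
    a = seq x m
    b = seq x n
    t = r n + u n
    0≤t : 0ℚ ≤ t
    0≤t = ℚ.+-mono-≤ (SqrtApprox.nonNeg b n) (ℚ.<⇒≤ (1/suc-pos n))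
    0≤tc : 0ℚ ≤ t * c
    0≤tc = subst (_≤ t * c) (ℚ.*-zeroˡ 0ℚ) (*-mono-≤ ℚ.≤-refl ℚ.≤-refl 0≤t (ℚ.<⇒≤ 0<c))
    sq< : r m * r m < (t + c) * (t + c)
    sq< = begin-strict
      r m * r m                          ≤⟨ SqrtApprox.lower a m ⟩
      ∣ a ∣                              ≤⟨ ∣p∣≤∣p-q∣+∣q∣ a b ⟩
      ∣ a - b ∣ + ∣ b ∣                  <⟨ ℚ.+-mono-< d< (SqrtApprox.upper b n) ⟩
      c * c + t * t                      ≡⟨ ℚ.+-identityʳ (c * c + t * t) ⟨
      (c * c + t * t) + 0ℚ               ≤⟨ ℚ.+-monoʳ-≤ (c * c + t * t) (ℚ.+-mono-≤ 0≤tc 0≤tc) ⟩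
      (c * c + t * t) + (t * c + t * c)  ≡⟨ solve 2 (λ t c → (c :* c :+ t :* t) :+ (t :* c :+ t :* c) := (t :+ c) :* (t :+ c)) refl t c ⟩
      (t + c) * (t + c)                  ∎
    r< : r m < r n + (u n + c)
    r< = subst (r m <_) (ℚ.+-assoc (r n) (u n) c)
      (sq-cancel-< (ℚ.+-mono-≤ 0≤t (ℚ.<⇒≤ 0<c)) sq<)

  √∣_∣ℝ : ℝ
  √∣_∣ℝ = mkℝ r λ ε 0<ε →
    let c = ½ * ε
        0<c = ½-pos 0<ε
        N₁ , h₁ = cauchy x (c * c) (*-pos 0<c 0<c)
        N₂ , h₂ = archimedean c 0<c
    in N₁ ℕ.⊔ N₂ , λ m n N≤m N≤n →
      let d< = h₁ m n (ℕ.m⊔n≤o⇒m≤o N₁ N₂ N≤m) (ℕ.m⊔n≤o⇒m≤o N₁ N₂ N≤n)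
      in <+⇒∣-∣<
        (subst (λ e → r m < r n + e) (½+½ ε)
          (sqrtℝ-close c 0<c m n d< (h₂ n (ℕ.m⊔n≤o⇒n≤o N₁ N₂ N≤n))))
        (subst (λ e → r n < r m + e) (½+½ ε)
          (sqrtℝ-close c 0<c n m (subst (_< c * c) (∣∣-swap (seq x m) (seq x n)) d<)
            (h₂ m (ℕ.m⊔n≤o⇒n≤o N₁ N₂ N≤m))))

-- The n-th term is ⌊(n+1) √∣xₙ∣⌋ / (n+1), and xₙ is eventually positive.
infix 9 √_
√_ : ℝ⁺ → ℝ⁺
√ (mkℝ⁺ x (δ , 0<δ , N , h)) = mkℝ⁺ √∣ x ∣ℝ (½ * c , ½-pos 0<c , N ℕ.⊔ N′ , bound)
  where
  c = δ ⊓ 1ℚ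
  0<c : 0ℚ < c
  0<c with ℚ.≤-total δ 1ℚ
  ... | inj₁ δ≤1 = subst (0ℚ <_) (sym (ℚ.p≤q⇒p⊓q≡p δ≤1)) 0<δ
  ... | inj₂ 1≤δ = subst (0ℚ <_) (sym (ℚ.p≥q⇒p⊓q≡q 1≤δ)) (ℚ.positive⁻¹ 1ℚ)
  c²≤δ : c * c ≤ δ
  c²≤δ = ℚ.≤-trans (*-mono-≤ (ℚ.<⇒≤ 0<c) (ℚ.<⇒≤ 0<c) (ℚ.p⊓q≤p δ 1ℚ) (ℚ.p⊓q≤q δ 1ℚ))
                   (ℚ.≤-reflexive (ℚ.*-identityʳ δ))
  N′ = proj₁ (archimedean (½ * c) (½-pos 0<c))
  h′ = proj₂ (archimedean (½ * c) (½-pos 0<c))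
  bound : ∀ n → N ℕ.⊔ N′ ℕ.≤ n → ½ * c ≤ sqrtApprox (seq x n) n
  bound n N≤n = begin
    ½ * c              ≡⟨ solve 1 (λ e → e := (e :+ e) :- e) refl (½ * c) ⟩
    (½ * c + ½ * c) - ½ * c
                       ≡⟨ cong (_- ½ * c) (½+½ c) ⟩
    c - ½ * c          ≤⟨ ℚ.+-monoˡ-≤ (- (½ * c)) (ℚ.<⇒≤ c<) ⟩
    (t + ½ * c) - ½ * c ≡⟨ solve 2 (λ t e → (t :+ e) :- e := t) refl t (½ * c) ⟩
    t                  ∎
    where
    open ℚ.≤-Reasoning
    open +-*-Solver
    t = sqrtApprox (seq x n) n
    w = + 1 / suc n
    0≤t+w : 0ℚ ≤ t + w
    0≤t+w = ℚ.+-mono-≤ (SqrtApprox.nonNeg (seq x n) n) (ℚ.<⇒≤ (1/suc-pos n))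
    c< : c < t + ½ * c
    c< = ℚ.<-trans
      (sq-cancel-< 0≤t+w (ℚ.≤-<-trans c²≤δ (ℚ.≤-<-trans
        (ℚ.≤-trans (h n (ℕ.m⊔n≤o⇒m≤o N N′ N≤n)) (p≤∣p∣ (seq x n)))
        (SqrtApprox.upper (seq x n) n))))
      (ℚ.+-monoʳ-< t (h′ n (ℕ.m⊔n≤o⇒n≤o N N′ N≤n)))

infixr 8 _^⁺_ _^ᶻ_

_^⁺_ : ℝ⁺ → ℕ → ℝ⁺
x ^⁺ zero  = fromℕ⁺ 1
x ^⁺ suc n = x *⁺ (x ^⁺ n)

_^ᶻ_ : ℝ⁺ → ℤ → ℝ⁺
x ^ᶻ (+ n)    = x ^⁺ n
x ^ᶻ -[1+ n ] = (x ^⁺ suc n) ⁻¹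

-- x ^[ m /2] is x raised to the real exponent m/2.
infix 8 _^[_/2]
_^[_/2] : ℝ⁺ → ℤ → ℝ⁺
x ^[ m /2] = (√ x) ^ᶻ m

-- altSum a n = a 0 - a 1 + a 2 - … ± a (n - 1)
altSum : (ℕ → ℚ) → ℕ → ℚ
altSum a zero    = 0ℚ
altSum a (suc n) = a 0 - altSum (a ∘ suc) n

-- The absolute values of the terms of π = 4/1 - 4/3 + 4/5 - …
leibniz : ℕ → ℚ
leibniz i = + 4 / suc (2 ℕ.* i)

module Alternating where

  Decreasing : (ℕ → ℚ) → Set
  Decreasing a = ∀ n → a (suc n) ≤ a n

  NonNegative : (ℕ → ℚ) → Set
  NonNegative a = ∀ n → 0ℚ ≤ a n

  bounds : ∀ a → NonNegative a → Decreasing a → ∀ n → 0ℚ ≤ altSum a n × altSum a n ≤ a 0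
  bounds a nn dec zero = ℚ.≤-refl , nn 0
  bounds a nn dec (suc n) =
    let lo , hi = bounds (a ∘ suc) (nn ∘ suc) (dec ∘ suc) n
        b = altSum (a ∘ suc) n
    in ℚ.≤-trans (ℚ.≤-reflexive (sym (ℚ.+-inverseʳ (a 0))))
         (ℚ.+-monoʳ-≤ (a 0) (ℚ.neg-antimono-≤ (ℚ.≤-trans hi (dec 0)))) ,
       ℚ.≤-trans (ℚ.+-monoʳ-≤ (a 0) (ℚ.neg-antimono-≤ lo)) (ℚ.≤-reflexive (ℚ.+-identityʳ (a 0)))

  diff : ∀ a → NonNegative a → Decreasing a → ∀ m d → ∣ altSum a (m ℕ.+ d) - altSum a m ∣ ≤ a m
  diff a nn dec zero d =
    let lo , hi = bounds a nn dec d
    in subst (_≤ a 0) (sym (trans (cong ∣_∣ (ℚ.+-identityʳ (altSum a d))) (ℚ.0≤p⇒∣p∣≡p lo))) hi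
  diff a nn dec (suc m) d = subst (_≤ a (suc m))
    (trans (∣∣-swap p q) (cong ∣_∣ (solve 3 (λ a p q → q :- p := (a :- p) :- (a :- q)) refl (a 0) p q)))
    (diff (a ∘ suc) (nn ∘ suc) (dec ∘ suc) m d)
    where
    open +-*-Solver
    p = altSum (a ∘ suc) (m ℕ.+ d)
    q = altSum (a ∘ suc) m

leibniz-nonNeg : Alternating.NonNegative leibniz
leibniz-nonNeg i = /-mono-≤ 0 4 1 (suc (2 ℕ.* i)) ℕ.z≤n

leibniz-anti : ∀ {i j} → i ℕ.≤ j → leibniz j ≤ leibniz i
leibniz-anti {i} {j} i≤j = /-mono-≤ 4 4 (suc (2 ℕ.* j)) (suc (2 ℕ.* i))
  (ℕ.*-monoʳ-≤ 4 (ℕ.s≤s (ℕ.*-monoʳ-≤ 2 i≤j)))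

leibniz-dec : Alternating.Decreasing leibniz
leibniz-dec i = leibniz-anti (ℕ.n≤1+n i)

leibniz→0 : ∀ ε → 0ℚ < ε → ∃[ N ] leibniz N < ε
leibniz→0 ε 0<ε =
  let N , h = archimedean (½ * (½ * ε)) (½-pos (½-pos 0<ε))
      u = + 1 / suc N
      open ℚ.≤-Reasoning
  in N , (begin-strict
    leibniz N              ≤⟨ /-mono-≤ 4 4 (suc (2 ℕ.* N)) (suc N) (ℕ.*-monoʳ-≤ 4 (ℕ.s≤s (ℕ.m≤n*m N 2))) ⟩
    + 4 / suc N            ≡⟨ /-+ 2 2 (suc N) ⟨
    (+ 2 / suc N) + (+ 2 / suc N)
                           ≡⟨ cong₂ _+_ (sym (/-+ 1 1 (suc N))) (sym (/-+ 1 1 (suc N))) ⟩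
    (u + u) + (u + u)      <⟨ ℚ.+-mono-< (ℚ.+-mono-< (h N ℕ.≤-refl) (h N ℕ.≤-refl)) (ℚ.+-mono-< (h N ℕ.≤-refl) (h N ℕ.≤-refl)) ⟩
    (½ * (½ * ε) + ½ * (½ * ε)) + (½ * (½ * ε) + ½ * (½ * ε))
                           ≡⟨ cong₂ _+_ (½+½ (½ * ε)) (½+½ (½ * ε)) ⟩
    ½ * ε + ½ * ε          ≡⟨ ½+½ ε ⟩
    ε                      ∎)

π : ℝ⁺
π = mkℝ⁺ (mkℝ (altSum leibniz) cau)
  (leibniz 0 - leibniz 1 , ℚ.positive⁻¹ (leibniz 0 - leibniz 1) , 1 , low)
  where
  close : ∀ N n → N ℕ.≤ n → ∣ altSum leibniz n - altSum leibniz N ∣ ≤ leibniz N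
  close N n N≤n = subst (λ k → ∣ altSum leibniz k - altSum leibniz N ∣ ≤ leibniz N) (ℕ.m+[n∸m]≡n N≤n)
    (Alternating.diff leibniz leibniz-nonNeg leibniz-dec N (n ℕ.∸ N))
  cau : ∀ ε → 0ℚ < ε → ∃[ N ] ∀ m n → N ℕ.≤ m → N ℕ.≤ n → ∣ altSum leibniz m - altSum leibniz n ∣ < ε
  cau ε 0<ε =
    let N , h = leibniz→0 (½ * ε) (½-pos 0<ε)
        s = altSum leibniz
    in N , λ m n N≤m N≤n →
      let open ℚ.≤-Reasoning
          open +-*-Solver
      in begin-strict
        ∣ s m - s n ∣                      ≡⟨ cong ∣_∣ (solve 3 (λ a b c → a :- b := (a :- c) :- (b :- c)) refl (s m) (s n) (s N)) ⟩
        ∣ (s m - s N) - (s n - s N) ∣      ≤⟨ ℚ.∣p-q∣≤∣p∣+∣q∣ (s m - s N) (s n - s N) ⟩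
        ∣ s m - s N ∣ + ∣ s n - s N ∣      ≤⟨ ℚ.+-mono-≤ (close N m N≤m) (close N n N≤n) ⟩
        leibniz N + leibniz N              <⟨ ℚ.+-mono-< h h ⟩
        ½ * ε + ½ * ε                      ≡⟨ ½+½ ε ⟩
        ε                                  ∎
  low : ∀ n → 1 ℕ.≤ n → leibniz 0 - leibniz 1 ≤ altSum leibniz n
  low (suc n) _ = ℚ.+-monoʳ-≤ (leibniz 0) (ℚ.neg-antimono-≤
    (proj₂ (Alternating.bounds (leibniz ∘ suc) (leibniz-nonNeg ∘ suc) (leibniz-dec ∘ suc) n)))

-- Sequences are indexed by n ≥ 1.
infix 4 _⟶_ _∼_

_⟶_ : ((n : ℕ) .{{_ : NonZero n}} → ℝ) → ℝ → Set
u ⟶ ℓ = ∀ ε → Pos ε → ∃[ N ] ∀ n .{{_ : NonZero n}} → N ℕ.≤ n → ∣ u n -ℝ ℓ ∣ℝ <ℝ ε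

_∼_ : ((n : ℕ) .{{_ : NonZero n}} → ℝ) → ((n : ℕ) .{{_ : NonZero n}} → ℝ⁺) → Set
f ∼ g = (λ n → f n *ℝ val (g n ⁻¹)) ⟶ fromℕ 1

{-# OPTIONS --safe #-}

-- Two random words of length n over k letters are rearrangements of each other with probability
-- pₖ(n) = fₖ(n) / k²ⁿ. Splitting off one letter gives pₖ₊₁(n) = Σ_{i+j=n} b(i,j)² pₖ(j), where b is the
-- binomial distribution with probabilities x = 1/(k+1) and y = k/(k+1). Its weights decay exponentially away
-- from the mean, so pₖ(j) may be replaced by its value at j ≈ yn. The remaining factor Σ b² is the average of
-- wₘ = (2m choose m) / 4ᵐ over a binomial variable m with success probability 4xy, because
-- |x + y e^{iθ}|² = (x - y)² + 4xy cos²(θ/2), and the same concentration argument evaluates it. By induction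
-- pₖ(n)² is asymptotic to kᵏ (wₙ²/4)ᵏ⁻¹; working with squares keeps everything rational.
--
-- It remains to see that n wₙ² → 1/π for Leibniz' π. Multiplying the i-th term of 4 - 4/3 + 4/5 - … by
-- (2n+1 choose n-i) / (2n+1 choose n) gives a sum equal to 4(n+1) / ((2n+1)² wₙ²), by a recurrence in n; as these
-- factors decrease in i and tend to 1 as n → ∞, the alternating sums have the same limit.

module Submission where

-- The limits involve π and square roots, so the estimates never name one. Asymptotic equality means
-- that the quotient eventually lies between 1/r and r, for every rational r > 1; that n wₙ² or a
-- normalised pₖ(n)² converges is expressed by comparing its values at two independent large
-- indices. This multiplicative form passes through products, powers and square roots.
--
-- The delicate point of the averaging is that Σ b² and pₖ(j) themselves tend to 0 like powers of n.
-- The part of the sum away from the mean must be small relative to that, so a variance bound would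
-- not do. Decay faster than every power of n does, and then very crude polynomial lower bounds for
-- the main term are enough.
--
-- For each n the quotient in the theorem is a real number, given by a sequence in a further index m
-- in which π is replaced by its m-th partial sum. The threshold for n must not depend on m, hence
-- the estimates that are uniform in pairs of indices.

module Estimates where

  open import Algebra.Bundles using (CommutativeRing)
  import Algebra.Properties.CommutativeSemiring.Exp as Exp
  open import Data.Fin using (Fin; zero; suc)
  import Data.Fin.Properties as Fin
  import Data.Integer as ℤ
  open import Data.List as List using (List; []; _∷_; length; filter; map; mapMaybe; replicate; allFin; cartesianProductWith)
  import Data.List.Properties as List
  open import Data.List.Relation.Binary.Permutation.Propositional using (_↭_; prep; ↭-sym; ↭-trans; ↭-refl; ↭-reflexive)
  import Data.List.Relation.Binary.Permutation.Propositional.Properties as ↭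
  open import Data.Maybe using (Maybe; just; nothing)
  open import Data.Nat as ℕ using (ℕ; zero; suc; NonZero)
  import Data.Nat.Properties as ℕ
  import Data.Nat.DivMod as ℕ
  open import Data.Product using (∃-syntax; _×_; _,_; proj₁; proj₂)
  open import Data.Rational as ℚ
    using (ℚ; 0ℚ; 1ℚ; ½; _+_; _*_; _-_; -_; _≤_; _<_; ∣_∣; _⊔_; _/_; positive; nonNegative)
  import Data.Rational.Properties as ℚ
  open import Data.Sum using (_⊎_; inj₁; inj₂)
  open import Data.Vec as Vec using (Vec; []; _∷_; toList)
  import Data.Vec.Properties as Vec
  open import Function using (_∘_; case_of_)
  open import Level using (0ℓ)
  open import Relation.Binary.PropositionalEquality
    using (_≡_; refl; sym; trans; cong; cong₂; subst; subst₂; module ≡-Reasoning)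
  open import Relation.Nullary using (Dec; yes; no; ¬_; contradiction)
  open import Relation.Nullary.Decidable using (dec⇒maybe)
  import Tactic.RingSolver as RingSolver
  import Tactic.RingSolver.Core.AlmostCommutativeRing as ACR
  open import Defs
  open Exp (CommutativeRing.commutativeSemiring ℚ.+-*-commutativeRing) using (_^_; ^-homo-*; ^-distrib-*; ^-assocʳ)

  -- Inequalities and powers of rationals

  ring : ACR.AlmostCommutativeRing 0ℓ 0ℓ
  ring = ACR.fromCommutativeRing ℚ.+-*-commutativeRing λ x → dec⇒maybe (0ℚ ℚ.≟ x)

  0<1 : 0ℚ < 1ℚ
  0<1 = ℚ.positive⁻¹ 1ℚ

  0≤1 : 0ℚ ≤ 1ℚ
  0≤1 = ℚ.<⇒≤ 0<1

  <⇒≱ : ∀ {p q} → p < q → ¬ q ≤ p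
  <⇒≱ p<q q≤p = ℚ.<-irrefl refl (ℚ.<-≤-trans p<q q≤p)

  *-nonNeg : ∀ {p q} → 0ℚ ≤ p → 0ℚ ≤ q → 0ℚ ≤ p * q
  *-nonNeg {p} {q} 0≤p 0≤q = subst (_≤ p * q) (ℚ.*-zeroˡ q) (*-monoˡ-≤ q 0≤q 0≤p)

  +-nonNeg : ∀ {p q} → 0ℚ ≤ p → 0ℚ ≤ q → 0ℚ ≤ p + q
  +-nonNeg = ℚ.+-mono-≤

  +-pos : ∀ {p q} → 0ℚ < p → 0ℚ ≤ q → 0ℚ < p + q
  +-pos = ℚ.+-mono-<-≤

  -- Many inequalities below are proved by exhibiting the difference of the two sides as a visibly
  -- nonnegative `d`, which leaves an identity to the ring solver.
  ≤-by : ∀ {p q} d → 0ℚ ≤ d → p + d ≡ q → p ≤ q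
  ≤-by {p} d 0≤d refl = subst (_≤ p + d) (ℚ.+-identityʳ p) (ℚ.+-monoʳ-≤ p 0≤d)

  <-by : ∀ {p q} d → 0ℚ < d → p + d ≡ q → p < q
  <-by {p} d 0<d refl = subst (_< p + d) (ℚ.+-identityʳ p) (ℚ.+-monoʳ-< p 0<d)

  p≤q⇒0≤q-p : ∀ {p q} → p ≤ q → 0ℚ ≤ q - p
  p≤q⇒0≤q-p {p} {q} p≤q = subst (_≤ q - p) (ℚ.+-inverseʳ p) (ℚ.+-monoˡ-≤ (- p) p≤q)

  p<q⇒0<q-p : ∀ {p q} → p < q → 0ℚ < q - p
  p<q⇒0<q-p {p} {q} p<q = subst (_< q - p) (ℚ.+-inverseʳ p) (ℚ.+-monoˡ-< (- p) p<q)

  *-cancelˡ-≤ : ∀ {r p q} → 0ℚ < r → r * p ≤ r * q → p ≤ q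
  *-cancelˡ-≤ {r} 0<r = ℚ.*-cancelˡ-≤-pos r {{positive 0<r}}

  *-cancelˡ-< : ∀ {r p q} → 0ℚ ≤ r → r * p < r * q → p < q
  *-cancelˡ-< {r} 0≤r = ℚ.*-cancelˡ-<-nonNeg r {{nonNegative 0≤r}}

  *-cancelˡ-≡ : ∀ {r p q} → 0ℚ < r → r * p ≡ r * q → p ≡ q
  *-cancelˡ-≡ 0<r eq = ℚ.≤-antisym (*-cancelˡ-≤ 0<r (ℚ.≤-reflexive eq)) (*-cancelˡ-≤ 0<r (ℚ.≤-reflexive (sym eq)))

  sq-cancel-≤ : ∀ {p q} → 0ℚ ≤ q → p * p ≤ q * q → p ≤ q
  sq-cancel-≤ {p} {q} 0≤q p²≤q² with p ℚ.≤? q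
  ... | yes p≤q = p≤q
  ... | no p≰q = contradiction p²≤q² (<⇒≱ (ℚ.≤-<-trans (*-monoʳ-≤ q 0≤q (ℚ.<⇒≤ q<p))
      (ℚ.*-monoˡ-<-pos p {{positive (ℚ.≤-<-trans 0≤q q<p)}} q<p)))
    where q<p = ℚ.≰⇒> p≰q

  p≤r*p : ∀ {r p} → 0ℚ ≤ p → 1ℚ ≤ r → p ≤ r * p
  p≤r*p {r} {p} 0≤p 1≤r = subst (_≤ r * p) (ℚ.*-identityˡ p) (*-monoˡ-≤ p 0≤p 1≤r)

  r*p≤p : ∀ {r p} → 0ℚ ≤ p → r ≤ 1ℚ → r * p ≤ p
  r*p≤p {r} {p} 0≤p r≤1 = subst (r * p ≤_) (ℚ.*-identityˡ p) (*-monoˡ-≤ p 0≤p r≤1)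

  -- Opaque, since unfolding would expose the gcd computations of normalised fractions.
  opaque
    ι : ℕ → ℚ
    ι n = ℤ.+ n / 1

    ι-def : ∀ n → ι n ≡ ℤ.+ n / 1
    ι-def n = refl

    ι-0 : ι 0 ≡ 0ℚ
    ι-0 = refl

    ι-1 : ι 1 ≡ 1ℚ
    ι-1 = refl

    ι-+ : ∀ m n → ι (m ℕ.+ n) ≡ ι m + ι n
    ι-+ m n = sym (/-+ m n 1)

    ι-* : ∀ m n → ι (m ℕ.* n) ≡ ι m * ι n
    ι-* m n = sym (/-* m n 1 1)

    ι-mono-≤ : ∀ {m n} → m ℕ.≤ n → ι m ≤ ι n
    ι-mono-≤ {m} {n} m≤n = /-mono-≤ m n 1 1 (ℕ.*-monoˡ-≤ 1 m≤n)

  ι-suc : ∀ n → ι (suc n) ≡ 1ℚ + ι n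
  ι-suc n = trans (ι-+ 1 n) (cong (_+ ι n) ι-1)

  ι-nonNeg : ∀ n → 0ℚ ≤ ι n
  ι-nonNeg n = subst (_≤ ι n) ι-0 (ι-mono-≤ ℕ.z≤n)

  ι-suc-pos : ∀ n → 0ℚ < ι (suc n)
  ι-suc-pos n = subst (0ℚ <_) (sym (ι-suc n)) (+-pos 0<1 (ι-nonNeg n))

  ι-pos : ∀ {n} → 1 ℕ.≤ n → 0ℚ < ι n
  ι-pos {suc n} _ = ι-suc-pos n

  ι<ι-suc : ∀ n → ι n < ι (suc n)
  ι<ι-suc n = <-by 1ℚ 0<1 (trans (ℚ.+-comm (ι n) 1ℚ) (sym (ι-suc n)))

  ι-cancel-≤ : ∀ {m n} → ι m ≤ ι n → m ℕ.≤ n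
  ι-cancel-≤ {m} {n} le with m ℕ.≤? n
  ... | yes m≤n = m≤n
  ... | no m≰n = contradiction (ℚ.≤-trans (ι-mono-≤ (ℕ.≰⇒> m≰n)) le) (<⇒≱ (ι<ι-suc n))

  1≤^ : ∀ {p} n → 1ℚ ≤ p → 1ℚ ≤ p ^ n
  1≤^ zero    1≤p = ℚ.≤-refl
  1≤^ {p} (suc n) 1≤p = ℚ.≤-trans 1≤p (subst (_≤ p * p ^ n) (ℚ.*-identityʳ p)
    (*-monoʳ-≤ p (ℚ.≤-trans 0≤1 1≤p) (1≤^ n 1≤p)))

  ^-pos : ∀ {p} n → 0ℚ < p → 0ℚ < p ^ n
  ^-pos zero    0<p = 0<1
  ^-pos (suc n) 0<p = *-pos 0<p (^-pos n 0<p)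

  ^-nonNeg : ∀ {p} n → 0ℚ ≤ p → 0ℚ ≤ p ^ n
  ^-nonNeg zero    0≤p = 0≤1
  ^-nonNeg (suc n) 0≤p = *-nonNeg 0≤p (^-nonNeg n 0≤p)

  ^-monoˡ-≤ : ∀ {p q} n → 0ℚ ≤ p → p ≤ q → p ^ n ≤ q ^ n
  ^-monoˡ-≤ zero    0≤p p≤q = ℚ.≤-refl
  ^-monoˡ-≤ (suc n) 0≤p p≤q = *-mono-≤ 0≤p (^-nonNeg n 0≤p) p≤q (^-monoˡ-≤ n 0≤p p≤q)

  1^ : ∀ n → 1ℚ ^ n ≡ 1ℚ
  1^ zero    = refl
  1^ (suc n) = trans (ℚ.*-identityˡ (1ℚ ^ n)) (1^ n)

  bernoulli : ∀ {h} → 0ℚ ≤ h → ∀ n → 1ℚ + ι n * h ≤ (1ℚ + h) ^ n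
  bernoulli {h} 0≤h zero = ℚ.≤-reflexive (trans (cong (λ z → 1ℚ + z * h) ι-0)
    (trans (cong (1ℚ +_) (ℚ.*-zeroˡ h)) (ℚ.+-identityʳ 1ℚ)))
  bernoulli {h} 0≤h (suc n) = ℚ.≤-trans
    (≤-by (ι n * h * h) (*-nonNeg (*-nonNeg (ι-nonNeg n) 0≤h) 0≤h)
      (trans (cong (λ z → 1ℚ + z * h + ι n * h * h) (ι-suc n)) (eq (ι n) h)))
    (*-monoʳ-≤ (1ℚ + h) (+-nonNeg 0≤1 0≤h) (bernoulli 0≤h n))
    where
    eq : ∀ m h → 1ℚ + (1ℚ + m) * h + m * h * h ≡ (1ℚ + h) * (1ℚ + m * h)
    eq = RingSolver.solve-∀ ring

  ∃-ι≥ : ∀ p → ∃[ N ] p ≤ ι N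
  ∃-ι≥ p = ℤ.∣ ℚ.↥ p ∣ , ℚ.≤-trans (p≤∣p∣ p) (subst (∣ p ∣ ≤_) (sym (ι-def _)) (∣p∣≤∣↥p∣ p))

  ∃-floor : ∀ p → 0ℚ ≤ p → ∃[ m ] ι m ≤ p × p < ι (suc m)
  ∃-floor p 0≤p = let N , p≤N = ∃-ι≥ p in search N (ℚ.≤-<-trans p≤N (ι<ι-suc N))
    where
    search : ∀ N → p < ι (suc N) → ∃[ m ] ι m ≤ p × p < ι (suc m)
    search N p< with ι N ℚ.≤? p
    ... | yes N≤p = N , N≤p , p<
    search zero    p< | no N≰p = contradiction (subst (_≤ p) (sym ι-0) 0≤p) N≰p
    search (suc N) p< | no N≰p = search N (ℚ.≰⇒> N≰p)

  -- For r > 1, the harmonic mean s of 1 and r.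
  ∃-root : ∀ {r} → 1ℚ < r → ∃[ s ] 1ℚ < s × s * s ≤ r
  ∃-root {r} 1<r = s , 1<s , s²≤r
    where
    0<r = ℚ.<-trans 0<1 1<r
    0<d : 0ℚ < 1ℚ + r
    0<d = +-pos 0<1 (ℚ.<⇒≤ 0<r)
    i = inv (1ℚ + r) 0<d
    0<i = inv-pos (1ℚ + r) 0<d
    h = r - 1ℚ
    s = 1ℚ + h * i
    1<s : 1ℚ < s
    1<s = <-by (h * i) (*-pos (p<q⇒0<q-p 1<r) 0<i) refl
    eq : ∀ r i → (1ℚ + (r - 1ℚ) * i) * (1ℚ + (r - 1ℚ) * i)
               + ((r - 1ℚ) * (1ℚ - (1ℚ + r) * i) + (r - 1ℚ) * (r - 1ℚ) * (i - (1ℚ + r) * i * i + r * i * i)) ≡ r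
    eq = RingSolver.solve-∀ ring
    eq₂ : (r - 1ℚ) * (1ℚ - (1ℚ + r) * i) + (r - 1ℚ) * (r - 1ℚ) * (i - (1ℚ + r) * i * i + r * i * i) ≡ h * h * (r * i * i)
    eq₂ = trans (cong (λ u → h * (1ℚ - u) + h * h * (i - u * i + r * i * i)) (p*inv (1ℚ + r) 0<d)) (eq₃ h i (r * i * i))
      where
      eq₃ : ∀ h i z → h * (1ℚ - 1ℚ) + h * h * (i - 1ℚ * i + z) ≡ h * h * z
      eq₃ = RingSolver.solve-∀ ring
    s²≤r : s * s ≤ r
    s²≤r = ≤-by (h * h * (r * i * i))
      (*-nonNeg (*-nonNeg 0≤h 0≤h) (*-nonNeg (*-nonNeg (ℚ.<⇒≤ 0<r) 0≤i) 0≤i))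
      (trans (cong (s * s +_) (sym eq₂)) (eq r i))
      where
      0≤h = ℚ.<⇒≤ (p<q⇒0<q-p 1<r)
      0≤i = ℚ.<⇒≤ 0<i

  -- Sums over i + j = n

  -- The summand takes both `i` and `j`, so that the truncated difference of `n` and `i` never
  -- occurs.
  D : ℕ → (ℕ → ℕ → ℚ) → ℚ
  D zero    F = F 0 0
  D (suc n) F = F 0 (suc n) + D n (λ i j → F (suc i) j)

  D-cong : ∀ n {F G : ℕ → ℕ → ℚ} → (∀ i j → i ℕ.+ j ≡ n → F i j ≡ G i j) → D n F ≡ D n G
  D-cong zero    eq = eq 0 0 refl
  D-cong (suc n) eq = cong₂ _+_ (eq 0 (suc n) refl) (D-cong n λ i j i+j≡n → eq (suc i) j (cong suc i+j≡n))

  D-mono : ∀ n {F G : ℕ → ℕ → ℚ} → (∀ i j → i ℕ.+ j ≡ n → F i j ≤ G i j) → D n F ≤ D n G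
  D-mono zero    le = le 0 0 refl
  D-mono (suc n) le = ℚ.+-mono-≤ (le 0 (suc n) refl) (D-mono n λ i j i+j≡n → le (suc i) j (cong suc i+j≡n))

  D-+ : ∀ n (F G : ℕ → ℕ → ℚ) → D n (λ i j → F i j + G i j) ≡ D n F + D n G
  D-+ zero    F G = refl
  D-+ (suc n) F G = trans (cong (F 0 (suc n) + G 0 (suc n) +_) (D-+ n _ _))
    (eq (F 0 (suc n)) (G 0 (suc n)) (D n λ i j → F (suc i) j) (D n λ i j → G (suc i) j))
    where
    eq : ∀ a b c d → (a + b) + (c + d) ≡ (a + c) + (b + d)
    eq = RingSolver.solve-∀ ring

  D-*ˡ : ∀ n c (F : ℕ → ℕ → ℚ) → D n (λ i j → c * F i j) ≡ c * D n F
  D-*ˡ zero    c F = refl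
  D-*ˡ (suc n) c F = trans (cong (c * F 0 (suc n) +_) (D-*ˡ n c _))
    (sym (ℚ.*-distribˡ-+ c (F 0 (suc n)) (D n λ i j → F (suc i) j)))

  D-*ʳ : ∀ n c (F : ℕ → ℕ → ℚ) → D n (λ i j → F i j * c) ≡ D n F * c
  D-*ʳ n c F = trans (D-cong n λ i j _ → ℚ.*-comm (F i j) c) (trans (D-*ˡ n c F) (ℚ.*-comm c (D n F)))

  D-0 : ∀ n → D n (λ _ _ → 0ℚ) ≡ 0ℚ
  D-0 zero    = refl
  D-0 (suc n) = trans (cong (0ℚ +_) (D-0 n)) (ℚ.+-identityʳ 0ℚ)

  D-const : ∀ n c → D n (λ _ _ → c) ≡ ι (suc n) * c
  D-const zero    c = trans (sym (ℚ.*-identityˡ c)) (cong (_* c) (sym ι-1))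
  D-const (suc n) c = trans (cong (c +_) (D-const n c))
    (trans (eq c (ι (suc n))) (cong (_* c) (sym (ι-suc (suc n)))))
    where
    eq : ∀ c m → c + m * c ≡ (1ℚ + m) * c
    eq = RingSolver.solve-∀ ring

  D-nonNeg : ∀ n {F : ℕ → ℕ → ℚ} → (∀ i j → 0ℚ ≤ F i j) → 0ℚ ≤ D n F
  D-nonNeg n {F} 0≤F = subst (_≤ D n F) (D-0 n) (D-mono n λ i j _ → 0≤F i j)

  D-last : ∀ n (F : ℕ → ℕ → ℚ) → D (suc n) F ≡ F (suc n) 0 + D n (λ i j → F i (suc j))
  D-last zero    F = ℚ.+-comm (F 0 1) (F 1 0)
  D-last (suc n) F = trans (cong (F 0 (suc (suc n)) +_) (D-last n λ i j → F (suc i) j))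
    (eq (F 0 (suc (suc n))) (F (suc (suc n)) 0) (D n λ i j → F (suc i) (suc j)))
    where
    eq : ∀ a b c → a + (b + c) ≡ b + (a + c)
    eq = RingSolver.solve-∀ ring

  δ : ℕ → ℕ → ℚ
  δ zero    zero    = 1ℚ
  δ zero    (suc j) = 0ℚ
  δ (suc i) zero    = 0ℚ
  δ (suc i) (suc j) = δ i j

  δ-+ˡ : ∀ m i j → δ (m ℕ.+ i) (m ℕ.+ j) ≡ δ i j
  δ-+ˡ zero    i j = refl
  δ-+ˡ (suc m) i j = δ-+ˡ m i j

  D-δ : ∀ i j (F : ℕ → ℕ → ℚ) → D (i ℕ.+ j) (λ a b → F a b * δ i a) ≡ F i j
  D-δ zero    zero    F = ℚ.*-identityʳ (F 0 0)
  D-δ zero    (suc j) F = trans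
    (cong₂ _+_ (ℚ.*-identityʳ (F 0 (suc j)))
      (trans (D-cong j λ a b _ → ℚ.*-zeroʳ (F (suc a) b)) (D-0 j)))
    (ℚ.+-identityʳ (F 0 (suc j)))
  D-δ (suc i) j       F = trans
    (cong₂ _+_ (ℚ.*-zeroʳ (F 0 (suc i ℕ.+ j))) (D-δ i j λ a b → F (suc a) b))
    (ℚ.+-identityˡ (F (suc i) j))

  -- Binomial coefficients and weights

  -- C i j is the binomial coefficient (i + j choose i).
  C : ℕ → ℕ → ℚ
  C zero    j       = 1ℚ
  C (suc i) zero    = 1ℚ
  C (suc i) (suc j) = C i (suc j) + C (suc i) j

  C-zeroʳ : ∀ i → C i 0 ≡ 1ℚ
  C-zeroʳ zero    = refl
  C-zeroʳ (suc i) = refl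

  C-sym : ∀ i j → C i j ≡ C j i
  C-sym zero    zero    = refl
  C-sym zero    (suc j) = refl
  C-sym (suc i) zero    = refl
  C-sym (suc i) (suc j) = trans (ℚ.+-comm (C i (suc j)) (C (suc i) j)) (cong₂ _+_ (C-sym (suc i) j) (C-sym i (suc j)))

  C-nonNeg : ∀ i j → 0ℚ ≤ C i j
  C-nonNeg zero    j       = 0≤1
  C-nonNeg (suc i) zero    = 0≤1
  C-nonNeg (suc i) (suc j) = +-nonNeg (C-nonNeg i (suc j)) (C-nonNeg (suc i) j)

  C-absorb : ∀ i j → ι (suc i) * C (suc i) j ≡ ι (suc (i ℕ.+ j)) * C i j
  C-absorb i       zero    = cong₂ _*_ (cong (ι ∘ suc) (sym (ℕ.+-identityʳ i))) (sym (C-zeroʳ i))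
  C-absorb zero    (suc j) = begin
    ι 1 * (1ℚ + C 1 j)              ≡⟨ eq (ι 1) (C 1 j) ⟩
    ι 1 + ι 1 * C 1 j               ≡⟨ cong (ι 1 +_) (C-absorb 0 j) ⟩
    ι 1 + ι (suc j) * 1ℚ            ≡⟨ cong₂ _+_ ι-1 (ℚ.*-identityʳ (ι (suc j))) ⟩
    1ℚ + ι (suc j)                  ≡⟨ ι-suc (suc j) ⟨
    ι (suc (suc j))                 ≡⟨ ℚ.*-identityʳ (ι (suc (suc j))) ⟨
    ι (suc (suc j)) * 1ℚ            ∎
    where
    open ≡-Reasoning
    eq : ∀ a b → a * (1ℚ + b) ≡ a + a * b
    eq = RingSolver.solve-∀ ring
  C-absorb (suc i) (suc j) = begin
    ι (suc (suc i)) * (X + C (suc (suc i)) j)            ≡⟨ ℚ.*-distribˡ-+ (ι (suc (suc i))) X (C (suc (suc i)) j) ⟩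
    ι (suc (suc i)) * X + ι (suc (suc i)) * C (suc (suc i)) j
      ≡⟨ cong₂ (λ a b → a * X + b) (ι-suc (suc i)) (C-absorb (suc i) j) ⟩
    (1ℚ + ι (suc i)) * X + m * C (suc i) j               ≡⟨ eq₁ (ι (suc i)) X (m * C (suc i) j) ⟩
    X + ι (suc i) * X + m * C (suc i) j                  ≡⟨ cong (λ z → X + z + m * C (suc i) j) (C-absorb i (suc j)) ⟩
    X + ι (suc (i ℕ.+ suc j)) * C i (suc j) + m * C (suc i) j
      ≡⟨ cong (λ z → X + ι (suc z) * C i (suc j) + m * C (suc i) j) (ℕ.+-suc i j) ⟩
    X + m * C i (suc j) + m * C (suc i) j                ≡⟨ eq₂ (C i (suc j)) (C (suc i) j) m ⟩
    (1ℚ + m) * X                                         ≡⟨ cong (_* X) (ι-suc (suc (suc (i ℕ.+ j)))) ⟨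
    ι (suc (suc (suc (i ℕ.+ j)))) * X                    ≡⟨ cong (λ z → ι (suc (suc z)) * X) (ℕ.+-suc i j) ⟨
    ι (suc (suc (i ℕ.+ suc j))) * X                      ∎
    where
    open ≡-Reasoning
    X = C i (suc j) + C (suc i) j
    m = ι (suc (suc (i ℕ.+ j)))
    eq₁ : ∀ a x b → (1ℚ + a) * x + b ≡ x + a * x + b
    eq₁ = RingSolver.solve-∀ ring
    eq₂ : ∀ a b m → a + b + m * a + m * b ≡ (1ℚ + m) * (a + b)
    eq₂ = RingSolver.solve-∀ ring

  C-absorbʳ : ∀ i j → ι (suc j) * C i (suc j) ≡ ι (suc (i ℕ.+ j)) * C i j
  C-absorbʳ i j = begin
    ι (suc j) * C i (suc j)       ≡⟨ cong (ι (suc j) *_) (C-sym i (suc j)) ⟩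
    ι (suc j) * C (suc j) i       ≡⟨ C-absorb j i ⟩
    ι (suc (j ℕ.+ i)) * C j i     ≡⟨ cong₂ (λ n c → ι (suc n) * c) (ℕ.+-comm j i) (C-sym j i) ⟩
    ι (suc (i ℕ.+ j)) * C i j     ∎
    where open ≡-Reasoning

  -- Pascal's rule splits a coefficient by the last step of a lattice path. `P` and `Q` collect the
  -- two halves, with zeros where the predecessor would leave the quadrant; dropping these zeros,
  -- one at each end of the sum, shifts the index.
  D-pascal : ∀ n (F : ℕ → ℕ → ℚ) → D (suc n) (λ i j → C i j * F i j) ≡ D n (λ i j → C i j * (F (suc i) j + F i (suc j)))
  D-pascal n F = begin
    D (suc n) (λ i j → C i j * F i j)              ≡⟨ D-cong (suc n) split ⟩
    D (suc n) (λ i j → P i j + Q i j)              ≡⟨ D-+ (suc n) P Q ⟩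
    (0ℚ + D n (λ i j → P (suc i) j)) + D (suc n) Q ≡⟨ cong₂ _+_ (ℚ.+-identityˡ (D n (λ i j → P (suc i) j))) (D-last n Q) ⟩
    D n (λ i j → P (suc i) j) + (Q (suc n) 0 + D n (λ i j → Q i (suc j)))
      ≡⟨ cong (λ q → D n (λ i j → P (suc i) j) + (q + D n (λ i j → Q i (suc j)))) (Q-zeroʳ (suc n)) ⟩
    D n (λ i j → P (suc i) j) + (0ℚ + D n (λ i j → Q i (suc j)))
      ≡⟨ cong (D n (λ i j → P (suc i) j) +_) (ℚ.+-identityˡ _) ⟩
    D n (λ i j → P (suc i) j) + D n (λ i j → Q i (suc j))
      ≡⟨ D-+ n (λ i j → P (suc i) j) (λ i j → Q i (suc j)) ⟨
    D n (λ i j → P (suc i) j + Q i (suc j))        ≡⟨ D-cong n (λ i j _ → cong (P (suc i) j +_) (Q-suc i j)) ⟩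
    D n (λ i j → C i j * F (suc i) j + C i j * F i (suc j))
      ≡⟨ D-cong n (λ i j _ → sym (ℚ.*-distribˡ-+ (C i j) (F (suc i) j) (F i (suc j)))) ⟩
    D n (λ i j → C i j * (F (suc i) j + F i (suc j))) ∎
    where
    open ≡-Reasoning
    P Q : ℕ → ℕ → ℚ
    P zero    j = 0ℚ
    P (suc i) j = C i j * F (suc i) j
    Q i zero    = 0ℚ
    Q i (suc j) = C i j * F i (suc j)
    Q-zeroʳ : ∀ i → Q i 0 ≡ 0ℚ
    Q-zeroʳ i = refl
    Q-suc : ∀ i j → Q i (suc j) ≡ C i j * F i (suc j)
    Q-suc i j = refl
    split : ∀ i j → i ℕ.+ j ≡ suc n → C i j * F i j ≡ P i j + Q i j
    split zero    (suc j) _ = sym (ℚ.+-identityˡ (1ℚ * F 0 (suc j)))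
    split (suc i) zero    _ = trans (cong (_* F (suc i) 0) (sym (C-zeroʳ i))) (sym (ℚ.+-identityʳ (C i 0 * F (suc i) 0)))
    split (suc i) (suc j) _ = ℚ.*-distribʳ-+ (F (suc i) (suc j)) (C i (suc j)) (C (suc i) j)

  -- The weight of i failures and j successes in i + j trials with respective probabilities x and y.
  bin : ℚ → ℚ → ℕ → ℕ → ℚ
  bin x y i j = C i j * (x ^ i * y ^ j)

  bin-sym : ∀ x y i j → bin x y i j ≡ bin y x j i
  bin-sym x y i j = cong₂ _*_ (C-sym i j) (ℚ.*-comm (x ^ i) (y ^ j))

  bin-nonNeg : ∀ {x y} → 0ℚ ≤ x → 0ℚ ≤ y → ∀ i j → 0ℚ ≤ bin x y i j
  bin-nonNeg 0≤x 0≤y i j = *-nonNeg (C-nonNeg i j) (*-nonNeg (^-nonNeg i 0≤x) (^-nonNeg j 0≤y))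

  -- Conditions on one of the trials. This is the engine of all inductions on the number of trials.
  D-bin-suc : ∀ n x y (G : ℕ → ℕ → ℚ) → D (suc n) (λ i j → bin x y i j * G i j) ≡
                          D n (λ i j → bin x y i j * (x * G (suc i) j + y * G i (suc j)))
  D-bin-suc n x y G = begin
    D (suc n) (λ i j → C i j * (x ^ i * y ^ j) * G i j)
      ≡⟨ D-cong (suc n) (λ i j _ → ℚ.*-assoc (C i j) (x ^ i * y ^ j) (G i j)) ⟩
    D (suc n) (λ i j → C i j * (x ^ i * y ^ j * G i j))
      ≡⟨ D-pascal n (λ i j → x ^ i * y ^ j * G i j) ⟩
    D n (λ i j → C i j * (x ^ suc i * y ^ j * G (suc i) j + x ^ i * y ^ suc j * G i (suc j)))
      ≡⟨ D-cong n (λ i j _ → eq (C i j) x y (x ^ i) (y ^ j) (G (suc i) j) (G i (suc j))) ⟩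
    D n (λ i j → bin x y i j * (x * G (suc i) j + y * G i (suc j))) ∎
    where
    open ≡-Reasoning
    eq : ∀ c x y a b g h → c * (x * a * b * g + a * (y * b) * h) ≡ c * (a * b) * (x * g + y * h)
    eq = RingSolver.solve-∀ ring

  D-bin : ∀ n x y → x + y ≡ 1ℚ → D n (bin x y) ≡ 1ℚ
  D-bin zero    x y eq = refl
  D-bin (suc n) x y eq = begin
    D (suc n) (bin x y)                                ≡⟨ D-cong (suc n) (λ i j _ → sym (ℚ.*-identityʳ (bin x y i j))) ⟩
    D (suc n) (λ i j → bin x y i j * 1ℚ)               ≡⟨ D-bin-suc n x y (λ _ _ → 1ℚ) ⟩
    D n (λ i j → bin x y i j * (x * 1ℚ + y * 1ℚ))      ≡⟨ D-cong n (λ i j _ → trans (cong (bin x y i j *_)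
                                                           (trans (cong₂ _+_ (ℚ.*-identityʳ x) (ℚ.*-identityʳ y)) eq)) (ℚ.*-identityʳ _)) ⟩
    D n (bin x y)                                      ≡⟨ D-bin n x y eq ⟩
    1ℚ                                                 ∎
    where open ≡-Reasoning

  D-single-≤ : ∀ {F : ℕ → ℕ → ℚ} → (∀ i j → 0ℚ ≤ F i j) → ∀ i j → F i j ≤ D (i ℕ.+ j) F
  D-single-≤ {F} 0≤F i j = subst (_≤ D (i ℕ.+ j) F) (D-δ i j F) (D-mono (i ℕ.+ j) λ a b _ → F*δ≤F a b (F a b) (0≤F a b))
    where
    δ≤1 : ∀ a b → δ a b ≤ 1ℚ
    δ≤1 zero    zero    = ℚ.≤-refl
    δ≤1 zero    (suc b) = 0≤1
    δ≤1 (suc a) zero    = 0≤1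
    δ≤1 (suc a) (suc b) = δ≤1 a b
    F*δ≤F : ∀ a b (f : ℚ) → 0ℚ ≤ f → f * δ i a ≤ f
    F*δ≤F a b f 0≤f = subst (_≤ f) (ℚ.*-comm (δ i a) f) (r*p≤p 0≤f (δ≤1 i a))

  bin≤1 : ∀ {x y} → 0ℚ ≤ x → 0ℚ ≤ y → x + y ≡ 1ℚ → ∀ i j → bin x y i j ≤ 1ℚ
  bin≤1 {x} {y} 0≤x 0≤y eq i j =
    subst (bin x y i j ≤_) (D-bin (i ℕ.+ j) x y eq) (D-single-≤ (bin-nonNeg 0≤x 0≤y) i j)

  -- Sums of squares of binomial weights as binomial averages of central weights

  δ-sym : ∀ i j → δ i j ≡ δ j i
  δ-sym zero    zero    = refl
  δ-sym zero    (suc j) = refl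
  δ-sym (suc i) zero    = refl
  δ-sym (suc i) (suc j) = δ-sym i j

  δ-double : ∀ i j → δ (i ℕ.+ i) (j ℕ.+ j) ≡ δ i j
  δ-double zero    zero    = refl
  δ-double zero    (suc j) = refl
  δ-double (suc i) zero    = refl
  δ-double (suc i) (suc j) = trans (cong₂ δ (ℕ.+-suc i i) (ℕ.+-suc j j)) (δ-double i j)

  -- On the antidiagonal, `i + a` and `j + b` differ by twice the difference of `a` and `j`. Adding
  -- `j` to both sides makes this visible without subtraction.
  δ-antidiagonal : ∀ i j a b → a ℕ.+ b ≡ i ℕ.+ j → δ (i ℕ.+ a) (j ℕ.+ b) ≡ δ j a
  δ-antidiagonal i j a b eq = begin
    δ (i ℕ.+ a) (j ℕ.+ b)                         ≡⟨ δ-+ˡ j (i ℕ.+ a) (j ℕ.+ b) ⟨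
    δ (j ℕ.+ (i ℕ.+ a)) (j ℕ.+ (j ℕ.+ b))         ≡⟨ cong₂ δ left (sym (ℕ.+-assoc j j b)) ⟩
    δ (b ℕ.+ (a ℕ.+ a)) (j ℕ.+ j ℕ.+ b)           ≡⟨ cong (δ (b ℕ.+ (a ℕ.+ a))) (ℕ.+-comm (j ℕ.+ j) b) ⟩
    δ (b ℕ.+ (a ℕ.+ a)) (b ℕ.+ (j ℕ.+ j))         ≡⟨ δ-+ˡ b (a ℕ.+ a) (j ℕ.+ j) ⟩
    δ (a ℕ.+ a) (j ℕ.+ j)                         ≡⟨ δ-double a j ⟩
    δ a j                                         ≡⟨ δ-sym a j ⟩
    δ j a                                         ∎
    where
    open ≡-Reasoning
    left : j ℕ.+ (i ℕ.+ a) ≡ b ℕ.+ (a ℕ.+ a)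
    left = trans (sym (ℕ.+-assoc j i a)) (trans (cong (ℕ._+ a) (trans (ℕ.+-comm j i) (trans (sym eq) (ℕ.+-comm a b))))
      (ℕ.+-assoc b a a))

  w : ℕ → ℚ
  w m = bin ½ ½ m m

  4ℚ : ℚ
  4ℚ = ℤ.+ 4 / 1

  module SquareMixture where

    T : ℚ → ℚ → ℕ → (ℕ → ℕ → ℚ) → ℚ
    T x y n G = D n λ i j → bin x y i j * G i j

    T-cong : ∀ x y n {G H : ℕ → ℕ → ℚ} → (∀ i j → i ℕ.+ j ≡ n → G i j ≡ H i j) → T x y n G ≡ T x y n H
    T-cong x y n eq = D-cong n λ i j i+j≡n → cong (bin x y i j *_) (eq i j i+j≡n)

    T-linear : ∀ x y n p q G H → T x y n (λ i j → p * G i j + q * H i j) ≡ p * T x y n G + q * T x y n H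
    T-linear x y n p q G H = begin
      T x y n (λ i j → p * G i j + q * H i j)
        ≡⟨ D-cong n (λ i j _ → eq (bin x y i j) p q (G i j) (H i j)) ⟩
      D n (λ i j → p * (bin x y i j * G i j) + q * (bin x y i j * H i j))
        ≡⟨ D-+ n (λ i j → p * (bin x y i j * G i j)) (λ i j → q * (bin x y i j * H i j)) ⟩
      D n (λ i j → p * (bin x y i j * G i j)) + D n (λ i j → q * (bin x y i j * H i j))
        ≡⟨ cong₂ _+_ (D-*ˡ n p λ i j → bin x y i j * G i j) (D-*ˡ n q λ i j → bin x y i j * H i j) ⟩
      p * T x y n G + q * T x y n H ∎
      where
      open ≡-Reasoning
      eq : ∀ b p q g h → b * (p * g + q * h) ≡ p * (b * g) + q * (b * h)
      eq = RingSolver.solve-∀ ring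

    -- Such arrays depend on the difference of `i` and `j` only and stand for functions on the
    -- integers.
    Invariant : (ℕ → ℕ → ℚ) → Set
    Invariant G = ∀ i j → G (suc i) (suc j) ≡ G i j

    -- The average of the two shifts; on invariant arrays, one step of the simple random walk.
    M : (ℕ → ℕ → ℚ) → ℕ → ℕ → ℚ
    M G i j = ½ * G (suc i) j + ½ * G i (suc j)

    M² : (ℕ → ℕ → ℚ) → ℕ → ℕ → ℚ
    M² G = M (M G)

    M²^ : ℕ → (ℕ → ℕ → ℚ) → ℕ → ℕ → ℚ
    M²^ zero    G = G
    M²^ (suc m) G = M²^ m (M² G)

    M-invariant : ∀ {G} → Invariant G → Invariant (M G)
    M-invariant inv i j = cong₂ (λ a b → ½ * a + ½ * b) (inv (suc i) j) (inv i (suc j))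

    M²^-cong : ∀ m {G H : ℕ → ℕ → ℚ} → (∀ i j → G i j ≡ H i j) → ∀ i j → M²^ m G i j ≡ M²^ m H i j
    M²^-cong zero    eq = eq
    M²^-cong (suc m) {G} {H} eq = M²^-cong m λ i j → M-cong (M-cong eq) i j
      where
      M-cong : ∀ {G H : ℕ → ℕ → ℚ} → (∀ i j → G i j ≡ H i j) → ∀ i j → M G i j ≡ M H i j
      M-cong eq i j = cong₂ (λ a b → ½ * a + ½ * b) (eq (suc i) j) (eq i (suc j))

    M²^-linear : ∀ m p q (G H : ℕ → ℕ → ℚ) i j →
                 M²^ m (λ i j → p * G i j + q * H i j) i j ≡ p * M²^ m G i j + q * M²^ m H i j
    M²^-linear zero    p q G H i j = refl
    M²^-linear (suc m) p q G H i j = trans (M²^-cong m (λ i j → eq p q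
        (G (suc (suc i)) j) (G (suc i) (suc j)) (G i (suc (suc j)))
        (H (suc (suc i)) j) (H (suc i) (suc j)) (H i (suc (suc j)))) i j)
      (M²^-linear m p q (M² G) (M² H) i j)
      where
      eq : ∀ p q a b c a′ b′ c′ →
        ½ * (½ * (p * a + q * a′) + ½ * (p * b + q * b′)) + ½ * (½ * (p * b + q * b′) + ½ * (p * c + q * c′)) ≡
        p * (½ * (½ * a + ½ * b) + ½ * (½ * b + ½ * c)) + q * (½ * (½ * a′ + ½ * b′) + ½ * (½ * b′ + ½ * c′))
      eq = RingSolver.solve-∀ ring

    M²^-T : ∀ m G → M²^ m G 0 0 ≡ T ½ ½ (m ℕ.+ m) G
    M²^-T zero    G = sym (ℚ.*-identityˡ (G 0 0))
    M²^-T (suc m) G = begin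
      M²^ m (M² G) 0 0                ≡⟨ M²^-T m (M² G) ⟩
      T ½ ½ (m ℕ.+ m) (M² G)          ≡⟨ D-bin-suc (m ℕ.+ m) ½ ½ (M G) ⟨
      T ½ ½ (suc (m ℕ.+ m)) (M G)     ≡⟨ D-bin-suc (suc (m ℕ.+ m)) ½ ½ G ⟨
      T ½ ½ (suc (suc (m ℕ.+ m))) G   ≡⟨ cong (λ n → T ½ ½ (suc n) G) (ℕ.+-suc m m) ⟨
      T ½ ½ (suc m ℕ.+ suc m) G       ∎
      where open ≡-Reasoning

    -- The probability that the simple random walk is back at its origin after `2m` steps.
    M²^-δ : ∀ m → M²^ m δ 0 0 ≡ w m
    M²^-δ m = begin
      M²^ m δ 0 0                                        ≡⟨ M²^-T m δ ⟩
      D (m ℕ.+ m) (λ i j → bin ½ ½ i j * δ i j)          ≡⟨ T-cong ½ ½ (m ℕ.+ m) (λ i j eq → trans (sym (δ-+ˡ m i j)) (δ-antidiagonal m m i j eq)) ⟩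
      D (m ℕ.+ m) (λ i j → bin ½ ½ i j * δ m i)          ≡⟨ D-δ m m (bin ½ ½) ⟩
      w m                                                ∎
      where open ≡-Reasoning

    module _ (x y : ℚ) where

      t u : ℚ
      t = (x - y) * (x - y)
      u = 4ℚ * (x * y)

      step : (ℕ → ℕ → ℚ) → ℕ → ℕ → ℚ
      step G i j = t * G i j + u * M² G i j

      -- The operator (x S + y S′)ⁿ (y S + x S′)ⁿ evaluated at the origin, where the second factor
      -- plays the role of the complex conjugate of the first. For `G = δ` only the terms with
      -- `a = j` and `b = i` survive, which leaves the sum of the squared weights.
      squared : ℕ → (ℕ → ℕ → ℚ) → ℚ
      squared n G = T x y n λ i j → T y x n λ a b → G (i ℕ.+ a) (j ℕ.+ b)

      -- (x S + y S′)(y S + x S′) = (x - y)² S S′ + 4xy (½ S + ½ S′)² for the two shifts S and S′,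
      -- and S S′ fixes invariant arrays.
      squared-suc : ∀ n {G} → Invariant G → squared (suc n) G ≡ squared n (step G)
      squared-suc n {G} inv = begin
        squared (suc n) G
          ≡⟨ D-bin-suc n x y (λ i j → T y x (suc n) λ a b → G (i ℕ.+ a) (j ℕ.+ b)) ⟩
        T x y n (λ i j → x * T y x (suc n) (λ a b → G (suc i ℕ.+ a) (j ℕ.+ b))
                       + y * T y x (suc n) (λ a b → G (i ℕ.+ a) (suc j ℕ.+ b)))
          ≡⟨ T-cong x y n (λ i j _ → inner i j) ⟩
        squared n (step G) ∎
        where
        open ≡-Reasoning
        eq : ∀ x y a b c → x * (y * a + x * b) + y * (y * b + x * c) ≡
             (x - y) * (x - y) * b + 4ℚ * (x * y) * (½ * (½ * a + ½ * b) + ½ * (½ * b + ½ * c))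
        eq = RingSolver.solve-∀ ring
        pointwise : ∀ i j a b →
          x * (y * G (suc i ℕ.+ suc a) (j ℕ.+ b) + x * G (suc i ℕ.+ a) (j ℕ.+ suc b)) +
          y * (y * G (i ℕ.+ suc a) (suc j ℕ.+ b) + x * G (i ℕ.+ a) (suc j ℕ.+ suc b)) ≡
          step G (i ℕ.+ a) (j ℕ.+ b)
        pointwise i j a b rewrite ℕ.+-suc i a | ℕ.+-suc j b =
          trans (eq x y (G (suc (suc (i ℕ.+ a))) (j ℕ.+ b)) (G (suc (i ℕ.+ a)) (suc (j ℕ.+ b))) (G (i ℕ.+ a) (suc (suc (j ℕ.+ b)))))
            (cong (λ g → t * g + u * M² G (i ℕ.+ a) (j ℕ.+ b)) (inv (i ℕ.+ a) (j ℕ.+ b)))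
        inner : ∀ i j →
          x * T y x (suc n) (λ a b → G (suc i ℕ.+ a) (j ℕ.+ b)) + y * T y x (suc n) (λ a b → G (i ℕ.+ a) (suc j ℕ.+ b)) ≡
          T y x n (λ a b → step G (i ℕ.+ a) (j ℕ.+ b))
        inner i j = begin
          x * T y x (suc n) (λ a b → G (suc i ℕ.+ a) (j ℕ.+ b)) + y * T y x (suc n) (λ a b → G (i ℕ.+ a) (suc j ℕ.+ b))
            ≡⟨ cong₂ (λ p q → x * p + y * q) (D-bin-suc n y x λ a b → G (suc i ℕ.+ a) (j ℕ.+ b))
                                             (D-bin-suc n y x λ a b → G (i ℕ.+ a) (suc j ℕ.+ b)) ⟩
          x * T y x n (λ a b → y * G (suc i ℕ.+ suc a) (j ℕ.+ b) + x * G (suc i ℕ.+ a) (j ℕ.+ suc b)) +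
          y * T y x n (λ a b → y * G (i ℕ.+ suc a) (suc j ℕ.+ b) + x * G (i ℕ.+ a) (suc j ℕ.+ suc b))
            ≡⟨ T-linear y x n x y (λ a b → y * G (suc i ℕ.+ suc a) (j ℕ.+ b) + x * G (suc i ℕ.+ a) (j ℕ.+ suc b))
                                  (λ a b → y * G (i ℕ.+ suc a) (suc j ℕ.+ b) + x * G (i ℕ.+ a) (suc j ℕ.+ suc b)) ⟨
          T y x n (λ a b → x * (y * G (suc i ℕ.+ suc a) (j ℕ.+ b) + x * G (suc i ℕ.+ a) (j ℕ.+ suc b)) +
                           y * (y * G (i ℕ.+ suc a) (suc j ℕ.+ b) + x * G (i ℕ.+ a) (suc j ℕ.+ suc b)))
            ≡⟨ T-cong y x n (λ a b _ → pointwise i j a b) ⟩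
          T y x n (λ a b → step G (i ℕ.+ a) (j ℕ.+ b)) ∎

      squared-mixture : ∀ n {G} → Invariant G → squared n G ≡ T t u n (λ _ m → M²^ m G 0 0)
      squared-mixture zero    {G} inv = cong (1ℚ *_) (ℚ.*-identityˡ (G 0 0))
      squared-mixture (suc n) {G} inv = begin
        squared (suc n) G                                     ≡⟨ squared-suc n inv ⟩
        squared n (step G)                                    ≡⟨ squared-mixture n step-invariant ⟩
        T t u n (λ _ m → M²^ m (step G) 0 0)                  ≡⟨ T-cong t u n (λ _ m _ → M²^-linear m t u G (M² G) 0 0) ⟩
        T t u n (λ _ m → t * M²^ m G 0 0 + u * M²^ m (M² G) 0 0)
                                                              ≡⟨ D-bin-suc n t u (λ _ m → M²^ m G 0 0) ⟨
        T t u (suc n) (λ _ m → M²^ m G 0 0)                   ∎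
        where
        open ≡-Reasoning
        step-invariant : Invariant (step G)
        step-invariant i j = cong₂ (λ a b → t * a + u * b) (inv i j) (M-invariant (M-invariant inv) i j)

      D-bin² : ∀ n → D n (λ i j → bin x y i j * bin x y i j) ≡ D n (λ l m → bin t u l m * w m)
      D-bin² n = begin
        D n (λ i j → bin x y i j * bin x y i j)               ≡⟨ T-cong x y n collapse ⟨
        squared n δ                                           ≡⟨ squared-mixture n (λ _ _ → refl) ⟩
        T t u n (λ _ m → M²^ m δ 0 0)                         ≡⟨ T-cong t u n (λ _ m _ → M²^-δ m) ⟩
        D n (λ l m → bin t u l m * w m)                       ∎
        where
        open ≡-Reasoning
        collapse : ∀ i j → i ℕ.+ j ≡ n → T y x n (λ a b → δ (i ℕ.+ a) (j ℕ.+ b)) ≡ bin x y i j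
        collapse i j refl = begin
          T y x (i ℕ.+ j) (λ a b → δ (i ℕ.+ a) (j ℕ.+ b))     ≡⟨ T-cong y x (i ℕ.+ j) (λ a b → δ-antidiagonal i j a b) ⟩
          T y x (i ℕ.+ j) (λ a b → δ j a)                     ≡⟨ cong (λ n → T y x n λ a b → δ j a) (ℕ.+-comm i j) ⟩
          D (j ℕ.+ i) (λ a b → bin y x a b * δ j a)           ≡⟨ D-δ j i (bin y x) ⟩
          bin y x j i                                         ≡⟨ bin-sym y x j i ⟩
          bin x y i j                                         ∎

  open SquareMixture using (D-bin²)

  w-suc : ∀ m → (ι (suc m) + ι (suc m)) * w (suc m) ≡ ι (suc (m ℕ.+ m)) * w m
  w-suc m = begin
    (ι (suc m) + ι (suc m)) * ((C m (suc m) + C (suc m) m) * (½ * ½ ^ m * (½ * ½ ^ m)))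
      ≡⟨ cong (λ c → (ι (suc m) + ι (suc m)) * ((C m (suc m) + c) * (½ * ½ ^ m * (½ * ½ ^ m)))) (C-sym (suc m) m) ⟩
    (ι (suc m) + ι (suc m)) * ((C m (suc m) + C m (suc m)) * (½ * ½ ^ m * (½ * ½ ^ m)))
      ≡⟨ eq (ι (suc m)) (C m (suc m)) (½ ^ m) ⟩
    ι (suc m) * C m (suc m) * (½ ^ m * ½ ^ m)
      ≡⟨ cong (_* (½ ^ m * ½ ^ m)) (C-absorbʳ m m) ⟩
    ι (suc (m ℕ.+ m)) * C m m * (½ ^ m * ½ ^ m)
      ≡⟨ ℚ.*-assoc (ι (suc (m ℕ.+ m))) (C m m) (½ ^ m * ½ ^ m) ⟩
    ι (suc (m ℕ.+ m)) * w m ∎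
    where
    open ≡-Reasoning
    eq : ∀ a c h → (a + a) * ((c + c) * (½ * h * (½ * h))) ≡ a * c * (h * h)
    eq = RingSolver.solve-∀ ring

  w-pos : ∀ m → 0ℚ < w m
  w-pos zero    = 0<1
  w-pos (suc m) = *-cancelˡ-< (ℚ.<⇒≤ 0<2m+2) (subst₂ _<_ (sym (ℚ.*-zeroʳ (ι (suc m) + ι (suc m)))) (sym (w-suc m))
    (*-pos (ι-suc-pos (m ℕ.+ m)) (w-pos m)))
    where 0<2m+2 = +-pos (ι-suc-pos m) (ι-nonNeg (suc m))

  w≤1 : ∀ m → w m ≤ 1ℚ
  w≤1 m = bin≤1 (ℚ.<⇒≤ (ℚ.positive⁻¹ ½)) (ℚ.<⇒≤ (ℚ.positive⁻¹ ½)) refl m m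

  -- Counting words

  ind : ∀ {P : Set} → Dec P → ℚ
  ind (yes _) = 1ℚ
  ind (no  _) = 0ℚ

  ind-cong : ∀ {P Q : Set} (p? : Dec P) (q? : Dec Q) → (P → Q) → (Q → P) → ind p? ≡ ind q?
  ind-cong (yes p) (yes q) f g = refl
  ind-cong (yes p) (no ¬q) f g = contradiction (f p) ¬q
  ind-cong (no ¬p) (yes q) f g = contradiction (g q) ¬p
  ind-cong (no ¬p) (no ¬q) f g = refl

  ∑ : ∀ {A : Set} → List A → (A → ℚ) → ℚ
  ∑ []       φ = 0ℚ
  ∑ (x ∷ xs) φ = φ x + ∑ xs φ

  ∑-cong : ∀ {A : Set} (xs : List A) {φ ψ : A → ℚ} → (∀ x → φ x ≡ ψ x) → ∑ xs φ ≡ ∑ xs ψ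
  ∑-cong []       eq = refl
  ∑-cong (x ∷ xs) eq = cong₂ _+_ (eq x) (∑-cong xs eq)

  ∑-++ : ∀ {A : Set} (xs ys : List A) φ → ∑ (xs List.++ ys) φ ≡ ∑ xs φ + ∑ ys φ
  ∑-++ []       ys φ = sym (ℚ.+-identityˡ (∑ ys φ))
  ∑-++ (x ∷ xs) ys φ = trans (cong (φ x +_) (∑-++ xs ys φ)) (sym (ℚ.+-assoc (φ x) (∑ xs φ) (∑ ys φ)))

  ∑-map : ∀ {A B : Set} (f : A → B) xs φ → ∑ (map f xs) φ ≡ ∑ xs (φ ∘ f)
  ∑-map f []       φ = refl
  ∑-map f (x ∷ xs) φ = cong (φ (f x) +_) (∑-map f xs φ)

  ∑-*ʳ : ∀ {A : Set} (xs : List A) c φ → ∑ xs (λ x → φ x * c) ≡ ∑ xs φ * c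
  ∑-*ʳ []       c φ = sym (ℚ.*-zeroˡ c)
  ∑-*ʳ (x ∷ xs) c φ = trans (cong (φ x * c +_) (∑-*ʳ xs c φ)) (sym (ℚ.*-distribʳ-+ c (φ x) (∑ xs φ)))

  ∑-0 : ∀ {A : Set} (xs : List A) → ∑ xs (λ _ → 0ℚ) ≡ 0ℚ
  ∑-0 []       = refl
  ∑-0 (x ∷ xs) = trans (ℚ.+-identityˡ (∑ xs λ _ → 0ℚ)) (∑-0 xs)

  ∑-cartesianProductWith : ∀ {A B E : Set} (f : A → B → E) xs ys φ →
    ∑ (cartesianProductWith f xs ys) φ ≡ ∑ xs λ x → ∑ ys λ y → φ (f x y)
  ∑-cartesianProductWith f []       ys φ = refl
  ∑-cartesianProductWith f (x ∷ xs) ys φ = trans (∑-++ (map (f x) ys) (cartesianProductWith f xs ys) φ)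
    (cong₂ _+_ (∑-map (f x) ys φ) (∑-cartesianProductWith f xs ys φ))

  ∑-D : ∀ {A : Set} (xs : List A) n (F : A → ℕ → ℕ → ℚ) →
        ∑ xs (λ x → D n (F x)) ≡ D n λ i j → ∑ xs λ x → F x i j
  ∑-D []       n F = sym (D-0 n)
  ∑-D (x ∷ xs) n F = trans (cong (D n (F x) +_) (∑-D xs n F)) (sym (D-+ n (F x) λ i j → ∑ xs λ x → F x i j))

  ι-length-filter : ∀ {A : Set} {P : A → Set} (P? : ∀ x → Dec (P x)) xs →
                    ι (length (filter P? xs)) ≡ ∑ xs (ind ∘ P?)
  ι-length-filter P? [] = ι-0
  ι-length-filter P? (x ∷ xs) with P? x
  ... | yes _ = trans (ι-suc (length (filter P? xs))) (cong (1ℚ +_) (ι-length-filter P? xs))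
  ... | no  _ = trans (ι-length-filter P? xs) (sym (ℚ.+-identityˡ (∑ xs (ind ∘ P?))))

  ∑-words-suc : ∀ k n (φ : Vec (Fin k) (suc n) → ℚ) →
                ∑ (words k (suc n)) φ ≡ ∑ (allFin k) λ i → ∑ (words k n) λ v → φ (i ∷ v)
  ∑-words-suc k n φ = ∑-cartesianProductWith _∷_ (allFin k) (words k n) φ

  ∑-words-++ : ∀ k m n (φ : Vec (Fin k) (m ℕ.+ n) → ℚ) →
               ∑ (words k (m ℕ.+ n)) φ ≡ ∑ (words k m) λ u → ∑ (words k n) λ v → φ (u Vec.++ v)
  ∑-words-++ k zero    n φ = sym (ℚ.+-identityʳ (∑ (words k n) φ))
  ∑-words-++ k (suc m) n φ = begin
    ∑ (words k (suc m ℕ.+ n)) φ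
      ≡⟨ ∑-words-suc k (m ℕ.+ n) φ ⟩
    ∑ (allFin k) (λ i → ∑ (words k (m ℕ.+ n)) λ v → φ (i ∷ v))
      ≡⟨ ∑-cong (allFin k) (λ i → ∑-words-++ k m n λ v → φ (i ∷ v)) ⟩
    ∑ (allFin k) (λ i → ∑ (words k m) λ u → ∑ (words k n) λ v → φ (i ∷ u Vec.++ v))
      ≡⟨ ∑-words-suc k m (λ u → ∑ (words k n) λ v → φ (u Vec.++ v)) ⟨
    ∑ (words k (suc m)) (λ u → ∑ (words k n) λ v → φ (u Vec.++ v)) ∎
    where open ≡-Reasoning

  ∑-allFin-suc : ∀ k (φ : Fin (suc k) → ℚ) → ∑ (allFin (suc k)) φ ≡ φ zero + ∑ (allFin k) (φ ∘ suc)
  ∑-allFin-suc k φ = cong (φ zero +_) (trans (cong (λ xs → ∑ xs φ) (sym (List.map-tabulate (λ i → i) suc)))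
    (∑-map suc (allFin k) φ))

  predFin : ∀ {k} → Fin (suc k) → Maybe (Fin k)
  predFin zero    = nothing
  predFin (suc i) = just i

  nonzeros : ∀ {k} → List (Fin (suc k)) → List (Fin k)
  nonzeros = mapMaybe predFin

  ↭-zeros++nonzeros : ∀ {k} (xs : List (Fin (suc k))) →
                      ∃[ c ] xs ↭ replicate c zero List.++ map suc (nonzeros xs)
  ↭-zeros++nonzeros []           = 0 , ↭-refl
  ↭-zeros++nonzeros (zero ∷ xs)  = let c , p = ↭-zeros++nonzeros xs in suc c , prep zero p
  ↭-zeros++nonzeros (suc i ∷ xs) = let c , p = ↭-zeros++nonzeros xs in
    c , ↭-trans (prep (suc i) p) (↭-sym (↭.shift (suc i) (replicate c zero) (map suc (nonzeros xs))))

  -- Up to rearrangement `nonzeros` forgets only the number of zeros, and the equal lengths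
  -- determine that.
  nonzeros-↭⁻ : ∀ {k} (xs ys : List (Fin (suc k))) → length xs ≡ length ys → nonzeros xs ↭ nonzeros ys → xs ↭ ys
  nonzeros-↭⁻ xs ys eq p with ↭-zeros++nonzeros xs | ↭-zeros++nonzeros ys
  ... | c , q | d , r = ↭-trans q (↭-trans
      (↭.++⁺ (↭-reflexive (cong (λ e → replicate e zero) c≡d)) (↭.map⁺ suc p)) (↭-sym r))
    where
    total : ∀ {xs} e {us} → xs ↭ replicate e zero List.++ map suc us → length xs ≡ e ℕ.+ length us
    total e {us} q = trans (↭.↭-length q) (trans (List.length-++ (replicate e zero))
      (cong₂ ℕ._+_ (List.length-replicate e) (List.length-map suc us)))
    c≡d : c ≡ d
    c≡d = ℕ.+-cancelʳ-≡ (length (nonzeros xs)) c d (trans (sym (total c q)) (trans eq (trans (total d r)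
      (cong (d ℕ.+_) (sym (↭.↭-length p))))))

  eqv : ∀ {k} → List (Fin k) → List (Fin k) → ℚ
  eqv xs ys = ind (↭-dec Fin._≟_ ys xs)

  eqv-nonzeros : ∀ {k} (xs ys : List (Fin (suc k))) → length ys ≡ length xs →
                 eqv xs ys ≡ eqv (nonzeros xs) (nonzeros ys)
  eqv-nonzeros xs ys eq = ind-cong (↭-dec Fin._≟_ ys xs) (↭-dec Fin._≟_ (nonzeros ys) (nonzeros xs))
    (↭.mapMaybe-↭ predFin) (nonzeros-↭⁻ ys xs eq)

  eqv-length : ∀ {k} (xs ys : List (Fin k)) → ¬ length ys ≡ length xs → eqv xs ys ≡ 0ℚ
  eqv-length xs ys neq with ↭-dec Fin._≟_ ys xs
  ... | yes p = contradiction (↭.↭-length p) neq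
  ... | no  _ = refl

  -- A word is given by the positions of its zeros, `C i j` choices, and the subword of its other
  -- letters. In the induction the first letter is zero or not, and the two cases combine by
  -- `D-pascal`.
  ∑-words-nonzeros : ∀ k n (φ : List (Fin k) → ℚ) →
    ∑ (words (suc k) n) (λ v → φ (nonzeros (toList v))) ≡
    D n (λ i j → C i j * ∑ (words k j) (λ v → φ (toList v)))
  ∑-words-nonzeros k zero    φ = sym (ℚ.*-identityˡ (φ [] + 0ℚ))
  ∑-words-nonzeros k (suc n) φ = begin
    ∑ (words (suc k) (suc n)) (λ v → φ (nonzeros (toList v)))
      ≡⟨ ∑-words-suc (suc k) n (λ v → φ (nonzeros (toList v))) ⟩
    ∑ (allFin (suc k)) (λ i → ∑ (words (suc k) n) λ v → φ (nonzeros (toList (i ∷ v))))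
      ≡⟨ ∑-allFin-suc k (λ i → ∑ (words (suc k) n) λ v → φ (nonzeros (toList (i ∷ v)))) ⟩
    ∑ (words (suc k) n) (λ v → φ (nonzeros (toList v))) +
    ∑ (allFin k) (λ i → ∑ (words (suc k) n) λ v → φ (i ∷ nonzeros (toList v)))
      ≡⟨ cong₂ _+_ (∑-words-nonzeros k n φ) (∑-cong (allFin k) λ i → ∑-words-nonzeros k n (φ ∘ (i ∷_))) ⟩
    D n (λ i j → C i j * V j φ) + ∑ (allFin k) (λ x → D n λ i j → C i j * V j (φ ∘ (x ∷_)))
      ≡⟨ cong (D n (λ i j → C i j * V j φ) +_) (∑-D (allFin k) n λ x i j → C i j * V j (φ ∘ (x ∷_))) ⟩
    D n (λ i j → C i j * V j φ) + D n (λ i j → ∑ (allFin k) λ x → C i j * V j (φ ∘ (x ∷_)))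
      ≡⟨ D-+ n (λ i j → C i j * V j φ) (λ i j → ∑ (allFin k) λ x → C i j * V j (φ ∘ (x ∷_))) ⟨
    D n (λ i j → C i j * V j φ + ∑ (allFin k) λ x → C i j * V j (φ ∘ (x ∷_)))
      ≡⟨ D-cong n (λ i j _ → factor i j) ⟩
    D n (λ i j → C i j * (V j φ + V (suc j) φ))
      ≡⟨ D-pascal n (λ _ j → V j φ) ⟨
    D (suc n) (λ i j → C i j * V j φ) ∎
    where
    open ≡-Reasoning
    V : ℕ → (List (Fin k) → ℚ) → ℚ
    V j ψ = ∑ (words k j) λ v → ψ (toList v)
    factor : ∀ i j → C i j * V j φ + ∑ (allFin k) (λ x → C i j * V j (φ ∘ (x ∷_))) ≡ C i j * (V j φ + V (suc j) φ)
    factor i j = begin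
      C i j * V j φ + ∑ (allFin k) (λ x → C i j * V j (φ ∘ (x ∷_)))
        ≡⟨ cong (C i j * V j φ +_) (∑-cong (allFin k) λ x → ℚ.*-comm (C i j) (V j (φ ∘ (x ∷_)))) ⟩
      C i j * V j φ + ∑ (allFin k) (λ x → V j (φ ∘ (x ∷_)) * C i j)
        ≡⟨ cong (C i j * V j φ +_) (∑-*ʳ (allFin k) (C i j) λ x → V j (φ ∘ (x ∷_))) ⟩
      C i j * V j φ + ∑ (allFin k) (λ x → V j (φ ∘ (x ∷_))) * C i j
        ≡⟨ cong (λ s → C i j * V j φ + s * C i j) (∑-words-suc k j (φ ∘ toList)) ⟨
      C i j * V j φ + V (suc j) φ * C i j
        ≡⟨ cong (C i j * V j φ +_) (ℚ.*-comm (V (suc j) φ) (C i j)) ⟩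
      C i j * V j φ + C i j * V (suc j) φ
        ≡⟨ ℚ.*-distribˡ-+ (C i j) (V j φ) (V (suc j) φ) ⟨
      C i j * (V j φ + V (suc j) φ) ∎

  squares : ℕ → ℕ → ℚ
  squares k n = ι (abelianSquares k n)

  squares-∑ : ∀ k n → squares k n ≡ ∑ (words k n) λ u → ∑ (words k n) λ v → eqv (toList u) (toList v)
  squares-∑ k n = begin
    squares k n
      ≡⟨ ι-length-filter (abelianSquare? k n) (words k (n ℕ.+ n)) ⟩
    ∑ (words k (n ℕ.+ n)) (ind ∘ abelianSquare? k n)
      ≡⟨ ∑-words-++ k n n (ind ∘ abelianSquare? k n) ⟩
    ∑ (words k n) (λ u → ∑ (words k n) λ v → ind (abelianSquare? k n (u Vec.++ v)))
      ≡⟨ ∑-cong (words k n) (λ u → ∑-cong (words k n) λ v → ind-cong (abelianSquare? k n (u Vec.++ v))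
           (↭-dec Fin._≟_ (toList v) (toList u)) (to u v) (λ p → u , v , refl , p)) ⟩
    ∑ (words k n) (λ u → ∑ (words k n) λ v → eqv (toList u) (toList v)) ∎
    where
    open ≡-Reasoning
    to : ∀ u v → AbelianSquare k n (u Vec.++ v) → toList v ↭ toList u
    to u v (x , x′ , eq , p) with refl , refl ← Vec.++-injective u x eq = p

  δ-refl : ∀ i → δ i i ≡ 1ℚ
  δ-refl zero    = refl
  δ-refl (suc i) = δ-refl i

  δ-≢ : ∀ i j → ¬ i ≡ j → δ i j ≡ 0ℚ
  δ-≢ zero    zero    neq = contradiction refl neq
  δ-≢ zero    (suc j) neq = refl
  δ-≢ (suc i) zero    neq = refl
  δ-≢ (suc i) (suc j) neq = δ-≢ i j (neq ∘ cong suc)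

  -- Only the number of occurrences of the letter zero and the subword of the other letters matter.
  squares-suc : ∀ k n → squares (suc k) n ≡ D n λ i j → C i j * (C i j * squares k j)
  squares-suc k n = begin
    squares (suc k) n
      ≡⟨ squares-∑ (suc k) n ⟩
    ∑ (words (suc k) n) (λ u → ∑ (words (suc k) n) λ v → eqv (toList u) (toList v))
      ≡⟨ ∑-cong (words (suc k) n) (λ u → ∑-cong (words (suc k) n) λ v → eqv-nonzeros (toList u) (toList v)
           (trans (Vec.length-toList v) (sym (Vec.length-toList u)))) ⟩
    ∑ (words (suc k) n) (λ u → ∑ (words (suc k) n) λ v → eqv (nonzeros (toList u)) (nonzeros (toList v)))
      ≡⟨ ∑-cong (words (suc k) n) (λ u → ∑-words-nonzeros k n (eqv (nonzeros (toList u)))) ⟩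
    ∑ (words (suc k) n) (λ u → E (nonzeros (toList u)))
      ≡⟨ ∑-words-nonzeros k n E ⟩
    D n (λ i j → C i j * ∑ (words k j) λ u → E (toList u))
      ≡⟨ D-cong n (λ i j i+j≡n → cong (C i j *_) (inner i j i+j≡n)) ⟩
    D n (λ i j → C i j * (C i j * squares k j)) ∎
    where
    open ≡-Reasoning
    E : List (Fin k) → ℚ
    E xs = D n λ a b → C a b * ∑ (words k b) λ v → eqv xs (toList v)
    -- Words of different lengths are never rearrangements of each other, so only `b = j`, that is
    -- `a = i`, contributes. The factor `δ i a` brings this into the form required by `D-δ`.
    summand : ∀ i j → i ℕ.+ j ≡ n → (u : Vec (Fin k) j) → ∀ a b → a ℕ.+ b ≡ n →
      C a b * ∑ (words k b) (λ v → eqv (toList u) (toList v)) ≡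
      C a b * ∑ (words k j) (λ v → eqv (toList u) (toList v)) * δ i a
    summand i j i+j≡n u a b a+b≡n using F ← C a b * ∑ (words k j) λ v → eqv (toList u) (toList v) with i ℕ.≟ a
    ... | yes refl with refl ← ℕ.+-cancelˡ-≡ i j b (trans i+j≡n (sym a+b≡n)) =
      sym (trans (cong (F *_) (δ-refl i)) (ℚ.*-identityʳ F))
    ... | no i≢a = trans (cong (C a b *_) (trans (∑-cong (words k b) λ v → eqv-length (toList u) (toList v) (neq v)) (∑-0 (words k b))))
      (trans (ℚ.*-zeroʳ (C a b)) (sym (trans (cong (F *_) (δ-≢ i a i≢a)) (ℚ.*-zeroʳ F))))
      where
      neq : ∀ v → ¬ length (toList v) ≡ length (toList u)
      neq v eq = i≢a (ℕ.+-cancelʳ-≡ j i a (trans i+j≡n (trans (sym a+b≡n)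
        (cong (a ℕ.+_) (trans (sym (Vec.length-toList v)) (trans eq (Vec.length-toList u)))))))
    inner : ∀ i j → i ℕ.+ j ≡ n → ∑ (words k j) (λ u → E (toList u)) ≡ C i j * squares k j
    inner i j refl = begin
      ∑ (words k j) (λ u → E (toList u))
        ≡⟨ ∑-cong (words k j) (λ u → trans (D-cong n (summand i j refl u)) (D-δ i j λ a b → C a b * ∑ (words k j) λ v → eqv (toList u) (toList v))) ⟩
      ∑ (words k j) (λ u → C i j * ∑ (words k j) λ v → eqv (toList u) (toList v))
        ≡⟨ ∑-cong (words k j) (λ u → ℚ.*-comm (C i j) (∑ (words k j) λ v → eqv (toList u) (toList v))) ⟩
      ∑ (words k j) (λ u → (∑ (words k j) λ v → eqv (toList u) (toList v)) * C i j)
        ≡⟨ ∑-*ʳ (words k j) (C i j) (λ u → ∑ (words k j) λ v → eqv (toList u) (toList v)) ⟩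
      (∑ (words k j) λ u → ∑ (words k j) λ v → eqv (toList u) (toList v)) * C i j
        ≡⟨ cong (_* C i j) (squares-∑ k j) ⟨
      squares k j * C i j
        ≡⟨ ℚ.*-comm (squares k j) (C i j) ⟩
      C i j * squares k j ∎

  -- The empty alphabet has only the empty word, so a single term of `squares-suc` survives.
  squares-1 : ∀ n → squares 1 n ≡ 1ℚ
  squares-1 n = begin
    squares 1 n                                       ≡⟨ squares-suc 0 n ⟩
    D n (λ i j → C i j * (C i j * squares 0 j))       ≡⟨ D-cong n (λ i j eq → trans (cong (λ s → C i j * (C i j * s)) (squares-0 i j eq))
                                                           (sym (ℚ.*-assoc (C i j) (C i j) (δ n i)))) ⟩
    D n (λ i j → C i j * C i j * δ n i)               ≡⟨ cong (λ m → D m λ i j → C i j * C i j * δ n i) (ℕ.+-identityʳ n) ⟨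
    D (n ℕ.+ 0) (λ i j → C i j * C i j * δ n i)       ≡⟨ D-δ n 0 (λ i j → C i j * C i j) ⟩
    C n 0 * C n 0                                     ≡⟨ cong₂ _*_ (C-zeroʳ n) (C-zeroʳ n) ⟩
    1ℚ                                                ∎
    where
    open ≡-Reasoning
    squares-0 : ∀ i j → i ℕ.+ j ≡ n → squares 0 j ≡ δ n i
    squares-0 i zero    eq = trans ι-1 (sym (trans (cong (λ m → δ m i) (trans (sym eq) (ℕ.+-identityʳ i))) (δ-refl i)))
    squares-0 i (suc j) eq = trans ι-0 (sym (δ-≢ n i λ n≡i → ℕ.m≢1+m+n i (trans (sym n≡i) (trans (sym eq) (ℕ.+-suc i j)))))

  -- The probability that two uniformly random words of length n over k + 1 letters are rearrangements
  -- of each other, where p₀ k is the probability of the first of k + 2 letters.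
  collision : ℕ → ℕ → ℚ
  p₀ p₁ : ℕ → ℚ
  p₀ k = inv (ι (suc (suc k))) (ι-suc-pos (suc k))
  p₁ k = p₀ k * ι (suc k)

  collision zero    n = 1ℚ
  collision (suc k) n = D n λ i j → bin (p₀ k) (p₁ k) i j * bin (p₀ k) (p₁ k) i j * collision k j

  squares-collision : ∀ k n → squares (suc k) n ≡ ι (suc k) ^ n * ι (suc k) ^ n * collision k n
  squares-collision zero    n = trans (squares-1 n) (sym (cong (λ z → z * z * 1ℚ) (trans (cong (_^ n) ι-1) (1^ n))))
  squares-collision (suc k) n = begin
    squares (suc (suc k)) n                                   ≡⟨ squares-suc (suc k) n ⟩
    D n (λ i j → C i j * (C i j * squares (suc k) j))         ≡⟨ D-cong n term ⟩
    D n (λ i j → K ^ n * K ^ n * (bin (p₀ k) (p₁ k) i j * bin (p₀ k) (p₁ k) i j * collision k j))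
                                                              ≡⟨ D-*ˡ n (K ^ n * K ^ n) (λ i j → bin (p₀ k) (p₁ k) i j * bin (p₀ k) (p₁ k) i j * collision k j) ⟩
    K ^ n * K ^ n * collision (suc k) n                       ∎
    where
    open ≡-Reasoning
    K = ι (suc (suc k))
    -- Multiplication by `K` turns `p₀ k` and `p₁ k` into 1 and `k + 1`, the numbers of letters in
    -- the two classes.
    scale : ∀ i j → K ^ (i ℕ.+ j) * (p₀ k ^ i * p₁ k ^ j) ≡ ι (suc k) ^ j
    scale i j = begin
      K ^ (i ℕ.+ j) * (p₀ k ^ i * p₁ k ^ j)                    ≡⟨ cong (_* (p₀ k ^ i * p₁ k ^ j)) (^-homo-* K i j) ⟩
      K ^ i * K ^ j * (p₀ k ^ i * p₁ k ^ j)                    ≡⟨ eq (K ^ i) (K ^ j) (p₀ k ^ i) (p₁ k ^ j) ⟩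
      K ^ i * p₀ k ^ i * (K ^ j * p₁ k ^ j)                    ≡⟨ cong₂ _*_ (^-distrib-* K (p₀ k) i) (^-distrib-* K (p₁ k) j) ⟨
      (K * p₀ k) ^ i * (K * (p₀ k * ι (suc k))) ^ j            ≡⟨ cong₂ (λ a b → a ^ i * b ^ j) Kx (trans (sym (ℚ.*-assoc K (p₀ k) (ι (suc k))))
                                                                  (trans (cong (_* ι (suc k)) Kx) (ℚ.*-identityˡ (ι (suc k))))) ⟩
      1ℚ ^ i * ι (suc k) ^ j                                 ≡⟨ trans (cong (_* ι (suc k) ^ j) (1^ i)) (ℚ.*-identityˡ (ι (suc k) ^ j)) ⟩
      ι (suc k) ^ j                                          ∎
      where
      Kx = p*inv K (ι-suc-pos (suc k))
      eq : ∀ a b c d → a * b * (c * d) ≡ a * c * (b * d)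
      eq = RingSolver.solve-∀ ring
    term : ∀ i j → i ℕ.+ j ≡ n → C i j * (C i j * squares (suc k) j) ≡
           K ^ n * K ^ n * (bin (p₀ k) (p₁ k) i j * bin (p₀ k) (p₁ k) i j * collision k j)
    term i j refl = begin
      C i j * (C i j * squares (suc k) j)
        ≡⟨ cong (λ s → C i j * (C i j * s)) (squares-collision k j) ⟩
      C i j * (C i j * (ι (suc k) ^ j * ι (suc k) ^ j * collision k j))
        ≡⟨ cong (λ s → C i j * (C i j * (s * s * collision k j))) (scale i j) ⟨
      C i j * (C i j * (K ^ n * (p₀ k ^ i * p₁ k ^ j) * (K ^ n * (p₀ k ^ i * p₁ k ^ j)) * collision k j))
        ≡⟨ eq (C i j) (K ^ n) (p₀ k ^ i * p₁ k ^ j) (collision k j) ⟩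
      K ^ n * K ^ n * (bin (p₀ k) (p₁ k) i j * bin (p₀ k) (p₁ k) i j * collision k j) ∎
      where
      eq : ∀ c a b p → c * (c * (a * b * (a * b) * p)) ≡ a * a * (c * b * (c * b) * p)
      eq = RingSolver.solve-∀ ring

  -- Asymptotic equivalence

  -- Positivity is part of the notion, so that common factors can be cancelled and the relation
  -- survives division.
  record Close (r p q : ℚ) : Set where
    constructor close
    field
      0<ˡ : 0ℚ < p
      0<ʳ : 0ℚ < q
      ≤r* : p ≤ r * q
      ≥r* : q ≤ r * p

  open Close

  close-refl : ∀ {r p} → 1ℚ ≤ r → 0ℚ < p → Close r p p
  close-refl 1≤r 0<p = close 0<p 0<p (p≤r*p (ℚ.<⇒≤ 0<p) 1≤r) (p≤r*p (ℚ.<⇒≤ 0<p) 1≤r)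

  close-sym : ∀ {r p q} → Close r p q → Close r q p
  close-sym (close a b c d) = close b a d c

  close-mono : ∀ {r s p q} → r ≤ s → Close r p q → Close s p q
  close-mono r≤s (close a b c d) = close a b
    (ℚ.≤-trans c (*-monoˡ-≤ _ (ℚ.<⇒≤ b) r≤s)) (ℚ.≤-trans d (*-monoˡ-≤ _ (ℚ.<⇒≤ a) r≤s))

  ≤*-trans : ∀ {r s p q t} → 0ℚ ≤ r → p ≤ r * q → q ≤ s * t → p ≤ r * s * t
  ≤*-trans {r} {s} {t = t} 0≤r p≤ q≤ = ℚ.≤-trans p≤
    (ℚ.≤-trans (*-monoʳ-≤ r 0≤r q≤) (ℚ.≤-reflexive (sym (ℚ.*-assoc r s t))))

  close-trans : ∀ {r s p q t} → 0ℚ ≤ r → 0ℚ ≤ s → Close r p q → Close s q t → Close (r * s) p t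
  close-trans {r} {s} {p} {q} {t} 0≤r 0≤s (close a _ c d) (close _ b e f) =
    close a b (≤*-trans 0≤r c e) (subst (λ z → t ≤ z * p) (ℚ.*-comm s r) (≤*-trans 0≤s f d))

  interchange : ∀ a b c d → (a * b) * (c * d) ≡ (a * c) * (b * d)
  interchange = RingSolver.solve-∀ ring

  close-* : ∀ {r s p q p′ q′} → Close r p q → Close s p′ q′ → Close (r * s) (p * p′) (q * q′)
  close-* {r} {s} {p} {q} {p′} {q′} (close a b c d) (close a′ b′ c′ d′) = close (*-pos a a′) (*-pos b b′)
    (subst (p * p′ ≤_) (interchange r q s q′) (*-mono-≤ (ℚ.<⇒≤ a) (ℚ.<⇒≤ a′) c c′))
    (subst (q * q′ ≤_) (interchange r p s p′) (*-mono-≤ (ℚ.<⇒≤ b) (ℚ.<⇒≤ b′) d d′))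

  close-cancelˡ : ∀ {r z p q} → 0ℚ < z → Close r (z * p) (z * q) → Close r p q
  close-cancelˡ {r} {z} {p} {q} 0<z (close a b c d) = close (cancel a) (cancel b)
    (*-cancelˡ-≤ 0<z (subst (z * p ≤_) (swap r z q) c)) (*-cancelˡ-≤ 0<z (subst (z * q ≤_) (swap r z p) d))
    where
    cancel : ∀ {t} → 0ℚ < z * t → 0ℚ < t
    cancel {t} h = *-cancelˡ-< (ℚ.<⇒≤ 0<z) (subst (_< z * t) (sym (ℚ.*-zeroʳ z)) h)
    swap : ∀ a b c → a * (b * c) ≡ b * (a * c)
    swap = RingSolver.solve-∀ ring

  -- Since `r ≤ r * r`, the factor can be kept as it is, instead of its possibly irrational root.
  ≤*-sqrt : ∀ {r p q} → 1ℚ ≤ r → 0ℚ ≤ q → p * p ≤ r * (q * q) → p ≤ r * q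
  ≤*-sqrt {r} {p} {q} 1≤r 0≤q p²≤ = sq-cancel-≤ (*-nonNeg 0≤r 0≤q)
    (ℚ.≤-trans p²≤ (subst (r * (q * q) ≤_) (interchange r r q q)
      (*-monoˡ-≤ (q * q) (*-nonNeg 0≤q 0≤q) (p≤r*p 0≤r 1≤r))))
    where 0≤r = ℚ.≤-trans 0≤1 1≤r

  close-sqrt : ∀ {r p q} → 1ℚ ≤ r → 0ℚ < p → 0ℚ < q → Close r (p * p) (q * q) → Close r p q
  close-sqrt 1≤r 0<p 0<q (close _ _ c d) = close 0<p 0<q (≤*-sqrt 1≤r (ℚ.<⇒≤ 0<q) c) (≤*-sqrt 1≤r (ℚ.<⇒≤ 0<p) d)

  ∃-root^ : ∀ n {r} → 1ℚ < r → ∃[ s ] 1ℚ < s × s ≤ r × s ^ n ≤ r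
  ∃-root^ zero    {r} 1<r = r , 1<r , ℚ.≤-refl , ℚ.<⇒≤ 1<r
  ∃-root^ (suc n) {r} 1<r =
    let t , 1<t , t²≤r = ∃-root 1<r
        s , 1<s , s≤t , sⁿ≤t = ∃-root^ n 1<t
        0≤t = ℚ.≤-trans 0≤1 (ℚ.<⇒≤ 1<t)
        0≤s = ℚ.≤-trans 0≤1 (ℚ.<⇒≤ 1<s)
    in s , 1<s , ℚ.≤-trans s≤t (ℚ.≤-trans (p≤r*p 0≤t (ℚ.<⇒≤ 1<t)) t²≤r) ,
       ℚ.≤-trans (*-mono-≤ 0≤s (^-nonNeg n 0≤s) s≤t sⁿ≤t) t²≤r

  -- The size is the index itself for sequences and the smaller coordinate for pairs, so that in a
  -- double limit both indices tend to infinity independently.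
  Eventually : {I : Set} (size : I → ℕ) → (I → Set) → Set
  Eventually size P = ∃[ N ] ∀ i → N ℕ.≤ size i → P i

  module Asymptotics {I : Set} (size : I → ℕ) where

    infix 4 _≈_
    _≈_ : (I → ℚ) → (I → ℚ) → Set
    p ≈ q = ∀ r → 1ℚ < r → Eventually size λ i → Close r (p i) (q i)

    ev-map : ∀ {P Q : I → Set} → (∀ i → P i → Q i) → Eventually size P → Eventually size Q
    ev-map f (N , h) = N , λ i N≤i → f i (h i N≤i)

    ev-zip : ∀ {P Q R : I → Set} → (∀ i → P i → Q i → R i) → Eventually size P → Eventually size Q → Eventually size R
    ev-zip f (M , g) (N , h) = M ℕ.⊔ N , λ i le →
      f i (g i (ℕ.m⊔n≤o⇒m≤o M N le)) (h i (ℕ.m⊔n≤o⇒n≤o M N le))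

    ≈-refl : ∀ {p : I → ℚ} → Eventually size (λ i → 0ℚ < p i) → p ≈ p
    ≈-refl pos r 1<r = ev-map (λ i → close-refl (ℚ.<⇒≤ 1<r)) pos

    ≈-sym : ∀ {p q} → p ≈ q → q ≈ p
    ≈-sym p≈q r 1<r = ev-map (λ i → close-sym) (p≈q r 1<r)

    ≈-trans : ∀ {p q t} → p ≈ q → q ≈ t → p ≈ t
    ≈-trans p≈q q≈t r 1<r =
      let s , 1<s , s²≤r = ∃-root 1<r
          0≤s = ℚ.≤-trans 0≤1 (ℚ.<⇒≤ 1<s)
      in ev-zip (λ i c d → close-mono s²≤r (close-trans 0≤s 0≤s c d)) (p≈q s 1<s) (q≈t s 1<s)

    ≈-* : ∀ {p q p′ q′} → p ≈ q → p′ ≈ q′ → (λ i → p i * p′ i) ≈ (λ i → q i * q′ i)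
    ≈-* p≈q p′≈q′ r 1<r =
      let s , 1<s , s²≤r = ∃-root 1<r
      in ev-zip (λ i c d → close-mono s²≤r (close-* c d)) (p≈q s 1<s) (p′≈q′ s 1<s)

    ≈-^ : ∀ {p q} n → p ≈ q → (λ i → p i ^ n) ≈ (λ i → q i ^ n)
    ≈-^ zero    p≈q = ≈-refl (0 , λ _ _ → 0<1)
    ≈-^ (suc n) p≈q = ≈-* p≈q (≈-^ n p≈q)

    ≈-cancelˡ : ∀ {z p q : I → ℚ} → Eventually size (λ i → 0ℚ < z i) → (λ i → z i * p i) ≈ (λ i → z i * q i) → p ≈ q
    ≈-cancelˡ {z} pos zp≈zq r 1<r = ev-zip (λ i → close-cancelˡ {z = z i}) pos (zp≈zq r 1<r)

    ≈-resp : ∀ {p q p′ q′ : I → ℚ} → (∀ i → p i ≡ p′ i) → (∀ i → q i ≡ q′ i) → p ≈ q → p′ ≈ q′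
    ≈-resp p≡p′ q≡q′ p≈q r 1<r = ev-map (λ i → subst₂ (Close r) (p≡p′ i) (q≡q′ i)) (p≈q r 1<r)

  open Asymptotics {ℕ} (λ n → n)

  size₂ : ℕ × ℕ → ℕ
  size₂ (m , n) = m ℕ.⊓ n

  module Pairs = Asymptotics size₂
  open Pairs using () renaming (_≈_ to _≈₂_)

  ev-proj₁ : ∀ {P : ℕ → Set} → Eventually (λ n → n) P → Eventually size₂ (P ∘ proj₁)
  ev-proj₁ (N , h) = N , λ { (m , n) le → h m (ℕ.≤-trans le (ℕ.m⊓n≤m m n)) }

  ev-proj₂ : ∀ {P : ℕ → Set} → Eventually (λ n → n) P → Eventually size₂ (P ∘ proj₂)
  ev-proj₂ (N , h) = N , λ { (m , n) le → h n (ℕ.≤-trans le (ℕ.m⊓n≤n m n)) }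

  ev-id-ι : ∀ p → Eventually (λ n → n) λ n → p ≤ ι n
  ev-id-ι p = let N , p≤N = ∃-ι≥ p in N , λ n N≤n → ℚ.≤-trans p≤N (ι-mono-≤ N≤n)

  -- Binomial tails

  module Tails {x y : ℚ} (0≤x : 0ℚ ≤ x) (0≤y : 0ℚ ≤ y) (x+y≡1 : x + y ≡ 1ℚ) where

    b : ℕ → ℕ → ℚ
    b = bin x y

    0≤b : ∀ i j → 0ℚ ≤ b i j
    0≤b = bin-nonNeg 0≤x 0≤y

    y≤1 : y ≤ 1ℚ
    y≤1 = ≤-by x 0≤x (trans (ℚ.+-comm y x) x+y≡1)

    bin-shift : ∀ i j → ι (suc i) * y * b (suc i) j ≡ ι (suc j) * x * b i (suc j)
    bin-shift i j = begin
      ι (suc i) * y * (C (suc i) j * (x * x ^ i * y ^ j))        ≡⟨ eq (ι (suc i)) y (C (suc i) j) x (x ^ i) (y ^ j) ⟩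
      ι (suc i) * C (suc i) j * (x * y * (x ^ i * y ^ j))        ≡⟨ cong (_* (x * y * (x ^ i * y ^ j))) (trans (C-absorb i j) (sym (C-absorbʳ i j))) ⟩
      ι (suc j) * C i (suc j) * (x * y * (x ^ i * y ^ j))        ≡⟨ eq₂ (ι (suc j)) y (C i (suc j)) x (x ^ i) (y ^ j) ⟨
      ι (suc j) * x * (C i (suc j) * (x ^ i * (y * y ^ j)))      ∎
      where
      open ≡-Reasoning
      eq : ∀ m y c x p q → m * y * (c * (x * p * q)) ≡ m * c * (x * y * (p * q))
      eq = RingSolver.solve-∀ ring
      eq₂ : ∀ m y c x p q → m * x * (c * (p * (y * q))) ≡ m * c * (x * y * (p * q))
      eq₂ = RingSolver.solve-∀ ring

    x≡1-y : x ≡ 1ℚ - y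
    x≡1-y = trans (eq x y) (cong (_- y) x+y≡1)
      where
      eq : ∀ x y → x ≡ x + y - y
      eq = RingSolver.solve-∀ ring

    -- For `x > 0` the hypothesis gives the ratio `1 + ε / x`, which is at least `1 + ε` as `x ≤ 1`.
    -- The proof avoids this division because `x` may be 0: it adds `y * (b′ - b)` to the hypothesis
    -- if `b ≤ b′`, and otherwise finds `b = 0`.
    growth : ∀ {b b′ ε} → 0ℚ ≤ b → 0ℚ ≤ b′ → 0ℚ < ε → b * (x + ε) ≤ x * b′ → b * (1ℚ + ε) ≤ b′
    growth {b} {b′} {ε} 0≤b 0≤b′ 0<ε h with ℚ.≤-total b b′
    ... | inj₁ b≤b′ = ≤-by (x * b′ - b * (x + ε) + y * (b′ - b))
        (+-nonNeg (p≤q⇒0≤q-p h) (*-nonNeg 0≤y (p≤q⇒0≤q-p b≤b′)))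
        (trans (eq b b′ ε x y) (trans (cong (λ z → b + z * (b′ - b)) x+y≡1) (eq₂ b b′)))
      where
      eq : ∀ b b′ ε x y → b * (1ℚ + ε) + (x * b′ - b * (x + ε) + y * (b′ - b)) ≡ b + (x + y) * (b′ - b)
      eq = RingSolver.solve-∀ ring
      eq₂ : ∀ b b′ → b + 1ℚ * (b′ - b) ≡ b′
      eq₂ = RingSolver.solve-∀ ring
    ... | inj₂ b′≤b = subst (λ z → z * (1ℚ + ε) ≤ b′) (sym b≡0) (subst (_≤ b′) (sym (ℚ.*-zeroˡ (1ℚ + ε))) 0≤b′)
      where
      bε≤0 : ε * b ≤ ε * 0ℚ
      bε≤0 = ≤-by (x * b′ - b * (x + ε) + x * (b - b′)) (+-nonNeg (p≤q⇒0≤q-p h) (*-nonNeg 0≤x (p≤q⇒0≤q-p b′≤b)))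
        (eq b b′ ε x)
        where
        eq : ∀ b b′ ε x → ε * b + (x * b′ - b * (x + ε) + x * (b - b′)) ≡ ε * 0ℚ
        eq = RingSolver.solve-∀ ring
      b≡0 : b ≡ 0ℚ
      b≡0 = ℚ.≤-antisym (*-cancelˡ-≤ 0<ε bε≤0) 0≤b

    -- With `n = suc i + j`, the hypothesis bounds `suc j` by `y n` and, through `x + y = 1`, gives
    -- `suc i ≥ (x + ε) n`. By `bin-shift` the weight therefore grows by at least the factor
    -- `(x + ε) / x`.
    tail-step : ∀ {ε} → 0ℚ < ε → ∀ i j → ι (suc j) + ε * ι (suc i ℕ.+ j) ≤ y * ι (suc i ℕ.+ j) →
                b (suc i) j * (1ℚ + ε) ≤ b i (suc j)
    tail-step {ε} 0<ε i j h = growth (0≤b (suc i) j) (0≤b i (suc j)) 0<ε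
      (*-cancelˡ-≤ 0<n (*-cancelˡ-≤ 0<y (begin
        y * (n * (b (suc i) j * (x + ε)))
          ≡⟨ eq y n (b (suc i) j) (x + ε) ⟩
        n * (x + ε) * (y * b (suc i) j)
          ≤⟨ *-monoˡ-≤ (y * b (suc i) j) (*-nonNeg 0≤y (0≤b (suc i) j)) n[x+ε]≤i ⟩
        ι (suc i) * (y * b (suc i) j)
          ≡⟨ ℚ.*-assoc (ι (suc i)) y (b (suc i) j) ⟨
        ι (suc i) * y * b (suc i) j
          ≡⟨ bin-shift i j ⟩
        ι (suc j) * x * b i (suc j)
          ≡⟨ ℚ.*-assoc (ι (suc j)) x (b i (suc j)) ⟩
        ι (suc j) * (x * b i (suc j))
          ≤⟨ *-monoˡ-≤ (x * b i (suc j)) (*-nonNeg 0≤x (0≤b i (suc j))) j≤yn ⟩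
        y * n * (x * b i (suc j))
          ≡⟨ ℚ.*-assoc y n (x * b i (suc j)) ⟩
        y * (n * (x * b i (suc j))) ∎)))
      where
      open ℚ.≤-Reasoning
      n = ι (suc i ℕ.+ j)
      0<n = ι-suc-pos (i ℕ.+ j)
      j≤yn : ι (suc j) ≤ y * n
      j≤yn = ℚ.≤-trans (≤-by (ε * n) (*-nonNeg (ℚ.<⇒≤ 0<ε) (ℚ.<⇒≤ 0<n)) refl) h
      0<y : 0ℚ < y
      0<y = *-cancelˡ-< (ℚ.<⇒≤ 0<n) (subst₂ _<_ (sym (ℚ.*-zeroʳ n)) (ℚ.*-comm y n) (ℚ.<-≤-trans (ι-suc-pos j) j≤yn))
      eq : ∀ y n b e → y * (n * (b * e)) ≡ n * e * (y * b)
      eq = RingSolver.solve-∀ ring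
      n[x+ε]≤i : n * (x + ε) ≤ ι (suc i)
      n[x+ε]≤i = ≤-by (y * n - (ι (suc j) + ε * n) + 1ℚ) (+-nonNeg (p≤q⇒0≤q-p h) 0≤1)
        (trans (cong₂ (λ a c → n * (a + ε) + (y * n - (c + ε * n) + 1ℚ)) x≡1-y (ι-suc j))
          (trans (eq₂ n y ε (ι j)) (trans (cong (_- ι j) (ι-+ (suc i) j)) (eq₃ (ι (suc i)) (ι j)))))
        where
        eq₂ : ∀ n y e j → n * (1ℚ - y + e) + (y * n - (1ℚ + j + e * n) + 1ℚ) ≡ n - j
        eq₂ = RingSolver.solve-∀ ring
        eq₃ : ∀ i j → i + j - j ≡ i
        eq₃ = RingSolver.solve-∀ ring

    tail-iterate : ∀ {ε} → 0ℚ < ε → ∀ s i j {n} → s ℕ.+ i ℕ.+ j ≡ n → ι (s ℕ.+ j) + ε * ι n ≤ y * ι n →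
                   b (s ℕ.+ i) j * (1ℚ + ε) ^ s ≤ b i (s ℕ.+ j)
    tail-iterate 0<ε zero    i j eq h = ℚ.≤-reflexive (ℚ.*-identityʳ (b i j))
    tail-iterate {ε} 0<ε (suc s) i j refl h = begin
      b (suc s ℕ.+ i) j * ((1ℚ + ε) * (1ℚ + ε) ^ s)
        ≡⟨ ℚ.*-assoc (b (suc s ℕ.+ i) j) (1ℚ + ε) ((1ℚ + ε) ^ s) ⟨
      b (suc s ℕ.+ i) j * (1ℚ + ε) * (1ℚ + ε) ^ s
        ≤⟨ *-monoˡ-≤ ((1ℚ + ε) ^ s) (^-nonNeg s (+-nonNeg 0≤1 (ℚ.<⇒≤ 0<ε))) (tail-step 0<ε (s ℕ.+ i) j
             (ℚ.≤-trans (ℚ.+-monoˡ-≤ _ (ι-mono-≤ (ℕ.s≤s (ℕ.m≤n+m j s)))) h)) ⟩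
      b (s ℕ.+ i) (suc j) * (1ℚ + ε) ^ s
        ≤⟨ tail-iterate 0<ε s i (suc j) (ℕ.+-suc (s ℕ.+ i) j)
             (subst (λ m → ι m + ε * ι (suc s ℕ.+ i ℕ.+ j) ≤ y * ι (suc s ℕ.+ i ℕ.+ j)) (sym (ℕ.+-suc s j)) h) ⟩
      b i (s ℕ.+ suc j)
        ≡⟨ cong (b i) (ℕ.+-suc s j) ⟩
      b i (suc s ℕ.+ j) ∎
      where open ℚ.≤-Reasoning

    -- Take q with qKL ≤ n < (q + 1)KL, where 1 ≤ εL: moving qK places towards the mean gains (1 + ε)^{qK} ≥ (qε)^K.
    lower-tail : ∀ {ε} → 0ℚ < ε → ∀ K → ∃[ M ] 0ℚ < M × Eventually (λ n → n) λ n → ∀ i j → i ℕ.+ j ≡ n →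
                 ι j + (ε + ε) * ι n ≤ y * ι n → b i j * ι n ^ suc K ≤ M
    lower-tail {ε} 0<ε K′ = A ^ K , ^-pos K 0<A , P , bound
      where
      K = suc K′
      L′ = proj₁ (∃-ι≥ (inv ε 0<ε))
      L = suc L′
      P = K ℕ.* L
      1≤εL : 1ℚ ≤ ε * ι L
      1≤εL = subst (_≤ ε * ι L) (p*inv ε 0<ε) (*-monoʳ-≤ ε (ℚ.<⇒≤ 0<ε)
        (ℚ.≤-trans (proj₂ (∃-ι≥ (inv ε 0<ε))) (ι-mono-≤ (ℕ.n≤1+n L′))))
      -- As `q ≥ 1`, `n < (q + 1) P ≤ 2 q P`, which is `A` times `q ε`.
      A = (ι P + ι P) * inv ε 0<ε
      0<P : 0ℚ < ι P
      0<P = ι-suc-pos (L′ ℕ.+ K′ ℕ.* L)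
      0<A : 0ℚ < A
      0<A = *-pos (+-pos 0<P (ℚ.<⇒≤ 0<P)) (inv-pos ε 0<ε)
      bound : ∀ n → P ℕ.≤ n → ∀ i j → i ℕ.+ j ≡ n → ι j + (ε + ε) * ι n ≤ y * ι n → b i j * ι n ^ K ≤ A ^ K
      bound n P≤n i j i+j≡n h = begin
        b i j * ι n ^ K                       ≤⟨ *-monoʳ-≤ (b i j) (0≤b i j) (^-monoˡ-≤ K (ι-nonNeg n) n≤) ⟩
        b i j * (A * (ι q * ε)) ^ K           ≡⟨ cong (b i j *_) (^-distrib-* A (ι q * ε) K) ⟩
        b i j * (A ^ K * (ι q * ε) ^ K)       ≡⟨ swap (b i j) (A ^ K) ((ι q * ε) ^ K) ⟩
        A ^ K * (b i j * (ι q * ε) ^ K)       ≤⟨ *-monoʳ-≤ (A ^ K) (^-nonNeg K (ℚ.<⇒≤ 0<A)) gain ⟩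
        A ^ K * 1ℚ                            ≡⟨ ℚ.*-identityʳ (A ^ K) ⟩
        A ^ K                                 ∎
        where
        open ℚ.≤-Reasoning
        swap : ∀ a b c → a * (b * c) ≡ b * (a * c)
        swap = RingSolver.solve-∀ ring
        q = n ℕ./ P
        s = q ℕ.* K
        n≡ : n ≡ n ℕ.% P ℕ.+ q ℕ.* P
        n≡ = ℕ.m≡m%n+[m/n]*n n P
        qP≤n : q ℕ.* P ℕ.≤ n
        qP≤n = subst (q ℕ.* P ℕ.≤_) (sym n≡) (ℕ.m≤n+m (q ℕ.* P) (n ℕ.% P))
        1≤q : 1 ℕ.≤ q
        1≤q = ℕ.m≥n⇒m/n>0 P≤n
        n≤ : ι n ≤ A * (ι q * ε)
        n≤ = begin
          ι n                               ≤⟨ ι-mono-≤ (subst (ℕ._≤ q ℕ.* P ℕ.+ q ℕ.* P) (sym n≡)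
                                                 (ℕ.+-monoˡ-≤ (q ℕ.* P) (ℕ.≤-trans (ℕ.<⇒≤ (ℕ.m%n<n n P)) (ℕ.m≤n*m P q {{ℕ.>-nonZero 1≤q}})))) ⟩
          ι (q ℕ.* P ℕ.+ q ℕ.* P)           ≡⟨ ι-+ (q ℕ.* P) (q ℕ.* P) ⟩
          ι (q ℕ.* P) + ι (q ℕ.* P)         ≡⟨ cong (λ z → z + z) (ι-* q P) ⟩
          ι q * ι P + ι q * ι P             ≡⟨ eq (ι q) (ι P) ⟩
          (ι P + ι P) * ι q * 1ℚ            ≡⟨ cong ((ι P + ι P) * ι q *_) (p*inv ε 0<ε) ⟨
          (ι P + ι P) * ι q * (ε * inv ε 0<ε) ≡⟨ eq₂ (ι P + ι P) (ι q) ε (inv ε 0<ε) ⟩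
          A * (ι q * ε)                     ∎
          where
          eq : ∀ q p → q * p + q * p ≡ (p + p) * q * 1ℚ
          eq = RingSolver.solve-∀ ring
          eq₂ : ∀ p q e i → p * q * (e * i) ≡ p * i * (q * e)
          eq₂ = RingSolver.solve-∀ ring
        s≤εn : ι s ≤ ε * ι n
        s≤εn = begin
          ι s                 ≤⟨ p≤r*p (ι-nonNeg s) 1≤εL ⟩
          ε * ι L * ι s       ≡⟨ eq ε (ι L) (ι s) ⟩
          ε * (ι s * ι L)     ≡⟨ cong (ε *_) (ι-* s L) ⟨
          ε * ι (s ℕ.* L)     ≤⟨ *-monoʳ-≤ ε (ℚ.<⇒≤ 0<ε) (ι-mono-≤ (subst (ℕ._≤ n) (sym (ℕ.*-assoc q K L)) qP≤n)) ⟩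
          ε * ι n             ∎
          where
          eq : ∀ e l s → e * l * s ≡ e * (s * l)
          eq = RingSolver.solve-∀ ring
        n≡i+j : ι n ≡ ι i + ι j
        n≡i+j = trans (cong ι (sym i+j≡n)) (ι-+ i j)
        s≤i : s ℕ.≤ i
        s≤i = ι-cancel-≤ (ℚ.≤-trans s≤εn (≤-by (y * ι n - (ι j + (ε + ε) * ι n) + x * ι n + ε * ι n)
          (+-nonNeg (+-nonNeg (p≤q⇒0≤q-p h) (*-nonNeg 0≤x (ι-nonNeg n))) (*-nonNeg (ℚ.<⇒≤ 0<ε) (ι-nonNeg n)))
          (trans (eq ε y x (ι n) (ι j)) (trans (cong₂ (λ a c → a * c - ι j) x+y≡1 n≡i+j) (eq₂ (ι i) (ι j))))))
          where
          eq : ∀ e y x n j → e * n + (y * n - (j + (e + e) * n) + x * n + e * n) ≡ (x + y) * n - j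
          eq = RingSolver.solve-∀ ring
          eq₂ : ∀ i j → 1ℚ * (i + j) - j ≡ i
          eq₂ = RingSolver.solve-∀ ring
        i′ = i ℕ.∸ s
        s+i′≡i : s ℕ.+ i′ ≡ i
        s+i′≡i = ℕ.m+[n∸m]≡n s≤i
        -- The hypothesis leaves a distance `2 ε n` to the mean. The `s` moves use up at most `ε n`
        -- of it, so all of them take place where `tail-step` applies.
        window : ι (s ℕ.+ j) + ε * ι n ≤ y * ι n
        window = ℚ.≤-trans (≤-by (ε * ι n - ι s) (p≤q⇒0≤q-p s≤εn)
          (trans (cong (λ z → z + ε * ι n + (ε * ι n - ι s)) (ι-+ s j)) (eq (ι s) (ι j) (ε * ι n) ))) (subst (_≤ y * ι n) (eq₂ (ι j) ε (ι n)) h)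
          where
          eq : ∀ s j e → s + j + e + (e - s) ≡ j + e + e
          eq = RingSolver.solve-∀ ring
          eq₂ : ∀ j e n → j + (e + e) * n ≡ j + e * n + e * n
          eq₂ = RingSolver.solve-∀ ring
        gain : b i j * (ι q * ε) ^ K ≤ 1ℚ
        gain = begin
          b i j * (ι q * ε) ^ K
            ≤⟨ *-monoʳ-≤ (b i j) (0≤b i j) (^-monoˡ-≤ K (*-nonNeg (ι-nonNeg q) (ℚ.<⇒≤ 0<ε))
                 (ℚ.≤-trans (≤-by 1ℚ 0≤1 (ℚ.+-comm (ι q * ε) 1ℚ)) (bernoulli (ℚ.<⇒≤ 0<ε) q))) ⟩
          b i j * ((1ℚ + ε) ^ q) ^ K         ≡⟨ cong (b i j *_) (^-assocʳ (1ℚ + ε) q K) ⟩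
          b i j * (1ℚ + ε) ^ s               ≡⟨ cong (λ m → b m j * (1ℚ + ε) ^ s) s+i′≡i ⟨
          b (s ℕ.+ i′) j * (1ℚ + ε) ^ s      ≤⟨ tail-iterate 0<ε s i′ j (trans (cong (ℕ._+ j) s+i′≡i) i+j≡n) window ⟩
          b i′ (s ℕ.+ j)                     ≤⟨ bin≤1 0≤x 0≤y x+y≡1 i′ (s ℕ.+ j) ⟩
          1ℚ                                 ∎

  -- Concentration of binomial weights

  module Concentration {x y : ℚ} (0≤x : 0ℚ ≤ x) (0<y : 0ℚ < y) (x+y≡1 : x + y ≡ 1ℚ) where

    private
      0≤y = ℚ.<⇒≤ 0<y
      module Low  = Tails 0≤x 0≤y x+y≡1
      -- An upper tail of successes is a lower tail of failures.
      module High = Tails 0≤y 0≤x (trans (ℚ.+-comm y x) x+y≡1)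

    below-window : ∀ {r v ε j n} → 0ℚ < v → r * v ≡ 1ℚ → ε + ε ≡ y * (1ℚ - v) → r * j < y * n → j + (ε + ε) * n ≤ y * n
    below-window {r} {v} {ε} {j} {n} 0<v rv≡1 2ε≡ h = ≤-by (v * (y * n - r * j))
      (*-nonNeg (ℚ.<⇒≤ 0<v) (p≤q⇒0≤q-p (ℚ.<⇒≤ h))) (begin
        j + (ε + ε) * n + v * (y * n - r * j)          ≡⟨ cong (λ e → j + e * n + v * (y * n - r * j)) 2ε≡ ⟩
        j + y * (1ℚ - v) * n + v * (y * n - r * j)     ≡⟨ eq j y v n r ⟩
        j + (y * n - r * v * j)                        ≡⟨ cong (λ e → j + (y * n - e * j)) rv≡1 ⟩
        j + (y * n - 1ℚ * j)                           ≡⟨ eq₂ j (y * n) ⟩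
        y * n                                          ∎)
      where
      open ≡-Reasoning
      eq : ∀ j y v n r → j + y * (1ℚ - v) * n + v * (y * n - r * j) ≡ j + (y * n - r * v * j)
      eq = RingSolver.solve-∀ ring
      eq₂ : ∀ j z → j + (z - 1ℚ * j) ≡ z
      eq₂ = RingSolver.solve-∀ ring

    -- The same `ε` serves on both sides of the mean: `j > r y n` leaves a distance `(r - 1) y n`,
    -- and `r - 1 = r (1 - v) ≥ 1 - v`.
    above-window : ∀ {r v ε i j n} → 1ℚ < r → 0ℚ ≤ 1ℚ - v → r * v ≡ 1ℚ → ε + ε ≡ y * (1ℚ - v) → 0ℚ ≤ n → n ≡ i + j →
                   r * (y * n) < j → i + (ε + ε) * n ≤ x * n
    above-window {r} {v} {ε} {i} {j} {n} 1<r 0≤1-v rv≡1 2ε≡ 0≤n n≡ h = ≤-by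
      (j - r * (y * n) + y * n * ((r - 1ℚ) * (1ℚ - v)))
      (+-nonNeg (p≤q⇒0≤q-p (ℚ.<⇒≤ h)) (*-nonNeg (*-nonNeg 0≤y 0≤n) (*-nonNeg (ℚ.<⇒≤ (p<q⇒0<q-p 1<r)) 0≤1-v)))
      (begin
        i + (ε + ε) * n + (j - r * (y * n) + y * n * ((r - 1ℚ) * (1ℚ - v)))
          ≡⟨ cong (λ e → i + e * n + (j - r * (y * n) + y * n * ((r - 1ℚ) * (1ℚ - v)))) 2ε≡ ⟩
        i + y * (1ℚ - v) * n + (j - r * (y * n) + y * n * ((r - 1ℚ) * (1ℚ - v)))
          ≡⟨ eq i j (y * n) y v n r ⟩
        i + j + (y * n - r * v * (y * n)) - y * n + y * (1ℚ - v) * n - (1ℚ - v) * (y * n)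
          ≡⟨ cong₂ (λ a c → a + (y * n - c * (y * n)) - y * n + y * (1ℚ - v) * n - (1ℚ - v) * (y * n)) (sym n≡) rv≡1 ⟩
        n + (y * n - 1ℚ * (y * n)) - y * n + y * (1ℚ - v) * n - (1ℚ - v) * (y * n)
          ≡⟨ eq₂ y n v ⟩
        (1ℚ - y) * n
          ≡⟨ cong (_* n) Low.x≡1-y ⟨
        x * n ∎)
      where
      open ≡-Reasoning
      eq : ∀ i j z y v n r → i + y * (1ℚ - v) * n + (j - r * z + z * ((r - 1ℚ) * (1ℚ - v))) ≡
           i + j + (z - r * v * z) - z + y * (1ℚ - v) * n - (1ℚ - v) * z
      eq = RingSolver.solve-∀ ring
      eq₂ : ∀ y n v → n + (y * n - 1ℚ * (y * n)) - y * n + y * (1ℚ - v) * n - (1ℚ - v) * (y * n) ≡ (1ℚ - y) * n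
      eq₂ = RingSolver.solve-∀ ring

    window? : ∀ {r j n} → 0ℚ < r → 0ℚ < n → Close r j (y * n) ⊎ r * j < y * n ⊎ r * (y * n) < j
    window? {r} {j} {n} 0<r 0<n with y * n ℚ.≤? r * j | j ℚ.≤? r * (y * n)
    ... | yes yn≤ | yes j≤ = inj₁ (close 0<j 0<yn j≤ yn≤)
      where
      0<yn = *-pos 0<y 0<n
      0<j : 0ℚ < j
      0<j = *-cancelˡ-< (ℚ.<⇒≤ 0<r) (subst (_< r * j) (sym (ℚ.*-zeroʳ r)) (ℚ.<-≤-trans 0<yn yn≤))
    ... | no yn≰ | _     = inj₂ (inj₁ (ℚ.≰⇒> yn≰))
    ... | yes _  | no j≰ = inj₂ (inj₂ (ℚ.≰⇒> j≰))

    Outside : ℚ → ℕ → ℚ → ℕ → Set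
    Outside r K M n = ∀ i j → i ℕ.+ j ≡ n → Close r (ι j) (y * ι n) ⊎ bin x y i j * ι n ^ K ≤ M

    outside : ∀ {r v ε M₁ M₂} K n → 1ℚ < r → 0ℚ < v → 0ℚ ≤ 1ℚ - v → r * v ≡ 1ℚ → ε + ε ≡ y * (1ℚ - v) →
      0ℚ < M₁ → 0ℚ < M₂ → 1 ℕ.≤ n →
      (∀ i j → i ℕ.+ j ≡ n → ι j + (ε + ε) * ι n ≤ y * ι n → bin x y i j * ι n ^ K ≤ M₁) →
      (∀ i j → i ℕ.+ j ≡ n → ι j + (ε + ε) * ι n ≤ x * ι n → bin y x i j * ι n ^ K ≤ M₂) →
      Outside r K (M₁ + M₂) n
    outside {r} {v} {ε} {M₁} {M₂} K n 1<r 0<v 0≤1-v rv≡1 2ε≡ 0<M₁ 0<M₂ 1≤n h₁ h₂ i j i+j≡n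
      with window? {j = ι j} (ℚ.<-trans 0<1 1<r) (ι-pos 1≤n)
    ... | inj₁ c = inj₁ c
    ... | inj₂ (inj₁ lt) = inj₂ (ℚ.≤-trans (h₁ i j i+j≡n (below-window {r} {v} {ε} {ι j} {ι n} 0<v rv≡1 2ε≡ lt)) (≤-by M₂ (ℚ.<⇒≤ 0<M₂) refl))
    ... | inj₂ (inj₂ lt) = inj₂ (ℚ.≤-trans (subst (λ z → z * ι n ^ K ≤ M₂) (bin-sym y x j i)
        (h₂ j i (trans (ℕ.+-comm j i) i+j≡n) (above-window {r} {v} {ε} {ι i} {ι j} {ι n} 1<r 0≤1-v rv≡1 2ε≡ (ι-nonNeg n) (trans (cong ι (sym i+j≡n)) (ι-+ i j)) lt)))
      (≤-by M₁ (ℚ.<⇒≤ 0<M₁) (ℚ.+-comm M₂ M₁)))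

    tail : ∀ {r} → 1ℚ < r → ∀ K → ∃[ M ] 0ℚ < M × Eventually (λ n → n) (Outside r (suc K) M)
    tail {r} 1<r K =
      let v = inv r (ℚ.<-trans 0<1 1<r)
          0<v = inv-pos r (ℚ.<-trans 0<1 1<r)
          rv≡1 = p*inv r (ℚ.<-trans 0<1 1<r)
          0<1-v = subst (0ℚ <_) (trans (eq r v) (cong (_- v) rv≡1)) (*-pos (p<q⇒0<q-p 1<r) 0<v)
          0<ε = ½-pos (*-pos 0<y 0<1-v)
          M₁ , 0<M₁ , low  = Low.lower-tail 0<ε K
          M₂ , 0<M₂ , high = High.lower-tail 0<ε K
      in M₁ + M₂ , +-pos 0<M₁ (ℚ.<⇒≤ 0<M₂) ,
         ev-zip (λ n 1≤n (h₁ , h₂) → outside {ε = ½ * (y * (1ℚ - v))} (suc K) n 1<r 0<v (ℚ.<⇒≤ 0<1-v) rv≡1 (½+½ (y * (1ℚ - v))) 0<M₁ 0<M₂ 1≤n h₁ h₂)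
           (1 , λ n 1≤n → 1≤n) (ev-zip (λ n h₁ h₂ → h₁ , h₂) low high)
      where
      eq : ∀ r v → (r - 1ℚ) * v ≡ r * v - v
      eq = RingSolver.solve-∀ ring

  -- Averages of regularly varying sequences

  weighted : (ℕ → ℚ) → ℕ → ℕ → ℚ
  weighted g r n = g n * g n * ι n ^ r

  -- A multiplicative Cauchy condition: `g` behaves like a positive constant times the power -r/2 of
  -- `n`, but neither the constant, which involves π, nor the half-integral power has to be
  -- rational.
  Regular : (ℕ → ℚ) → ℕ → Set
  Regular g r = (λ (m , n) → weighted g r m) ≈₂ (λ (m , n) → weighted g r n)

  module _ {g : ℕ → ℚ} {r : ℕ} (0<g : ∀ n → 0ℚ < g n) (regular : Regular g r) where

    -- Of the `r + 1` factors `t` that `s` must accommodate, one comes from regularity and `r` from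
    -- comparing the powers of `m` and `n`.
    slowly-varying : ∀ {s} → 1ℚ < s → ∃[ t ] 1ℚ < t ×
      Eventually size₂ λ (m , n) → Close t (ι m) (ι n) → g m ≤ s * g n
    slowly-varying {s} 1<s =
      let t , 1<t , _ , t^≤s = ∃-root^ (suc r) 1<s
      in t , 1<t , Pairs.ev-map (λ (m , n) c d → compare 1<t t^≤s m n c d) (regular t 1<t)
      where
      compare : ∀ {t} → 1ℚ < t → t ^ suc r ≤ s → ∀ m n → Close t (weighted g r m) (weighted g r n) →
                Close t (ι m) (ι n) → g m ≤ s * g n
      compare {t} 1<t t^≤s m n c d = ≤*-sqrt (ℚ.<⇒≤ 1<s) (ℚ.<⇒≤ (0<g n)) (*-cancelˡ-≤ (^-pos r (0<ˡ d)) (begin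
        ι m ^ r * (g m * g m)                   ≡⟨ ℚ.*-comm (ι m ^ r) (g m * g m) ⟩
        weighted g r m                          ≤⟨ ≤r* c ⟩
        t * (g n * g n * ι n ^ r)               ≤⟨ *-monoʳ-≤ t 0≤t (*-monoʳ-≤ (g n * g n) 0≤g² (^-monoˡ-≤ r (ι-nonNeg n) (≥r* d))) ⟩
        t * (g n * g n * (t * ι m) ^ r)         ≡⟨ cong (λ z → t * (g n * g n * z)) (^-distrib-* t (ι m) r) ⟩
        t * (g n * g n * (t ^ r * ι m ^ r))     ≡⟨ eq t (g n * g n) (t ^ r) (ι m ^ r) ⟩
        ι m ^ r * (t ^ suc r * (g n * g n))     ≤⟨ *-monoʳ-≤ (ι m ^ r) (^-nonNeg r (ι-nonNeg m)) (*-monoˡ-≤ (g n * g n) 0≤g² t^≤s) ⟩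
        ι m ^ r * (s * (g n * g n))             ∎))
        where
        open ℚ.≤-Reasoning
        0≤t = ℚ.≤-trans 0≤1 (ℚ.<⇒≤ 1<t)
        0≤g² = ℚ.<⇒≤ (*-pos (0<g n) (0<g n))
        eq : ∀ t g u m → t * (g * (u * m)) ≡ m * (t * u * g)
        eq = RingSolver.solve-∀ ring

    weighted-bounded-below : ∃[ c ] 0ℚ < c × Eventually (λ n → n) λ n → c ≤ weighted g r n
    weighted-bounded-below =
      let N , h = regular (1ℚ + 1ℚ) (<-by 1ℚ 0<1 refl)
          m = 1 ℕ.⊔ N
          0<Gm = *-pos (*-pos (0<g m) (0<g m)) (^-pos r (ι-pos (ℕ.m≤m⊔n 1 N)))
      in ½ * weighted g r m , ½-pos 0<Gm , N , λ n N≤n →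
         *-cancelˡ-≤ (+-pos 0<1 0≤1)
           (subst (_≤ (1ℚ + 1ℚ) * weighted g r n) (eq (weighted g r m)) (≤r* (h (m , n) (ℕ.⊓-glb (ℕ.m≤n⊔m 1 N) N≤n))))
      where
      eq : ∀ z → z ≡ (1ℚ + 1ℚ) * (½ * z)
      eq = RingSolver.solve-∀ ring

  module Pivot {y : ℚ} (0<y : 0ℚ < y) (y≤1 : y ≤ 1ℚ) where

    0≤yn : ∀ n → 0ℚ ≤ y * ι n
    0≤yn n = *-nonNeg (ℚ.<⇒≤ 0<y) (ι-nonNeg n)

    pivot : ℕ → ℕ
    pivot n = proj₁ (∃-floor (y * ι n) (0≤yn n))

    pivot≤ : ∀ n → ι (pivot n) ≤ y * ι n
    pivot≤ n = proj₁ (proj₂ (∃-floor (y * ι n) (0≤yn n)))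

    <1+pivot : ∀ n → y * ι n < 1ℚ + ι (pivot n)
    <1+pivot n = subst (y * ι n <_) (ι-suc (pivot n)) (proj₂ (proj₂ (∃-floor (y * ι n) (0≤yn n))))

    pivot≤n : ∀ n → ι (pivot n) ≤ ι n
    pivot≤n n = ℚ.≤-trans (pivot≤ n) (r*p≤p (ι-nonNeg n) y≤1)

    ev-y : ∀ p → Eventually (λ n → n) λ n → p ≤ y * ι n
    ev-y p = ev-map (λ n h → subst (_≤ y * ι n) (trans (eq y (inv y 0<y) p) (trans (cong (_* p) (p*inv y 0<y)) (ℚ.*-identityˡ p)))
        (*-monoʳ-≤ y (ℚ.<⇒≤ 0<y) h))
      (ev-id-ι (inv y 0<y * p))
      where
      eq : ∀ y i p → y * (i * p) ≡ y * i * p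
      eq = RingSolver.solve-∀ ring

    ev-pivot : ∀ p → Eventually (λ n → n) λ n → p ≤ ι (pivot n)
    ev-pivot p = ev-map (λ n h → ≤-by (y * ι n - (1ℚ + p) + (1ℚ + ι (pivot n) - y * ι n))
        (+-nonNeg (p≤q⇒0≤q-p h) (p≤q⇒0≤q-p (ℚ.<⇒≤ (<1+pivot n)))) (eq p (y * ι n) (ι (pivot n))))
      (ev-y (1ℚ + p))
      where
      eq : ∀ p z j → p + (z - (1ℚ + p) + (1ℚ + j - z)) ≡ j
      eq = RingSolver.solve-∀ ring

    ev-pivot-ℕ : ∀ N → Eventually (λ n → n) λ n → N ℕ.≤ pivot n
    ev-pivot-ℕ N = ev-map (λ n → ι-cancel-≤) (ev-pivot (ι N))

    pivot-≈ : (λ n → ι (pivot n)) ≈ (λ n → y * ι n)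
    pivot-≈ r 1<r = ev-map near (ev-pivot (inv h 0<h))
      where
      h = r - 1ℚ
      0<h = p<q⇒0<q-p 1<r
      near : ∀ n → inv h 0<h ≤ ι (pivot n) → Close r (ι (pivot n)) (y * ι n)
      near n le = close 0<j (ℚ.<-≤-trans 0<j (pivot≤ n))
        (ℚ.≤-trans (pivot≤ n) (p≤r*p (0≤yn n) (ℚ.<⇒≤ 1<r)))
        (≤-by (1ℚ + ι (pivot n) - y * ι n + (h * ι (pivot n) - 1ℚ))
          (+-nonNeg (p≤q⇒0≤q-p (ℚ.<⇒≤ (<1+pivot n)))
            (p≤q⇒0≤q-p (subst (_≤ h * ι (pivot n)) (p*inv h 0<h) (*-monoʳ-≤ h (ℚ.<⇒≤ 0<h) le))))
          (eq (y * ι n) (ι (pivot n)) r))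
        where
        0<j = ℚ.<-≤-trans (inv-pos h 0<h) le
        eq : ∀ z j r → z + (1ℚ + j - z + ((r - 1ℚ) * j - 1ℚ)) ≡ r * j
        eq = RingSolver.solve-∀ ring

  -- Used twice: for the full binomial distribution with `g = w`, and for the squared weights with
  -- `g = collision k`. The lower bound on the mass is far from sharp in both cases; any power of
  -- `n` would beat the tails.
  module Averaging {x y : ℚ} (0≤x : 0ℚ ≤ x) (0<y : 0ℚ < y) (x+y≡1 : x + y ≡ 1ℚ)
    {A : ℕ → ℕ → ℚ} (0≤A : ∀ i j → 0ℚ ≤ A i j) (A≤bin : ∀ i j → A i j ≤ bin x y i j)
    {c : ℚ} (0<c : 0ℚ < c) (mass : Eventually (λ n → n) λ n → c ≤ D n A * ι n)
    {g : ℕ → ℚ} {r : ℕ} (0<g : ∀ n → 0ℚ < g n) (g≤1 : ∀ n → g n ≤ 1ℚ) (regular : Regular g r) where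

    open Pivot 0<y (≤-by x 0≤x (trans (ℚ.+-comm y x) x+y≡1))

    T X E : ℕ → ℚ
    T n = D n A
    X n = D n λ i j → A i j * g j
    E n = T n * g (pivot n)

    c′ : ℚ
    c′ = proj₁ (weighted-bounded-below {g} {r} 0<g regular)

    0<c′ : 0ℚ < c′
    0<c′ = proj₁ (proj₂ (weighted-bounded-below {g} {r} 0<g regular))

    ev-T-pos : Eventually (λ n → n) λ n → 0ℚ < T n
    ev-T-pos = ev-map (λ n h → *-cancelˡ-< (ι-nonNeg n)
      (subst₂ _<_ (sym (ℚ.*-zeroʳ (ι n))) (ℚ.*-comm (T n) (ι n)) (ℚ.<-≤-trans 0<c h))) mass

    ev-E-pos : Eventually (λ n → n) λ n → 0ℚ < E n
    ev-E-pos = ev-map (λ n 0<T → *-pos 0<T (0<g (pivot n))) ev-T-pos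

    -- Using `g ≤ 1` for one of the two factors of the square avoids a square root; the power of `n`
    -- lost in this way does not matter against the tails.
    E-bounded-below : Eventually (λ n → n) λ n → c * c′ ≤ ι n ^ suc r * E n
    E-bounded-below =
      let N , h = proj₂ (proj₂ (weighted-bounded-below {g} {r} 0<g regular))
      in ev-zip (λ n c≤ N≤ → bound n c≤ (h (pivot n) N≤)) mass (ev-pivot-ℕ N)
      where
      bound : ∀ n → c ≤ T n * ι n → c′ ≤ weighted g r (pivot n) → c * c′ ≤ ι n ^ suc r * E n
      bound n c≤ c′≤ = begin
        c * c′                                    ≤⟨ *-mono-≤ (ℚ.<⇒≤ 0<c) (ℚ.<⇒≤ 0<c′) c≤ (begin
          c′                                          ≤⟨ c′≤ ⟩
          g₀ * g₀ * ι (pivot n) ^ r                   ≤⟨ *-mono-≤ (*-nonNeg 0≤g₀ 0≤g₀) (^-nonNeg r (ι-nonNeg (pivot n)))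
                                                           (r*p≤p 0≤g₀ (g≤1 (pivot n))) (^-monoˡ-≤ r (ι-nonNeg (pivot n)) (pivot≤n n)) ⟩
          g₀ * ι n ^ r                                ∎) ⟩
        T n * ι n * (g₀ * ι n ^ r)                ≡⟨ eq (T n) (ι n) g₀ (ι n ^ r) ⟩
        ι n ^ suc r * E n                         ∎
        where
        open ℚ.≤-Reasoning
        g₀ = g (pivot n)
        0≤g₀ = ℚ.<⇒≤ (0<g (pivot n))
        eq : ∀ t n g m → t * n * (g * m) ≡ n * m * (t * g)
        eq = RingSolver.solve-∀ ring

    negligible : ∀ {t δ} → 1ℚ < t → 0ℚ < δ → Eventually (λ n → n) λ n → ∀ i j → i ℕ.+ j ≡ n →
                 Close t (ι j) (y * ι n) ⊎ ι (suc n) * A i j ≤ δ * E n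
    negligible {t} {δ} 1<t 0<δ =
      -- The exponent `r + 3` is made up of `r + 1` for the lower bound on `E n`, one for the factor
      -- `suc n`, and one that outgrows the constants.
      let M , 0<M , ev = Concentration.tail 0≤x 0<y x+y≡1 1<t (2 ℕ.+ r)
      in ev-zip (λ n h (out , low , 1≤n) i j eq → case out i j eq of λ
            { (inj₁ cl) → inj₁ cl
            ; (inj₂ le) → inj₂ (small M 0<M n h low 1≤n i j le) })
           (ev-id-ι (inv (δ * (c * c′)) 0<δcc′ * (M + M)))
           (ev-zip (λ n out rest → out , rest) ev (ev-zip (λ n low 1≤n → low , 1≤n) E-bounded-below (1 , λ n 1≤n → 1≤n)))
      where
      0<δcc′ = *-pos 0<δ (*-pos 0<c 0<c′)
      small : ∀ M → 0ℚ < M → ∀ n → inv (δ * (c * c′)) 0<δcc′ * (M + M) ≤ ι n → c * c′ ≤ ι n ^ suc r * E n → 1 ℕ.≤ n →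
              ∀ i j → bin x y i j * ι n ^ suc (2 ℕ.+ r) ≤ M → ι (suc n) * A i j ≤ δ * E n
      small M 0<M n n≥ low 1≤n i j le = *-cancelˡ-≤ (^-pos (suc (2 ℕ.+ r)) 0<n) (begin
        N³ * (ι (suc n) * A i j)                       ≡⟨ eq₁ N³ (ι (suc n)) (A i j) ⟩
        ι (suc n) * (A i j * N³)                       ≤⟨ *-monoʳ-≤ (ι (suc n)) (ι-nonNeg (suc n)) (ℚ.≤-trans
                                                            (*-monoˡ-≤ N³ (^-nonNeg (suc (2 ℕ.+ r)) (ι-nonNeg n)) (A≤bin i j)) le) ⟩
        ι (suc n) * M                                  ≤⟨ *-monoˡ-≤ M (ℚ.<⇒≤ 0<M) (ι-mono-≤ (ℕ.+-monoˡ-≤ n 1≤n)) ⟩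
        ι (n ℕ.+ n) * M                                ≡⟨ cong (_* M) (ι-+ n n) ⟩
        (ι n + ι n) * M                                ≡⟨ eq₂ (ι n) M ⟩
        ι n * (1ℚ * (M + M))                           ≡⟨ cong (λ z → ι n * (z * (M + M))) (p*inv (δ * (c * c′)) 0<δcc′) ⟨
        ι n * (δ * (c * c′) * I * (M + M))             ≡⟨ cong (ι n *_) (ℚ.*-assoc (δ * (c * c′)) I (M + M)) ⟩
        ι n * (δ * (c * c′) * (I * (M + M)))           ≤⟨ *-monoʳ-≤ (ι n) (ι-nonNeg n) (*-monoʳ-≤ (δ * (c * c′)) (ℚ.<⇒≤ 0<δcc′) n≥) ⟩
        ι n * (δ * (c * c′) * ι n)                     ≡⟨ eq₃ (ι n) δ (c * c′) ⟩
        ι n * ι n * δ * (c * c′)                       ≤⟨ *-monoʳ-≤ (ι n * ι n * δ) (*-nonNeg (*-nonNeg (ι-nonNeg n) (ι-nonNeg n)) (ℚ.<⇒≤ 0<δ)) low ⟩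
        ι n * ι n * δ * (ι n ^ suc r * E n)            ≡⟨ eq₄ (ι n) δ (ι n ^ suc r) (E n) ⟩
        N³ * (δ * E n)                                 ∎)
        where
        open ℚ.≤-Reasoning
        I = inv (δ * (c * c′)) 0<δcc′
        N³ = ι n ^ suc (2 ℕ.+ r)
        0<n = ι-pos 1≤n
        eq₁ : ∀ a b c → a * (b * c) ≡ b * (c * a)
        eq₁ = RingSolver.solve-∀ ring
        eq₂ : ∀ n m → (n + n) * m ≡ n * (1ℚ * (m + m))
        eq₂ = RingSolver.solve-∀ ring
        eq₃ : ∀ n d c → n * (d * c * n) ≡ n * n * d * c
        eq₃ = RingSolver.solve-∀ ring
        eq₄ : ∀ n d p e → n * n * d * (p * e) ≡ n * (n * p) * (d * e)
        eq₄ = RingSolver.solve-∀ ring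

    -- The allowed error `δ * E n` is shared equally among the `suc n` terms, giving each the amount
    -- `e`. Where `j` is far from the mean, `g ≤ 1` reduces the term to the weight `A i j`, which is
    -- at most `e`.
    sandwich : ∀ {s δ} n → 1ℚ < s → 0ℚ ≤ δ * E n →
      (∀ i j → i ℕ.+ j ≡ n → (g j ≤ s * g (pivot n) × g (pivot n) ≤ s * g j) ⊎ ι (suc n) * A i j ≤ δ * E n) →
      X n ≤ (s + δ) * E n × E n ≤ s * X n + δ * E n
    sandwich {s} {δ} n 1<s 0≤δE h = upper , lower
      where
      open ℚ.≤-Reasoning
      g₀ = g (pivot n)
      0≤s = ℚ.≤-trans 0≤1 (ℚ.<⇒≤ 1<s)
      0<N = ι-suc-pos n
      e = inv (ι (suc n)) 0<N * (δ * E n)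
      0≤e : 0ℚ ≤ e
      0≤e = *-nonNeg (ℚ.<⇒≤ (inv-pos (ι (suc n)) 0<N)) 0≤δE
      Ne≡ : ι (suc n) * e ≡ δ * E n
      Ne≡ = trans (sym (ℚ.*-assoc (ι (suc n)) (inv (ι (suc n)) 0<N) (δ * E n)))
        (trans (cong (_* (δ * E n)) (p*inv (ι (suc n)) 0<N)) (ℚ.*-identityˡ (δ * E n)))
      A≤e : ∀ {i j} → ι (suc n) * A i j ≤ δ * E n → A i j ≤ e
      A≤e {i} {j} le = *-cancelˡ-≤ 0<N (subst (ι (suc n) * A i j ≤_) (sym Ne≡) le)
      Ag≤A : ∀ i j m → A i j * g m ≤ A i j
      Ag≤A i j m = subst (A i j * g m ≤_) (ℚ.*-identityʳ (A i j)) (*-monoʳ-≤ (A i j) (0≤A i j) (g≤1 m))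
      swap : ∀ a b c → a * (b * c) ≡ b * (a * c)
      swap = RingSolver.solve-∀ ring
      term : ∀ m m′ i j → g m ≤ s * g m′ ⊎ ι (suc n) * A i j ≤ δ * E n → A i j * g m ≤ s * (A i j * g m′) + e
      term m m′ i j (inj₁ le) = ≤-by (A i j * (s * g m′) - A i j * g m + e)
        (+-nonNeg (p≤q⇒0≤q-p (*-monoʳ-≤ (A i j) (0≤A i j) le)) 0≤e) (eq (A i j) (g m) s (g m′) e)
        where
        eq : ∀ a g s g′ e → a * g + (a * (s * g′) - a * g + e) ≡ s * (a * g′) + e
        eq = RingSolver.solve-∀ ring
      term m m′ i j (inj₂ le) = ℚ.≤-trans (Ag≤A i j m) (ℚ.≤-trans (A≤e le)
        (≤-by (s * (A i j * g m′)) (*-nonNeg 0≤s (*-nonNeg (0≤A i j) (ℚ.<⇒≤ (0<g m′)))) (ℚ.+-comm e _)))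
      D-error : ∀ F → D n (λ i j → s * F i j + e) ≡ s * D n F + δ * E n
      D-error F = trans (D-+ n (λ i j → s * F i j) (λ _ _ → e))
        (cong₂ _+_ (D-*ˡ n s F) (trans (D-const n e) Ne≡))
      upper : X n ≤ (s + δ) * E n
      upper = begin
        X n                                              ≤⟨ D-mono n (λ i j eq → term j (pivot n) i j (case h i j eq of λ
                                                              { (inj₁ (le , _)) → inj₁ le ; (inj₂ le) → inj₂ le })) ⟩
        D n (λ i j → s * (A i j * g₀) + e)               ≡⟨ D-error (λ i j → A i j * g₀) ⟩
        s * D n (λ i j → A i j * g₀) + δ * E n           ≡⟨ cong (λ z → s * z + δ * E n) (D-*ʳ n g₀ A) ⟩
        s * E n + δ * E n                                ≡⟨ ℚ.*-distribʳ-+ (E n) s δ ⟨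
        (s + δ) * E n                                    ∎
      lower : E n ≤ s * X n + δ * E n
      lower = begin
        E n                                              ≡⟨ D-*ʳ n g₀ A ⟨
        D n (λ i j → A i j * g₀)                         ≤⟨ D-mono n (λ i j eq → term (pivot n) j i j (case h i j eq of λ
                                                              { (inj₁ (_ , le)) → inj₁ le ; (inj₂ le) → inj₂ le })) ⟩
        D n (λ i j → s * (A i j * g j) + e)              ≡⟨ D-error (λ i j → A i j * g j) ⟩
        s * X n + δ * E n                                ∎

    -- With `v = 1 / s`, the error `δ = 1 - v` makes both bounds give the factor `s * s`:
    -- `s + 1 - 1/s` is at most `s * s`, and `E n` minus its error is `E n / s`.
    close-sandwich : ∀ {s v} n → 1ℚ < s → 0ℚ < v → v ≤ 1ℚ → s * v ≡ 1ℚ → 0ℚ < E n →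
      X n ≤ (s + (1ℚ - v)) * E n × E n ≤ s * X n + (1ℚ - v) * E n → Close (s * s) (X n) (E n)
    close-sandwich {s} {v} n 1<s 0<v v≤1 sv≡1 0<E (up , lo) = close 0<X 0<E
      (ℚ.≤-trans up (*-monoˡ-≤ (E n) (ℚ.<⇒≤ 0<E) (≤-by {s + (1ℚ - v)} ((s - 1ℚ) * (s - v) + (s * v - 1ℚ))
        (+-nonNeg (*-nonNeg (p≤q⇒0≤q-p (ℚ.<⇒≤ 1<s)) (p≤q⇒0≤q-p (ℚ.≤-trans v≤1 (ℚ.<⇒≤ 1<s)))) (p≤q⇒0≤q-p (ℚ.≤-reflexive (sym sv≡1))))
        (eq₁ s v))))
      E≤ssX
      where
      0<s = ℚ.<-trans 0<1 1<s
      eq₁ : ∀ s v → s + (1ℚ - v) + ((s - 1ℚ) * (s - v) + (s * v - 1ℚ)) ≡ s * s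
      eq₁ = RingSolver.solve-∀ ring
      eq₂ : ∀ s v x e → s * v * e + s * (s * x + (1ℚ - v) * e - e) ≡ s * s * x
      eq₂ = RingSolver.solve-∀ ring
      E≤ssX : E n ≤ s * s * X n
      E≤ssX = ≤-by (s * (s * X n + (1ℚ - v) * E n - E n)) (*-nonNeg (ℚ.<⇒≤ 0<s) (p≤q⇒0≤q-p lo))
        (trans (cong (_+ s * (s * X n + (1ℚ - v) * E n - E n)) (trans (sym (ℚ.*-identityˡ (E n))) (cong (_* E n) (sym sv≡1))))
          (eq₂ s v (X n) (E n)))
      0<X : 0ℚ < X n
      0<X = *-cancelˡ-< (ℚ.<⇒≤ (*-pos 0<s 0<s)) (subst (_< s * s * X n) (sym (ℚ.*-zeroʳ (s * s))) (ℚ.<-≤-trans 0<E E≤ssX))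

    average-≈ : X ≈ E
    average-≈ R 1<R =
      let s , 1<s , s²≤R = ∃-root 1<R
          0<s = ℚ.<-trans 0<1 1<s
          v = inv s 0<s
          0<v = inv-pos s 0<s
          sv≡1 = p*inv s 0<s
          v<1 = *-cancelˡ-< (ℚ.<⇒≤ 0<s) (subst₂ _<_ (sym sv≡1) (sym (ℚ.*-identityʳ s)) 1<s)
          t′ , 1<t′ , N , slow = slowly-varying {g} {r} 0<g regular 1<s
          -- Both `j` and the pivot are compared with `y n`, at the cost of a factor `t` each.
          t , 1<t , t²≤t′ = ∃-root 1<t′
          0<t = ℚ.<-trans 0<1 1<t
          0≤t = ℚ.<⇒≤ 0<t
      in ev-zip (λ n (0<E , out) (piv , N≤piv , large) → close-mono s²≤R
           (close-sandwich n 1<s 0<v (ℚ.<⇒≤ v<1) sv≡1 0<E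
             (sandwich n 1<s (*-nonNeg (ℚ.<⇒≤ (p<q⇒0<q-p v<1)) (ℚ.<⇒≤ 0<E)) λ i j eq → case out i j eq of λ
               { (inj₂ le) → inj₂ le
               ; (inj₁ cl) →
                 -- `slow` needs `j` itself to be large, which follows from `t N ≤ y n ≤ t j`.
                 let N≤j = ι-cancel-≤ (*-cancelˡ-≤ 0<t (ℚ.≤-trans large (≥r* cl)))
                     near = close-mono t²≤t′ (close-trans 0≤t 0≤t cl (close-sym piv))
                 in inj₁ (slow (j , pivot n) (ℕ.⊓-glb N≤j N≤piv) near ,
                          slow (pivot n , j) (ℕ.⊓-glb N≤piv N≤j) (close-sym near)) })))
         (ev-zip (λ n a b → a , b) ev-E-pos (negligible 1<t (p<q⇒0<q-p v<1)))
         (ev-zip (λ n a b → a , b) (pivot-≈ t 1<t) (ev-zip (λ n a b → a , b) (ev-pivot-ℕ N) (ev-y (t * ι N))))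

    -- After squaring, the value at the pivot becomes the weighted sequence there, and regularity
    -- moves it from the pivot to `n`.
    average²-≈ : (λ n → X n * X n * (y * ι n) ^ r) ≈ (λ n → T n * T n * weighted g r n)
    average²-≈ = ≈-trans (≈-* (≈-* average-≈ average-≈) (≈-^ r (≈-sym pivot-≈)))
      (≈-resp (λ n → eq (T n) (g (pivot n)) (ι (pivot n) ^ r)) (λ _ → refl)
        (≈-* (≈-* (≈-refl ev-T-pos) (≈-refl ev-T-pos)) pivot-weighted))
      where
      pivot-weighted : (λ n → weighted g r (pivot n)) ≈ weighted g r
      pivot-weighted s 1<s = let N , h = regular s 1<s in
        ev-zip (λ n N≤piv N≤n → h (pivot n , n) (ℕ.⊓-glb N≤piv N≤n)) (ev-pivot-ℕ N) (N , λ n N≤n → N≤n)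
      eq : ∀ t g p → t * t * (g * g * p) ≡ t * g * (t * g) * p
      eq = RingSolver.solve-∀ ring

  -- Wallis' product and Leibniz' series

  -- `Δ` increases, `∇` below decreases, and `2 Δ ≤ ∇`. These nested bounds make `Δ`
  -- multiplicatively Cauchy before its limit 1/π is identified.
  Δ : ℕ → ℚ
  Δ n = w n * w n * ι n

  Δ-suc : ∀ n → Δ n ≤ Δ (suc n)
  Δ-suc n = *-cancelˡ-≤ (*-pos 0<2m 0<2m) (begin
    (m + m) * (m + m) * (w n * w n * ι n)                           ≤⟨ ≤-by (m * (w n * w n))
                                                                         (*-nonNeg (ι-nonNeg (suc n)) (*-nonNeg (ℚ.<⇒≤ (w-pos n)) (ℚ.<⇒≤ (w-pos n)))) eq₁ ⟩
    m * ((ι (suc (n ℕ.+ n)) * w n) * (ι (suc (n ℕ.+ n)) * w n))     ≡⟨ cong (λ z → m * (z * z)) (w-suc n) ⟨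
    m * (((m + m) * w (suc n)) * ((m + m) * w (suc n)))             ≡⟨ eq₂ m (w (suc n)) ⟩
    (m + m) * (m + m) * Δ (suc n)                                   ∎)
    where
    open ℚ.≤-Reasoning
    m = ι (suc n)
    0<2m = +-pos (ι-suc-pos n) (ι-nonNeg (suc n))
    eq₁ : (m + m) * (m + m) * (w n * w n * ι n) + m * (w n * w n) ≡ m * ((ι (suc (n ℕ.+ n)) * w n) * (ι (suc (n ℕ.+ n)) * w n))
    eq₁ = trans (cong (λ m → (m + m) * (m + m) * (w n * w n * ι n) + m * (w n * w n)) (ι-suc n))
      (trans (eq (ι n) (w n)) (cong₂ (λ m l → m * ((l * w n) * (l * w n))) (sym (ι-suc n))
        (sym (trans (ι-suc (n ℕ.+ n)) (cong (1ℚ +_) (ι-+ n n))))))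
      where
      eq : ∀ n w → (1ℚ + n + (1ℚ + n)) * (1ℚ + n + (1ℚ + n)) * (w * w * n) + (1ℚ + n) * (w * w) ≡
           (1ℚ + n) * (((1ℚ + (n + n)) * w) * ((1ℚ + (n + n)) * w))
      eq = RingSolver.solve-∀ ring
    eq₂ : ∀ m w → m * (((m + m) * w) * ((m + m) * w)) ≡ (m + m) * (m + m) * (w * w * m)
    eq₂ = RingSolver.solve-∀ ring

  ∇ : ℕ → ℚ
  ∇ n = w n * w n * (1ℚ + (ι n + ι n))

  ∇-suc : ∀ n → ∇ (suc n) ≤ ∇ n
  ∇-suc n = *-cancelˡ-≤ (*-pos 0<2m 0<2m) (begin
    (m + m) * (m + m) * ∇ (suc n)                                   ≡⟨ eq₂ m (w (suc n)) ⟩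
    (1ℚ + (m + m)) * (((m + m) * w (suc n)) * ((m + m) * w (suc n)))  ≡⟨ cong (λ z → (1ℚ + (m + m)) * (z * z)) (w-suc n) ⟩
    (1ℚ + (m + m)) * ((l * w n) * (l * w n))                        ≤⟨ ≤-by (l * (w n * w n)) (*-nonNeg (ι-nonNeg (suc (n ℕ.+ n)))
                                                                         (*-nonNeg (ℚ.<⇒≤ (w-pos n)) (ℚ.<⇒≤ (w-pos n)))) eq₁ ⟩
    (m + m) * (m + m) * ∇ n                                         ∎)
    where
    open ℚ.≤-Reasoning
    m = ι (suc n)
    l = ι (suc (n ℕ.+ n))
    0<2m = +-pos (ι-suc-pos n) (ι-nonNeg (suc n))
    eq₁ : (1ℚ + (m + m)) * ((l * w n) * (l * w n)) + l * (w n * w n) ≡ (m + m) * (m + m) * ∇ n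
    eq₁ = trans (cong₂ (λ m l → (1ℚ + (m + m)) * ((l * w n) * (l * w n)) + l * (w n * w n)) (ι-suc n)
        (trans (ι-suc (n ℕ.+ n)) (cong (1ℚ +_) (ι-+ n n))))
      (trans (eq (ι n) (w n)) (cong (λ m → (m + m) * (m + m) * ∇ n) (sym (ι-suc n))))
      where
      eq : ∀ n w → (1ℚ + (1ℚ + n + (1ℚ + n))) * (((1ℚ + (n + n)) * w) * ((1ℚ + (n + n)) * w)) + (1ℚ + (n + n)) * (w * w) ≡
           (1ℚ + n + (1ℚ + n)) * (1ℚ + n + (1ℚ + n)) * (w * w * (1ℚ + (n + n)))
      eq = RingSolver.solve-∀ ring
    eq₂ : ∀ m w → (m + m) * (m + m) * (w * w * (1ℚ + (m + m))) ≡ (1ℚ + (m + m)) * (((m + m) * w) * ((m + m) * w))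
    eq₂ = RingSolver.solve-∀ ring

  monotone : ∀ (a : ℕ → ℚ) → (∀ n → a n ≤ a (suc n)) → ∀ m d → a m ≤ a (m ℕ.+ d)
  monotone a step m zero    = ℚ.≤-reflexive (cong a (sym (ℕ.+-identityʳ m)))
  monotone a step m (suc d) = ℚ.≤-trans (monotone a step m d)
    (subst (λ k → a (m ℕ.+ d) ≤ a k) (sym (ℕ.+-suc m d)) (step (m ℕ.+ d)))

  antitone : ∀ (a : ℕ → ℚ) → (∀ n → a (suc n) ≤ a n) → ∀ m d → a (m ℕ.+ d) ≤ a m
  antitone a step m zero    = ℚ.≤-reflexive (cong a (ℕ.+-identityʳ m))
  antitone a step m (suc d) = ℚ.≤-trans
    (subst (λ k → a k ≤ a (m ℕ.+ d)) (sym (ℕ.+-suc m d)) (step (m ℕ.+ d))) (antitone a step m d)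

  2Δ≤∇ : ∀ n → Δ n + Δ n ≤ ∇ n
  2Δ≤∇ n = ≤-by (w n * w n) (*-nonNeg (ℚ.<⇒≤ (w-pos n)) (ℚ.<⇒≤ (w-pos n))) (eq (w n) (ι n))
    where
    eq : ∀ w n → w * w * n + w * w * n + w * w ≡ w * w * (1ℚ + (n + n))
    eq = RingSolver.solve-∀ ring

  2Δ≤∇′ : ∀ m n → Δ m + Δ m ≤ ∇ n
  2Δ≤∇′ m n with ℕ.≤-total m n
  ... | inj₁ m≤n = ℚ.≤-trans (ℚ.+-mono-≤ Δm≤Δn Δm≤Δn) (2Δ≤∇ n)
    where Δm≤Δn = subst (λ k → Δ m ≤ Δ k) (ℕ.m+[n∸m]≡n m≤n) (monotone Δ Δ-suc m (n ℕ.∸ m))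
  ... | inj₂ n≤m = ℚ.≤-trans (2Δ≤∇ m) (subst (λ k → ∇ k ≤ ∇ n) (ℕ.m+[n∸m]≡n n≤m) (antitone ∇ ∇-suc n (m ℕ.∸ n)))

  Δ-pos : ∀ {n} → 1 ℕ.≤ n → 0ℚ < Δ n
  Δ-pos {n} 1≤n = *-pos (*-pos (w-pos n) (w-pos n)) (ι-pos 1≤n)

  -- `∇ n` exceeds `2 Δ n` only by the square of `w n`, a fraction 1/(2n) of `2 Δ n`.
  Δ-≤r* : ∀ r m n → 1ℚ ≤ (r - 1ℚ) * ι n → Δ m ≤ r * Δ n
  Δ-≤r* r m n h = *-cancelˡ-≤ (+-pos 0<1 0≤1) (begin
    (1ℚ + 1ℚ) * Δ m                         ≡⟨ eq₁ (Δ m) ⟩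
    Δ m + Δ m                               ≤⟨ 2Δ≤∇′ m n ⟩
    ∇ n                                     ≤⟨ ≤-by (w n * w n * ((r - 1ℚ) * ι n - 1ℚ) + w n * w n * ((r - 1ℚ) * ι n))
                                                 (+-nonNeg (*-nonNeg 0≤w² (p≤q⇒0≤q-p h)) (*-nonNeg 0≤w² (ℚ.≤-trans 0≤1 h)))
                                                 (eq₂ r (w n) (ι n)) ⟩
    (1ℚ + 1ℚ) * (r * Δ n)                   ∎)
    where
    open ℚ.≤-Reasoning
    0≤w² = *-nonNeg (ℚ.<⇒≤ (w-pos n)) (ℚ.<⇒≤ (w-pos n))
    eq₁ : ∀ a → (1ℚ + 1ℚ) * a ≡ a + a
    eq₁ = RingSolver.solve-∀ ring
    eq₂ : ∀ r w n → w * w * (1ℚ + (n + n)) + (w * w * ((r - 1ℚ) * n - 1ℚ) + w * w * ((r - 1ℚ) * n)) ≡ (1ℚ + 1ℚ) * (r * (w * w * n))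
    eq₂ = RingSolver.solve-∀ ring

  Δ-regular : (λ (m , n) → Δ m) ≈₂ (λ (m , n) → Δ n)
  Δ-regular r 1<r =
    let ev = ev-zip (λ n a b → a , b) (1 , λ n 1≤n → 1≤n) (ev-id-ι (inv h 0<h))
    in Pairs.ev-zip (λ (m , n) (1≤m , m≥) (1≤n , n≥) → close (Δ-pos 1≤m) (Δ-pos 1≤n) (Δ-≤r* r m n (large n n≥)) (Δ-≤r* r n m (large m m≥)))
         (ev-proj₁ ev) (ev-proj₂ ev)
    where
    h = r - 1ℚ
    0<h = p<q⇒0<q-p 1<r
    large : ∀ n → inv h 0<h ≤ ι n → 1ℚ ≤ h * ι n
    large n le = subst (_≤ h * ι n) (p*inv h 0<h) (*-monoʳ-≤ h (ℚ.<⇒≤ 0<h) le)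

  -- Leibniz' series with damped terms

  sign : ℕ → ℚ
  sign zero    = 1ℚ
  sign (suc n) = - sign n

  altSum-last : ∀ a n → altSum a (suc n) ≡ altSum a n + sign n * a n
  altSum-last a zero    = eq (a 0)
    where
    eq : ∀ a → a - 0ℚ ≡ 0ℚ + 1ℚ * a
    eq = RingSolver.solve-∀ ring
  altSum-last a (suc n) = trans (cong (λ z → a 0 - z) (altSum-last (a ∘ suc) n)) (eq (a 0) (altSum (a ∘ suc) n) (sign n) (a (suc n)))
    where
    eq : ∀ a s e b → a - (s + e * b) ≡ (a - s) + (- e) * b
    eq = RingSolver.solve-∀ ring

  altSum-linear : ∀ p q a b n → altSum (λ i → p * a i + q * b i) n ≡ p * altSum a n + q * altSum b n
  altSum-linear p q a b zero    = sym (trans (cong₂ _+_ (ℚ.*-zeroʳ p) (ℚ.*-zeroʳ q)) (ℚ.+-identityʳ 0ℚ))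
  altSum-linear p q a b (suc n) = trans (cong (λ z → p * a 0 + q * b 0 - z) (altSum-linear p q (a ∘ suc) (b ∘ suc) n))
    (eq p q (a 0) (b 0) (altSum (a ∘ suc) n) (altSum (b ∘ suc) n))
    where
    eq : ∀ p q a b s t → p * a + q * b - (p * s + q * t) ≡ p * (a - s) + q * (b - t)
    eq = RingSolver.solve-∀ ring

  altSum-*ˡ : ∀ p a n → altSum (λ i → p * a i) n ≡ p * altSum a n
  altSum-*ˡ p a zero    = sym (ℚ.*-zeroʳ p)
  altSum-*ˡ p a (suc n) = trans (cong (λ z → p * a 0 - z) (altSum-*ˡ p (a ∘ suc) n)) (eq p (a 0) (altSum (a ∘ suc) n))
    where
    eq : ∀ p a s → p * a - p * s ≡ p * (a - s)
    eq = RingSolver.solve-∀ ring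

  altSum-cong : ∀ {a b : ℕ → ℚ} n → (∀ i → a i ≡ b i) → altSum a n ≡ altSum b n
  altSum-cong zero    eq = refl
  altSum-cong (suc n) eq = cong₂ _-_ (eq 0) (altSum-cong n (eq ∘ suc))

  altSum-close : ∀ {a b : ℕ → ℚ} {e} n → (∀ i → i ℕ.< n → ∣ a i - b i ∣ ≤ e) → ∣ altSum a n - altSum b n ∣ ≤ ι n * e
  altSum-close {e = e} zero h = ℚ.≤-reflexive (sym (trans (cong (_* e) ι-0) (ℚ.*-zeroˡ e)))
  altSum-close {a} {b} {e} (suc n) h = begin
    ∣ (a 0 - s) - (b 0 - t) ∣      ≡⟨ cong ∣_∣ (eq₁ (a 0) (b 0) s t) ⟩
    ∣ (a 0 - b 0) - (s - t) ∣      ≤⟨ ℚ.∣p-q∣≤∣p∣+∣q∣ (a 0 - b 0) (s - t) ⟩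
    ∣ a 0 - b 0 ∣ + ∣ s - t ∣      ≤⟨ ℚ.+-mono-≤ (h 0 (ℕ.s≤s ℕ.z≤n)) (altSum-close n λ i i<n → h (suc i) (ℕ.s≤s i<n)) ⟩
    e + ι n * e                    ≡⟨ eq₂ e (ι n) ⟩
    (1ℚ + ι n) * e                 ≡⟨ cong (_* e) (ι-suc n) ⟨
    ι (suc n) * e                  ∎
    where
    open ℚ.≤-Reasoning
    s = altSum (a ∘ suc) n
    t = altSum (b ∘ suc) n
    eq₁ : ∀ a b s t → (a - s) - (b - t) ≡ (a - b) - (s - t)
    eq₁ = RingSolver.solve-∀ ring
    eq₂ : ∀ e n → e + n * e ≡ (1ℚ + n) * e
    eq₂ = RingSolver.solve-∀ ring

  -- ρ n i is the quotient of the binomial coefficients (2n+1 choose n-i) and (2n+1 choose n).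
  ρ : ℕ → ℕ → ℚ
  ρ n zero    = 1ℚ
  ρ n (suc i) = ρ n i * (ι n - ι i) * inv (ι (suc (suc (n ℕ.+ i)))) (ι-suc-pos (suc (n ℕ.+ i)))

  ρ-suc : ∀ n i → (1ℚ + (1ℚ + (ι n + ι i))) * ρ n (suc i) ≡ (ι n - ι i) * ρ n i
  ρ-suc n i = begin
    (1ℚ + (1ℚ + (ι n + ι i))) * ρ n (suc i)          ≡⟨ cong (_* ρ n (suc i)) N≡ ⟨
    N * (ρ n i * (ι n - ι i) * inv N 0<N)            ≡⟨ eq N (ρ n i) (ι n - ι i) (inv N 0<N) ⟩
    N * inv N 0<N * ((ι n - ι i) * ρ n i)            ≡⟨ cong (_* ((ι n - ι i) * ρ n i)) (p*inv N 0<N) ⟩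
    1ℚ * ((ι n - ι i) * ρ n i)                       ≡⟨ ℚ.*-identityˡ ((ι n - ι i) * ρ n i) ⟩
    (ι n - ι i) * ρ n i                              ∎
    where
    open ≡-Reasoning
    N = ι (suc (suc (n ℕ.+ i)))
    0<N = ι-suc-pos (suc (n ℕ.+ i))
    N≡ : N ≡ 1ℚ + (1ℚ + (ι n + ι i))
    N≡ = trans (ι-suc (suc (n ℕ.+ i))) (cong (1ℚ +_) (trans (ι-suc (n ℕ.+ i)) (cong (1ℚ +_) (ι-+ n i))))
    eq : ∀ m r d v → m * (r * d * v) ≡ m * v * (d * r)
    eq = RingSolver.solve-∀ ring

  0<2+ : ∀ n i → 0ℚ < 1ℚ + (1ℚ + (ι n + ι i))
  0<2+ n i = +-pos 0<1 (+-nonNeg 0≤1 (+-nonNeg (ι-nonNeg n) (ι-nonNeg i)))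

  ρ-suc-vanish : ∀ n i → ρ n i ≡ 0ℚ → ρ n (suc i) ≡ 0ℚ
  ρ-suc-vanish n i eq = *-cancelˡ-≡ (0<2+ n i) (trans (ρ-suc n i)
    (trans (cong ((ι n - ι i) *_) eq) (trans (ℚ.*-zeroʳ (ι n - ι i)) (sym (ℚ.*-zeroʳ (1ℚ + (1ℚ + (ι n + ι i))))))))

  ρ-vanish : ∀ n d → ρ n (suc n ℕ.+ d) ≡ 0ℚ
  ρ-vanish n zero = subst (λ k → ρ n (suc k) ≡ 0ℚ) (sym (ℕ.+-identityʳ n)) (*-cancelˡ-≡ (0<2+ n n) (trans (ρ-suc n n)
    (trans (cong (_* ρ n n) (ℚ.+-inverseʳ (ι n))) (trans (ℚ.*-zeroˡ (ρ n n)) (sym (ℚ.*-zeroʳ (1ℚ + (1ℚ + (ι n + ι n)))))))))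
  ρ-vanish n (suc d) = subst (λ k → ρ n (suc k) ≡ 0ℚ) (sym (ℕ.+-suc n d)) (ρ-suc-vanish n (suc n ℕ.+ d) (ρ-vanish n d))

  ρ-nonNeg : ∀ n i → 0ℚ ≤ ρ n i
  ρ-nonNeg n zero    = 0≤1
  ρ-nonNeg n (suc i) with i ℕ.≤? n
  ... | yes i≤n = *-cancelˡ-≤ (0<2+ n i) (subst₂ _≤_ (sym (ℚ.*-zeroʳ (1ℚ + (1ℚ + (ι n + ι i))))) (sym (ρ-suc n i))
    (*-nonNeg (p≤q⇒0≤q-p (ι-mono-≤ i≤n)) (ρ-nonNeg n i)))
  ... | no i≰n = ℚ.≤-reflexive (sym (ρ-suc-vanish n i (subst (λ k → ρ n k ≡ 0ℚ) (ℕ.m+[n∸m]≡n (ℕ.≰⇒> i≰n)) (ρ-vanish n (i ℕ.∸ suc n)))))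

  ρ-decreasing : ∀ n i → ρ n (suc i) ≤ ρ n i
  ρ-decreasing n i = *-cancelˡ-≤ (0<2+ n i) (≤-by ((1ℚ + ι i + (1ℚ + ι i)) * ρ n i)
    (*-nonNeg (+-nonNeg 0≤1+i 0≤1+i) (ρ-nonNeg n i))
    (trans (cong (_+ (1ℚ + ι i + (1ℚ + ι i)) * ρ n i) (ρ-suc n i)) (eq (ι n) (ι i) (ρ n i))))
    where
    0≤1+i = +-nonNeg 0≤1 (ι-nonNeg i)
    eq : ∀ n i r → (n - i) * r + (1ℚ + i + (1ℚ + i)) * r ≡ (1ℚ + (1ℚ + (n + i))) * r
    eq = RingSolver.solve-∀ ring

  ρ≤1 : ∀ n i → ρ n i ≤ 1ℚ
  ρ≤1 n i = antitone (ρ n) (ρ-decreasing n) 0 i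

  -- By `ρ-suc`, passing from `i` to `i + 1` lowers `ρ` by at most `(2 i + 2) / n`, and these
  -- decrements add up to `i (i + 1) / n`. For fixed `i` the damping factors thus tend to 1.
  1-ρ≤ : ∀ n i → ι n * (1ℚ - ρ n i) ≤ ι i * (1ℚ + ι i)
  1-ρ≤ n zero    = ℚ.≤-reflexive (trans (eq (ι n)) (cong (λ z → z * (1ℚ + z)) (sym ι-0)))
    where
    eq : ∀ n → n * (1ℚ - 1ℚ) ≡ 0ℚ * (1ℚ + 0ℚ)
    eq = RingSolver.solve-∀ ring
  1-ρ≤ n (suc i) = begin
    ι n * (1ℚ - s)                                   ≡⟨ eq₁ (ι n) r s ⟩
    ι n * (1ℚ - r) + ι n * (r - s)                   ≤⟨ ℚ.+-mono-≤ (1-ρ≤ n i) (*-monoˡ-≤ (r - s) (p≤q⇒0≤q-p (ρ-decreasing n i))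
                                                          (≤-by {ι n} (1ℚ + (1ℚ + ι i)) (+-nonNeg 0≤1 0≤1+i) (eq₂ (ι n) (ι i)))) ⟩
    ι i * (1ℚ + ι i) + N * (r - s)                   ≡⟨ eq₃ (ι i * (1ℚ + ι i)) N r s ⟩
    ι i * (1ℚ + ι i) + (N * r - N * s)               ≡⟨ cong (λ z → ι i * (1ℚ + ι i) + (N * r - z)) (ρ-suc n i) ⟩
    ι i * (1ℚ + ι i) + (N * r - (ι n - ι i) * r)     ≡⟨ eq₄ (ι n) (ι i) r ⟩
    ι i * (1ℚ + ι i) + (1ℚ + ι i + (1ℚ + ι i)) * r   ≤⟨ ℚ.+-monoʳ-≤ (ι i * (1ℚ + ι i)) (*-monoʳ-≤ (1ℚ + ι i + (1ℚ + ι i)) (+-nonNeg 0≤1+i 0≤1+i) (ρ≤1 n i)) ⟩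
    ι i * (1ℚ + ι i) + (1ℚ + ι i + (1ℚ + ι i)) * 1ℚ  ≡⟨ eq₅ (ι i) ⟩
    (1ℚ + ι i) * (1ℚ + (1ℚ + ι i))                   ≡⟨ cong (λ z → z * (1ℚ + z)) (ι-suc i) ⟨
    ι (suc i) * (1ℚ + ι (suc i))                     ∎
    where
    open ℚ.≤-Reasoning
    r = ρ n i
    s = ρ n (suc i)
    N = 1ℚ + (1ℚ + (ι n + ι i))
    0≤1+i = +-nonNeg 0≤1 (ι-nonNeg i)
    eq₁ : ∀ n r s → n * (1ℚ - s) ≡ n * (1ℚ - r) + n * (r - s)
    eq₁ = RingSolver.solve-∀ ring
    eq₂ : ∀ n i → n + (1ℚ + (1ℚ + i)) ≡ 1ℚ + (1ℚ + (n + i))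
    eq₂ = RingSolver.solve-∀ ring
    eq₃ : ∀ a N r s → a + N * (r - s) ≡ a + (N * r - N * s)
    eq₃ = RingSolver.solve-∀ ring
    eq₄ : ∀ n i r → i * (1ℚ + i) + ((1ℚ + (1ℚ + (n + i))) * r - (n - i) * r) ≡ i * (1ℚ + i) + (1ℚ + i + (1ℚ + i)) * r
    eq₄ = RingSolver.solve-∀ ring
    eq₅ : ∀ i → i * (1ℚ + i) + (1ℚ + i + (1ℚ + i)) * 1ℚ ≡ (1ℚ + i) * (1ℚ + (1ℚ + i))
    eq₅ = RingSolver.solve-∀ ring

  ρ-next : ∀ n i → (1ℚ + ι n - ι i) * (1ℚ + (1ℚ + (ι n + ι i))) * ρ (suc n) i ≡ (1ℚ + ι n) * (1ℚ + (1ℚ + ι n)) * ρ n i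
  ρ-next n zero = trans (cong (λ z → (1ℚ + ι n - z) * (1ℚ + (1ℚ + (ι n + z))) * 1ℚ) ι-0) (eq (ι n))
    where
    eq : ∀ n → (1ℚ + n - 0ℚ) * (1ℚ + (1ℚ + (n + 0ℚ))) * 1ℚ ≡ (1ℚ + n) * (1ℚ + (1ℚ + n)) * 1ℚ
    eq = RingSolver.solve-∀ ring
  ρ-next n (suc i) = *-cancelˡ-≡ (0<2+ n i) (begin
    N * ((1ℚ + ι n - ι (suc i)) * (1ℚ + (1ℚ + (ι n + ι (suc i)))) * ρ (suc n) (suc i))
      ≡⟨ cong (λ z → N * ((1ℚ + ι n - z) * (1ℚ + (1ℚ + (ι n + z))) * ρ (suc n) (suc i))) (ι-suc i) ⟩
    N * ((1ℚ + ι n - (1ℚ + ι i)) * (1ℚ + (1ℚ + (ι n + (1ℚ + ι i)))) * ρ (suc n) (suc i))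
      ≡⟨ eq₁ N (ι n) (ι i) (ρ (suc n) (suc i)) ⟩
    N * (ι n - ι i) * ((1ℚ + (1ℚ + (1ℚ + ι n + ι i))) * ρ (suc n) (suc i))
      ≡⟨ cong (λ z → N * (ι n - ι i) * z) (trans (cong (λ z → (1ℚ + (1ℚ + (z + ι i))) * ρ (suc n) (suc i)) (sym (ι-suc n)))
           (trans (ρ-suc (suc n) i) (cong (λ z → (z - ι i) * ρ (suc n) i) (ι-suc n)))) ⟩
    N * (ι n - ι i) * ((1ℚ + ι n - ι i) * ρ (suc n) i)
      ≡⟨ eq₂ N (ι n - ι i) (1ℚ + ι n - ι i) (ρ (suc n) i) ⟩
    (ι n - ι i) * ((1ℚ + ι n - ι i) * N * ρ (suc n) i)
      ≡⟨ cong ((ι n - ι i) *_) (ρ-next n i) ⟩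
    (ι n - ι i) * ((1ℚ + ι n) * (1ℚ + (1ℚ + ι n)) * ρ n i)
      ≡⟨ eq₃ (ι n - ι i) ((1ℚ + ι n) * (1ℚ + (1ℚ + ι n))) (ρ n i) ⟩
    (1ℚ + ι n) * (1ℚ + (1ℚ + ι n)) * ((ι n - ι i) * ρ n i)
      ≡⟨ cong ((1ℚ + ι n) * (1ℚ + (1ℚ + ι n)) *_) (ρ-suc n i) ⟨
    (1ℚ + ι n) * (1ℚ + (1ℚ + ι n)) * (N * ρ n (suc i))
      ≡⟨ eq₄ ((1ℚ + ι n) * (1ℚ + (1ℚ + ι n))) N (ρ n (suc i)) ⟩
    N * ((1ℚ + ι n) * (1ℚ + (1ℚ + ι n)) * ρ n (suc i)) ∎)
    where
    open ≡-Reasoning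
    N = 1ℚ + (1ℚ + (ι n + ι i))
    eq₁ : ∀ N n i r → N * ((1ℚ + n - (1ℚ + i)) * (1ℚ + (1ℚ + (n + (1ℚ + i)))) * r) ≡ N * (n - i) * ((1ℚ + (1ℚ + (1ℚ + n + i))) * r)
    eq₁ = RingSolver.solve-∀ ring
    eq₂ : ∀ N a b r → N * a * (b * r) ≡ a * (b * N * r)
    eq₂ = RingSolver.solve-∀ ring
    eq₃ : ∀ a b r → a * (b * r) ≡ b * (a * r)
    eq₃ = RingSolver.solve-∀ ring
    eq₄ : ∀ a b r → a * (b * r) ≡ b * (a * r)
    eq₄ = RingSolver.solve-∀ ring

  odd : ℕ → ℚ
  odd i = 1ℚ + (ι i + ι i)

  -- The sum telescopes: by `ρ-suc`, `n` times the `i`-th term is the difference of two consecutive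
  -- right-hand sides. Since `ρ n` vanishes beyond `n`, the complete sum is 0 for `n > 0`.
  altSum-odd-ρ : ∀ n i → ι n * altSum (λ l → odd l * ρ n l) i ≡ - (sign i * (ι i * (1ℚ + (ι n + ι i)) * ρ n i))
  altSum-odd-ρ n zero = trans (ℚ.*-zeroʳ (ι n)) (trans (eq (1ℚ + (ι n + ι 0)) 1ℚ) (cong (λ z → - (1ℚ * (z * (1ℚ + (ι n + ι 0)) * 1ℚ))) (sym ι-0)))
    where
    eq : ∀ a b → 0ℚ ≡ - (b * (0ℚ * a * b))
    eq = RingSolver.solve-∀ ring
  altSum-odd-ρ n (suc i) = begin
    ι n * altSum a (suc i)
      ≡⟨ cong (ι n *_) (altSum-last a i) ⟩
    ι n * (altSum a i + sign i * (odd i * ρ n i))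
      ≡⟨ ℚ.*-distribˡ-+ (ι n) (altSum a i) (sign i * (odd i * ρ n i)) ⟩
    ι n * altSum a i + ι n * (sign i * (odd i * ρ n i))
      ≡⟨ cong (_+ ι n * (sign i * (odd i * ρ n i))) (altSum-odd-ρ n i) ⟩
    - (sign i * (ι i * (1ℚ + (ι n + ι i)) * ρ n i)) + ι n * (sign i * ((1ℚ + (ι i + ι i)) * ρ n i))
      ≡⟨ eq₁ (ι n) (ι i) (sign i) (ρ n i) ⟩
    sign i * ((1ℚ + ι i) * ((ι n - ι i) * ρ n i))
      ≡⟨ cong (λ z → sign i * ((1ℚ + ι i) * z)) (ρ-suc n i) ⟨
    sign i * ((1ℚ + ι i) * ((1ℚ + (1ℚ + (ι n + ι i))) * ρ n (suc i)))
      ≡⟨ eq₂ (ι n) (ι i) (sign i) (ρ n (suc i)) ⟩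
    - (- sign i * ((1ℚ + ι i) * (1ℚ + (ι n + (1ℚ + ι i))) * ρ n (suc i)))
      ≡⟨ cong (λ z → - (- sign i * (z * (1ℚ + (ι n + z)) * ρ n (suc i)))) (ι-suc i) ⟨
    - (sign (suc i) * (ι (suc i) * (1ℚ + (ι n + ι (suc i))) * ρ n (suc i))) ∎
    where
    open ≡-Reasoning
    a : ℕ → ℚ
    a l = odd l * ρ n l
    eq₁ : ∀ n i e r → - (e * (i * (1ℚ + (n + i)) * r)) + n * (e * ((1ℚ + (i + i)) * r)) ≡ e * ((1ℚ + i) * ((n - i) * r))
    eq₁ = RingSolver.solve-∀ ring
    eq₂ : ∀ n i e r → e * ((1ℚ + i) * ((1ℚ + (1ℚ + (n + i))) * r)) ≡ - (- e * ((1ℚ + i) * (1ℚ + (n + (1ℚ + i))) * r))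
    eq₂ = RingSolver.solve-∀ ring

  odd-leibniz : ∀ i → odd i * leibniz i ≡ 4ℚ
  odd-leibniz i = begin
    odd i * leibniz i                        ≡⟨ cong (_* leibniz i) odd≡ ⟩
    ι (suc (2 ℕ.* i)) * leibniz i            ≡⟨ cong (_* leibniz i) (ι-def (suc (2 ℕ.* i))) ⟩
    (ℤ.+ suc (2 ℕ.* i) / 1) * (ℤ.+ 4 / suc (2 ℕ.* i))  ≡⟨ /-* (suc (2 ℕ.* i)) 4 1 (suc (2 ℕ.* i)) ⟩
    ℤ.+ (suc (2 ℕ.* i) ℕ.* 4) / (1 ℕ.* suc (2 ℕ.* i))  ≡⟨ ℚ.≤-antisym
        (/-mono-≤ (suc (2 ℕ.* i) ℕ.* 4) 4 (1 ℕ.* suc (2 ℕ.* i)) 1 (ℕ.≤-reflexive (e (suc (2 ℕ.* i)))))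
        (/-mono-≤ 4 (suc (2 ℕ.* i) ℕ.* 4) 1 (1 ℕ.* suc (2 ℕ.* i)) (ℕ.≤-reflexive (sym (e (suc (2 ℕ.* i)))))) ⟩
    4ℚ                                       ∎
    where
    open ≡-Reasoning
    odd≡ : odd i ≡ ι (suc (2 ℕ.* i))
    odd≡ = sym (trans (ι-suc (2 ℕ.* i)) (cong (1ℚ +_) (trans (ι-+ i (i ℕ.+ 0)) (cong (λ z → ι i + ι z) (ℕ.+-identityʳ i)))))
    e : ∀ m → m ℕ.* 4 ℕ.* 1 ≡ 4 ℕ.* (1 ℕ.* m)
    e m = trans (ℕ.*-identityʳ (m ℕ.* 4)) (trans (ℕ.*-comm m 4) (cong (4 ℕ.*_) (sym (ℕ.*-identityˡ m))))

  damped : ℕ → ℕ → ℚ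
  damped n i = ρ n i * leibniz i

  dampedSum : ℕ → ℚ
  dampedSum n = altSum (damped n) (suc n)

  -- Creative telescoping: the combination of the terms for `n + 1` and `n` is chosen to be summable
  -- by `altSum-odd-ρ`. After `ρ-next` it rests on (2n+3)² - 4(n+1-i)(n+2+i) = (2i+1)², where one
  -- factor `2i + 1` cancels the denominator of Leibniz' term.
  damped-next : ∀ n i → odd (suc n) * odd (suc n) * damped (suc n) i + - (4ℚ * ((1ℚ + ι n) * (1ℚ + (1ℚ + ι n)))) * damped n i ≡
                        4ℚ * (odd i * ρ (suc n) i)
  damped-next n i = begin
    odd (suc n) * odd (suc n) * (ρ (suc n) i * L) + - (4ℚ * ((1ℚ + ι n) * (1ℚ + (1ℚ + ι n)))) * (ρ n i * L)
      ≡⟨ cong (λ z → (1ℚ + (z + z)) * (1ℚ + (z + z)) * (ρ (suc n) i * L) + - (4ℚ * ((1ℚ + ι n) * (1ℚ + (1ℚ + ι n)))) * (ρ n i * L)) (ι-suc n) ⟩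
    (1ℚ + (1ℚ + ι n + (1ℚ + ι n))) * (1ℚ + (1ℚ + ι n + (1ℚ + ι n))) * (ρ (suc n) i * L) + - (4ℚ * ((1ℚ + ι n) * (1ℚ + (1ℚ + ι n)))) * (ρ n i * L)
      ≡⟨ eq₁ (ι n) (ρ (suc n) i) ((1ℚ + ι n) * (1ℚ + (1ℚ + ι n))) (ρ n i) L ⟩
    ((1ℚ + (1ℚ + ι n + (1ℚ + ι n))) * (1ℚ + (1ℚ + ι n + (1ℚ + ι n))) * ρ (suc n) i - 4ℚ * ((1ℚ + ι n) * (1ℚ + (1ℚ + ι n)) * ρ n i)) * L
      ≡⟨ cong (λ z → ((1ℚ + (1ℚ + ι n + (1ℚ + ι n))) * (1ℚ + (1ℚ + ι n + (1ℚ + ι n))) * ρ (suc n) i - 4ℚ * z) * L) (ρ-next n i) ⟨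
    ((1ℚ + (1ℚ + ι n + (1ℚ + ι n))) * (1ℚ + (1ℚ + ι n + (1ℚ + ι n))) * ρ (suc n) i - 4ℚ * ((1ℚ + ι n - ι i) * (1ℚ + (1ℚ + (ι n + ι i))) * ρ (suc n) i)) * L
      ≡⟨ eq₂ (ι n) (ι i) (ρ (suc n) i) L ⟩
    odd i * L * (odd i * ρ (suc n) i)
      ≡⟨ cong (_* (odd i * ρ (suc n) i)) (odd-leibniz i) ⟩
    4ℚ * (odd i * ρ (suc n) i) ∎
    where
    open ≡-Reasoning
    L = leibniz i
    eq₁ : ∀ n r a s l → (1ℚ + (1ℚ + n + (1ℚ + n))) * (1ℚ + (1ℚ + n + (1ℚ + n))) * (r * l) + - (4ℚ * a) * (s * l) ≡
          ((1ℚ + (1ℚ + n + (1ℚ + n))) * (1ℚ + (1ℚ + n + (1ℚ + n))) * r - 4ℚ * (a * s)) * l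
    eq₁ = RingSolver.solve-∀ ring
    eq₂ : ∀ n i r l → ((1ℚ + (1ℚ + n + (1ℚ + n))) * (1ℚ + (1ℚ + n + (1ℚ + n))) * r - 4ℚ * ((1ℚ + n - i) * (1ℚ + (1ℚ + (n + i))) * r)) * l ≡
          (1ℚ + (i + i)) * l * ((1ℚ + (i + i)) * r)
    eq₂ = RingSolver.solve-∀ ring

  dampedSum-next : ∀ n → odd (suc n) * odd (suc n) * dampedSum (suc n) ≡ 4ℚ * ((1ℚ + ι n) * (1ℚ + (1ℚ + ι n))) * dampedSum n
  dampedSum-next n = begin
    P * dampedSum (suc n)                              ≡⟨ eq (P * dampedSum (suc n)) Q (altSum (damped n) (suc (suc n))) ⟩
    P * dampedSum (suc n) + - Q * altSum (damped n) (suc (suc n)) + Q * altSum (damped n) (suc (suc n))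
      ≡⟨ cong₂ _+_ vanish (cong (Q *_) last) ⟩
    0ℚ + Q * dampedSum n                               ≡⟨ ℚ.+-identityˡ (Q * dampedSum n) ⟩
    Q * dampedSum n                                    ∎
    where
    open ≡-Reasoning
    P = odd (suc n) * odd (suc n)
    Q = 4ℚ * ((1ℚ + ι n) * (1ℚ + (1ℚ + ι n)))
    eq : ∀ a q b → a ≡ a + - q * b + q * b
    eq = RingSolver.solve-∀ ring
    ρ≡0 : ρ n (suc n) ≡ 0ℚ
    ρ≡0 = subst (λ k → ρ n (suc k) ≡ 0ℚ) (ℕ.+-identityʳ n) (ρ-vanish n 0)
    -- The sum for `n` is lengthened by its vanishing term at `n + 1`, so that it can be combined
    -- termwise with the sum for `n + 1`.
    last : altSum (damped n) (suc (suc n)) ≡ dampedSum n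
    last = trans (altSum-last (damped n) (suc n)) (trans (cong (λ z → dampedSum n + sign (suc n) * (z * leibniz (suc n))) ρ≡0)
      (eq₂ (dampedSum n) (sign (suc n)) (leibniz (suc n))))
      where
      eq₂ : ∀ d e l → d + e * (0ℚ * l) ≡ d
      eq₂ = RingSolver.solve-∀ ring
    oddSum : altSum (λ l → odd l * ρ (suc n) l) (suc (suc n)) ≡ 0ℚ
    oddSum = *-cancelˡ-≡ (ι-suc-pos n) (trans (altSum-odd-ρ (suc n) (suc (suc n)))
      (trans (cong (λ z → - (sign (suc (suc n)) * (ι (suc (suc n)) * (1ℚ + (ι (suc n) + ι (suc (suc n)))) * z)))
          (subst (λ k → ρ (suc n) (suc (suc k)) ≡ 0ℚ) (ℕ.+-identityʳ n) (ρ-vanish (suc n) 0)))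
        (eq₃ (sign (suc (suc n))) (ι (suc (suc n)) * (1ℚ + (ι (suc n) + ι (suc (suc n))))) (ι (suc n)))))
      where
      eq₃ : ∀ e a b → - (e * (a * 0ℚ)) ≡ b * 0ℚ
      eq₃ = RingSolver.solve-∀ ring
    vanish : P * dampedSum (suc n) + - Q * altSum (damped n) (suc (suc n)) ≡ 0ℚ
    vanish = trans (sym (altSum-linear P (- Q) (damped (suc n)) (damped n) (suc (suc n))))
      (trans (altSum-cong (suc (suc n)) (damped-next n))
        (trans (altSum-*ˡ 4ℚ (λ l → odd l * ρ (suc n) l) (suc (suc n))) (trans (cong (4ℚ *_) oddSum) (ℚ.*-zeroʳ 4ℚ))))

  w-odd : ∀ n → 4ℚ * ((1ℚ + ι n) * (1ℚ + ι n)) * (w (suc n) * w (suc n)) ≡ odd n * odd n * (w n * w n)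
  w-odd n = begin
    4ℚ * ((1ℚ + ι n) * (1ℚ + ι n)) * (w (suc n) * w (suc n))        ≡⟨ cong (λ m → 4ℚ * (m * m) * (w (suc n) * w (suc n))) (ι-suc n) ⟨
    4ℚ * (ι (suc n) * ι (suc n)) * (w (suc n) * w (suc n))          ≡⟨ eq₁ (ι (suc n)) (w (suc n)) ⟩
    (ι (suc n) + ι (suc n)) * w (suc n) * ((ι (suc n) + ι (suc n)) * w (suc n))
      ≡⟨ cong (λ z → z * z) (trans (w-suc n) (cong (_* w n) (trans (ι-suc (n ℕ.+ n)) (cong (1ℚ +_) (ι-+ n n))))) ⟩
    odd n * w n * (odd n * w n)                                     ≡⟨ interchange (odd n) (w n) (odd n) (w n) ⟩
    odd n * odd n * (w n * w n)                                     ∎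
    where
    open ≡-Reasoning
    eq₁ : ∀ m w → 4ℚ * (m * m) * (w * w) ≡ (m + m) * w * ((m + m) * w)
    eq₁ = RingSolver.solve-∀ ring

  dampedSum-w : ∀ n → odd n * odd n * (w n * w n * dampedSum n) ≡ 4ℚ * (1ℚ + ι n)
  dampedSum-w zero = trans (cong (λ z → (1ℚ + (z + z)) * (1ℚ + (z + z)) * (1ℚ * 1ℚ * (1ℚ * 4ℚ - 0ℚ))) ι-0)
    (cong (λ z → 4ℚ * (1ℚ + z)) (sym ι-0))
  dampedSum-w (suc n) = *-cancelˡ-≡ 0<m (begin
    m * (P * (W′ * dampedSum (suc n)))                 ≡⟨ eq₁ m P W′ (dampedSum (suc n)) ⟩
    m * W′ * (P * dampedSum (suc n))                   ≡⟨ cong (m * W′ *_) (dampedSum-next n) ⟩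
    m * W′ * (4ℚ * (m * (1ℚ + m)) * dampedSum n)       ≡⟨ eq₂ m W′ (dampedSum n) ⟩
    4ℚ * (m * m) * W′ * ((1ℚ + m) * dampedSum n)       ≡⟨ cong (_* ((1ℚ + m) * dampedSum n)) (w-odd n) ⟩
    odd n * odd n * (w n * w n) * ((1ℚ + m) * dampedSum n)  ≡⟨ eq₃ (odd n * odd n) (w n * w n) (1ℚ + m) (dampedSum n) ⟩
    (1ℚ + m) * (odd n * odd n * (w n * w n * dampedSum n))  ≡⟨ cong ((1ℚ + m) *_) (dampedSum-w n) ⟩
    (1ℚ + m) * (4ℚ * m)                                ≡⟨ eq₄ m ⟩
    m * (4ℚ * (1ℚ + m))                                ≡⟨ cong (λ z → m * (4ℚ * (1ℚ + z))) (ι-suc n) ⟨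
    m * (4ℚ * (1ℚ + ι (suc n)))                        ∎)
    where
    open ≡-Reasoning
    m = 1ℚ + ι n
    0<m = +-pos 0<1 (ι-nonNeg n)
    P = odd (suc n) * odd (suc n)
    W′ = w (suc n) * w (suc n)
    eq₁ : ∀ m p w d → m * (p * (w * d)) ≡ m * w * (p * d)
    eq₁ = RingSolver.solve-∀ ring
    eq₂ : ∀ m w d → m * w * (4ℚ * (m * (1ℚ + m)) * d) ≡ 4ℚ * (m * m) * w * ((1ℚ + m) * d)
    eq₂ = RingSolver.solve-∀ ring
    eq₃ : ∀ o w m d → o * w * (m * d) ≡ m * (o * (w * d))
    eq₃ = RingSolver.solve-∀ ring
    eq₄ : ∀ m → (1ℚ + m) * (4ℚ * m) ≡ m * (4ℚ * (1ℚ + m))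
    eq₄ = RingSolver.solve-∀ ring

  ≈-proj₁ : ∀ {p q} → p ≈ q → (p ∘ proj₁) ≈₂ (q ∘ proj₁)
  ≈-proj₁ p≈q r 1<r = ev-proj₁ (p≈q r 1<r)

  ≈-proj₂ : ∀ {p q} → p ≈ q → (p ∘ proj₂) ≈₂ (q ∘ proj₂)
  ≈-proj₂ p≈q r 1<r = ev-proj₂ (p≈q r 1<r)

  ev-1≤ : Eventually (λ n → n) (1 ℕ.≤_)
  ev-1≤ = 1 , λ n 1≤n → 1≤n

  -- By `dampedSum-w` and 4n(n+1) = (2n+1)² - 1, the product falls short of 1 by exactly 1/(2n+1)².
  dampedSum-Δ : (λ n → dampedSum n * Δ n) ≈ (λ _ → 1ℚ)
  dampedSum-Δ r 1<r = ev-zip (λ n 1≤n n≥ → near n 1≤n (subst (_≤ h * ι n) (p*inv h 0<h) (*-monoʳ-≤ h (ℚ.<⇒≤ 0<h) n≥)))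
      ev-1≤ (ev-id-ι (inv h 0<h))
    where
    h = r - 1ℚ
    0<h = p<q⇒0<q-p 1<r
    0<r = ℚ.<-trans 0<1 1<r
    near : ∀ n → 1 ℕ.≤ n → 1ℚ ≤ h * ι n → Close r (dampedSum n * Δ n) 1ℚ
    near n 1≤n hn≥1 = close 0<z 0<1 (ℚ.≤-trans z≤1 (subst (1ℚ ≤_) (sym (ℚ.*-identityʳ r)) (ℚ.<⇒≤ 1<r))) 1≤rz
      where
      z = dampedSum n * Δ n
      P = odd n * odd n
      0<odd = +-pos 0<1 (+-nonNeg (ι-nonNeg n) (ι-nonNeg n))
      0<P = *-pos 0<odd 0<odd
      Pz : P * z ≡ P * 1ℚ - 1ℚ
      Pz = begin
        P * (dampedSum n * (w n * w n * ι n))            ≡⟨ eq₁ P (dampedSum n) (w n * w n) (ι n) ⟩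
        P * (w n * w n * dampedSum n) * ι n              ≡⟨ cong (_* ι n) (dampedSum-w n) ⟩
        4ℚ * (1ℚ + ι n) * ι n                            ≡⟨ eq₂ (ι n) ⟩
        P * 1ℚ - 1ℚ                                      ∎
        where
        open ≡-Reasoning
        eq₁ : ∀ p d w n → p * (d * (w * n)) ≡ p * (w * d) * n
        eq₁ = RingSolver.solve-∀ ring
        eq₂ : ∀ n → 4ℚ * (1ℚ + n) * n ≡ (1ℚ + (n + n)) * (1ℚ + (n + n)) * 1ℚ - 1ℚ
        eq₂ = RingSolver.solve-∀ ring
      z≤1 : z ≤ 1ℚ
      z≤1 = *-cancelˡ-≤ 0<P (≤-by 1ℚ 0≤1 (trans (cong (_+ 1ℚ) Pz) (eq (P * 1ℚ))))
        where
        eq : ∀ a → a - 1ℚ + 1ℚ ≡ a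
        eq = RingSolver.solve-∀ ring
      1≤rz : 1ℚ ≤ r * z
      1≤rz = *-cancelˡ-≤ 0<P (≤-by ((4ℚ * (1ℚ + ι n)) * (h * ι n - 1ℚ) + (4ℚ * ι n + (1ℚ + 1ℚ + 1ℚ)))
        (+-nonNeg (*-nonNeg (*-nonNeg 0≤4 (+-nonNeg 0≤1 (ι-nonNeg n))) (p≤q⇒0≤q-p hn≥1))
          (+-nonNeg (*-nonNeg 0≤4 (ι-nonNeg n)) (+-nonNeg (+-nonNeg 0≤1 0≤1) 0≤1)))
        (trans (eq₁ (ι n) r) (trans (cong (r *_) (sym Pz)) (eq₂ r P z))))
        where
        0≤4 : 0ℚ ≤ 4ℚ
        0≤4 = ℚ.<⇒≤ (ℚ.positive⁻¹ 4ℚ)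
        eq₁ : ∀ n r → (1ℚ + (n + n)) * (1ℚ + (n + n)) * 1ℚ + ((4ℚ * (1ℚ + n)) * ((r - 1ℚ) * n - 1ℚ) + (4ℚ * n + (1ℚ + 1ℚ + 1ℚ))) ≡
              r * ((1ℚ + (n + n)) * (1ℚ + (n + n)) * 1ℚ - 1ℚ)
        eq₁ = RingSolver.solve-∀ ring
        eq₂ : ∀ r p z → r * (p * z) ≡ p * (r * z)
        eq₂ = RingSolver.solve-∀ ring
      0<z : 0ℚ < z
      0<z = *-cancelˡ-< (ℚ.<⇒≤ 0<r) (subst (_< r * z) (sym (ℚ.*-zeroʳ r)) (ℚ.<-≤-trans 0<1 1≤rz))

  damped-nonNeg : ∀ n → Alternating.NonNegative (damped n)
  damped-nonNeg n i = *-nonNeg (ρ-nonNeg n i) (leibniz-nonNeg i)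

  damped-decreasing : ∀ n → Alternating.Decreasing (damped n)
  damped-decreasing n i = *-mono-≤ (ρ-nonNeg n (suc i)) (leibniz-nonNeg (suc i)) (ρ-decreasing n i) (leibniz-dec i)

  damped≤leibniz : ∀ n i → damped n i ≤ leibniz i
  damped≤leibniz n i = r*p≤p (leibniz-nonNeg i) (ρ≤1 n i)

  altSum-tail : ∀ a → Alternating.NonNegative a → Alternating.Decreasing a → ∀ {m n} → m ℕ.≤ n → ∣ altSum a n - altSum a m ∣ ≤ a m
  altSum-tail a nn dec {m} {n} m≤n = subst (λ k → ∣ altSum a k - altSum a m ∣ ≤ a m) (ℕ.m+[n∸m]≡n m≤n)
    (Alternating.diff a nn dec m (n ℕ.∸ m))

  damped-close : ∀ {e} m n i → i ℕ.< m → 1 ℕ.≤ n → ι m * (1ℚ + ι m) * 4ℚ ≤ ι n * e → ∣ damped n i - leibniz i ∣ ≤ e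
  damped-close {e} m n i i<m 1≤n h = *-cancelˡ-≤ (ι-pos 1≤n) (begin
    ι n * ∣ damped n i - leibniz i ∣                   ≡⟨ cong (ι n *_) abs ⟩
    ι n * ((1ℚ - ρ n i) * leibniz i)                   ≡⟨ ℚ.*-assoc (ι n) (1ℚ - ρ n i) (leibniz i) ⟨
    ι n * (1ℚ - ρ n i) * leibniz i                     ≤⟨ *-mono-≤ (*-nonNeg (ι-nonNeg n) 0≤1-ρ) (leibniz-nonNeg i)
                                                            (ℚ.≤-trans (1-ρ≤ n i) (*-mono-≤ (ι-nonNeg i) (+-nonNeg 0≤1 (ι-nonNeg i)) i≤m (ℚ.+-monoʳ-≤ 1ℚ i≤m)))
                                                            (leibniz-anti {0} {i} ℕ.z≤n) ⟩
    ι m * (1ℚ + ι m) * 4ℚ                              ≤⟨ h ⟩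
    ι n * e                                            ∎)
    where
    open ℚ.≤-Reasoning
    i≤m = ι-mono-≤ (ℕ.<⇒≤ i<m)
    0≤1-ρ = p≤q⇒0≤q-p (ρ≤1 n i)
    eq : ∀ r l → l - r * l ≡ (1ℚ - r) * l
    eq = RingSolver.solve-∀ ring
    abs : ∣ damped n i - leibniz i ∣ ≡ (1ℚ - ρ n i) * leibniz i
    abs = trans (∣∣-swap (damped n i) (leibniz i)) (trans (cong ∣_∣ (eq (ρ n i) (leibniz i)))
      (ℚ.0≤p⇒∣p∣≡p (*-nonNeg 0≤1-ρ (leibniz-nonNeg i))))

  -- An interchange of limits. Both series are cut at a fixed `m`: alternation bounds their tails by
  -- `leibniz m`, uniformly in `n` and `M`, and the finitely many terms before `m` converge as `n`
  -- grows.
  dampedSum-close : ∀ {ε} → 0ℚ < ε → Eventually size₂ λ (n , M) → ∣ dampedSum n - altSum leibniz M ∣ ≤ ε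
  dampedSum-close {ε} 0<ε =
    let m , leib< = leibniz→0 (½ * (½ * ε)) (½-pos (½-pos 0<ε))
        0<1+m = +-pos 0<1 (ι-nonNeg m)
        -- The `m` leading terms share `½ * ε`, and the two tails take `½ * (½ * ε)` each. Dividing
        -- by `1 + m` covers `m = 0`.
        e = ½ * ε * inv (1ℚ + ι m) 0<1+m
        0<e = *-pos (½-pos 0<ε) (inv-pos (1ℚ + ι m) 0<1+m)
        Q = ι m * (1ℚ + ι m) * 4ℚ
    in Pairs.ev-zip (λ (n , M) (1≤n , m≤n , n≥) m≤M → bound m n M (ℚ.<⇒≤ leib<) 1≤n m≤n m≤M
           (subst (Q ≤_) (ℚ.*-comm e (ι n)) (subst (_≤ e * ι n) (trans (sym (ℚ.*-assoc e (inv e 0<e) Q))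
             (trans (cong (_* Q) (p*inv e 0<e)) (ℚ.*-identityˡ Q))) (*-monoʳ-≤ e (ℚ.<⇒≤ 0<e) n≥))))
         (ev-proj₁ (ev-zip (λ n a b → a , b) ev-1≤ (ev-zip (λ n a b → a , b) (m , λ n m≤n → m≤n) (ev-id-ι (inv e 0<e * Q)))))
         (ev-proj₂ (m , λ M m≤M → m≤M))
    where
    bound : ∀ m n M → leibniz m ≤ ½ * (½ * ε) → 1 ℕ.≤ n → m ℕ.≤ n → m ℕ.≤ M →
            ι m * (1ℚ + ι m) * 4ℚ ≤ ι n * (½ * ε * inv (1ℚ + ι m) (+-pos 0<1 (ι-nonNeg m))) →
            ∣ dampedSum n - altSum leibniz M ∣ ≤ ε
    bound m n M leib≤ 1≤n m≤n m≤M h = begin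
      ∣ d - s ∣                                       ≡⟨ cong ∣_∣ (eq d s dₘ sₘ) ⟩
      ∣ (d - dₘ) + ((dₘ - sₘ) - (s - sₘ)) ∣            ≤⟨ ℚ.∣p+q∣≤∣p∣+∣q∣ (d - dₘ) ((dₘ - sₘ) - (s - sₘ)) ⟩
      ∣ d - dₘ ∣ + ∣ (dₘ - sₘ) - (s - sₘ) ∣            ≤⟨ ℚ.+-monoʳ-≤ ∣ d - dₘ ∣ (ℚ.∣p-q∣≤∣p∣+∣q∣ (dₘ - sₘ) (s - sₘ)) ⟩
      ∣ d - dₘ ∣ + (∣ dₘ - sₘ ∣ + ∣ s - sₘ ∣)
        ≤⟨ ℚ.+-mono-≤ (ℚ.≤-trans (altSum-tail (damped n) (damped-nonNeg n) (damped-decreasing n) (ℕ.m≤n⇒m≤1+n m≤n))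
                        (ℚ.≤-trans (damped≤leibniz n m) leib≤))
             (ℚ.+-mono-≤ (ℚ.≤-trans (altSum-close m λ i i<m → damped-close m n i i<m 1≤n h) me≤)
                         (ℚ.≤-trans (altSum-tail leibniz leibniz-nonNeg leibniz-dec m≤M) leib≤)) ⟩
      ½ * (½ * ε) + (½ * ε + ½ * (½ * ε))             ≡⟨ eq₂ ε ⟩
      ε                                               ∎
      where
      open ℚ.≤-Reasoning
      d = dampedSum n
      s = altSum leibniz M
      dₘ = altSum (damped n) m
      sₘ = altSum leibniz m
      0<1+m = +-pos 0<1 (ι-nonNeg m)
      v = inv (1ℚ + ι m) 0<1+m
      me≤ : ι m * (½ * ε * v) ≤ ½ * ε
      me≤ = ≤-by (½ * ε * v) (*-nonNeg (ℚ.<⇒≤ (½-pos 0<ε)) (ℚ.<⇒≤ (inv-pos (1ℚ + ι m) 0<1+m)))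
        (trans (eq₃ (ι m) (½ * ε) v) (trans (cong (½ * ε *_) (p*inv (1ℚ + ι m) 0<1+m)) (ℚ.*-identityʳ (½ * ε))))
        where
        eq₃ : ∀ m e v → m * (e * v) + e * v ≡ e * ((1ℚ + m) * v)
        eq₃ = RingSolver.solve-∀ ring
      eq : ∀ d s a b → d - s ≡ (d - a) + ((a - b) - (s - b))
      eq = RingSolver.solve-∀ ring
      eq₂ : ∀ e → ½ * (½ * e) + (½ * e + ½ * (½ * e)) ≡ e
      eq₂ = RingSolver.solve-∀ ring

  dampedSum-≈ : (λ (n , M) → dampedSum n) ≈₂ (λ (n , M) → altSum leibniz M)
  dampedSum-≈ r 1<r = Pairs.ev-zip (λ (n , M) → near (dampedSum n) (altSum leibniz M))
      (dampedSum-close 0<η) (ev-proj₂ (1 , proj₂ (proj₂ (proj₂ (pos π)))))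
    where
    l = leibniz 0 - leibniz 1
    0<l : 0ℚ < l
    0<l = ℚ.positive⁻¹ l
    h = r - 1ℚ
    0<h = p<q⇒0<q-p 1<r
    0<r = ℚ.<-trans 0<1 1<r
    v = inv r 0<r
    -- The partial sums of π stay above `l`, so `r * η = h * l ≤ h * s`: the additive error is
    -- absorbed by the factor `r` in both directions.
    η = h * l * v
    0<η : 0ℚ < η
    0<η = *-pos (*-pos 0<h 0<l) (inv-pos r 0<r)
    rη≡ : r * η ≡ h * l
    rη≡ = trans (eq r h l v) (trans (cong (λ z → h * l * z) (p*inv r 0<r)) (ℚ.*-identityʳ (h * l)))
      where
      eq : ∀ r h l v → r * (h * l * v) ≡ h * l * (r * v)
      eq = RingSolver.solve-∀ ring
    near : ∀ d s → ∣ d - s ∣ ≤ η → l ≤ s → Close r d s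
    near d s ds≤ l≤s = close 0<d (ℚ.<-≤-trans 0<l l≤s) d≤rs s≤rd
      where
      open ℚ.≤-Reasoning
      hl≤hs = *-monoʳ-≤ h (ℚ.<⇒≤ 0<h) l≤s
      d≤rs : d ≤ r * s
      d≤rs = begin
        d               ≤⟨ p≤∣p-q∣+q d s ⟩
        ∣ d - s ∣ + s   ≤⟨ ℚ.+-monoˡ-≤ s (ℚ.≤-trans ds≤ (ℚ.≤-trans (p≤r*p (ℚ.<⇒≤ 0<η) (ℚ.<⇒≤ 1<r)) (ℚ.≤-trans (ℚ.≤-reflexive rη≡) hl≤hs))) ⟩
        h * s + s       ≡⟨ eq r s ⟩
        r * s           ∎
        where
        eq : ∀ r s → (r - 1ℚ) * s + s ≡ r * s
        eq = RingSolver.solve-∀ ring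
      s≤rd : s ≤ r * d
      s≤rd = begin
        s                         ≡⟨ eq₁ r s ⟩
        r * s - h * s             ≤⟨ ℚ.+-monoˡ-≤ (- (h * s)) (*-monoʳ-≤ r (ℚ.<⇒≤ 0<r) (ℚ.≤-trans (p≤∣p-q∣+q s d)
                                       (ℚ.+-monoˡ-≤ d (subst (_≤ η) (∣∣-swap d s) ds≤)))) ⟩
        r * (η + d) - h * s       ≡⟨ trans (cong (_- h * s) (trans (ℚ.*-distribˡ-+ r η d) (cong (_+ r * d) rη≡))) (eq₂ (h * l) (r * d) (h * s)) ⟩
        r * d + (h * l - h * s)   ≤⟨ ℚ.+-monoʳ-≤ (r * d) (ℚ.+-monoˡ-≤ (- (h * s)) hl≤hs) ⟩
        r * d + (h * s - h * s)   ≡⟨ eq₃ (r * d) (h * s) ⟩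
        r * d                     ∎
        where
        eq₁ : ∀ r s → s ≡ r * s - (r - 1ℚ) * s
        eq₁ = RingSolver.solve-∀ ring
        eq₂ : ∀ a b c → a + b - c ≡ b + (a - c)
        eq₂ = RingSolver.solve-∀ ring
        eq₃ : ∀ a b → a + (b - b) ≡ a
        eq₃ = RingSolver.solve-∀ ring
      0<d : 0ℚ < d
      0<d = *-cancelˡ-< (ℚ.<⇒≤ 0<r) (subst (_< r * d) (sym (ℚ.*-zeroʳ r)) (ℚ.<-≤-trans (ℚ.<-≤-trans 0<l l≤s) s≤rd))

  -- Wallis' product in the form n wₙ² → 1/π, with π replaced by the partial sums of its series.
  wallis : (λ (n , M) → Δ n * altSum leibniz M) ≈₂ (λ _ → 1ℚ)
  wallis = Pairs.≈-trans (Pairs.≈-* (Pairs.≈-refl (ev-proj₁ (1 , λ n → Δ-pos))) (Pairs.≈-sym dampedSum-≈))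
    (Pairs.≈-resp (λ (n , M) → ℚ.*-comm (dampedSum n) (Δ n)) (λ _ → refl) (≈-proj₁ dampedSum-Δ))

  -- The growth of the collision probabilities

  constant : ∀ {c : ℚ} → 0ℚ < c → (λ (_ : ℕ) → c) ≈ (λ _ → c)
  constant 0<c = ≈-refl (0 , λ _ _ → 0<c)

  module Step (k : ℕ) where

    K K′ : ℚ
    K  = ι (suc (suc k))
    K′ = ι (suc k)

    0<K : 0ℚ < K
    0<K = ι-suc-pos (suc k)

    0<p₀ : 0ℚ < p₀ k
    0<p₀ = inv-pos K 0<K

    0<p₁ : 0ℚ < p₁ k
    0<p₁ = *-pos 0<p₀ (ι-suc-pos k)

    Kp₀≡1 : K * p₀ k ≡ 1ℚ
    Kp₀≡1 = p*inv K 0<K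

    Kp₁≡K′ : K * p₁ k ≡ K′
    Kp₁≡K′ = trans (sym (ℚ.*-assoc K (p₀ k) K′)) (trans (cong (_* K′) Kp₀≡1) (ℚ.*-identityˡ K′))

    p₀+p₁≡1 : p₀ k + p₁ k ≡ 1ℚ
    p₀+p₁≡1 = *-cancelˡ-≡ 0<K (begin
      K * (p₀ k + p₁ k)        ≡⟨ ℚ.*-distribˡ-+ K (p₀ k) (p₁ k) ⟩
      K * p₀ k + K * p₁ k      ≡⟨ cong₂ _+_ Kp₀≡1 Kp₁≡K′ ⟩
      1ℚ + K′                ≡⟨ ι-suc (suc k) ⟨
      K                      ≡⟨ ℚ.*-identityʳ K ⟨
      K * 1ℚ                 ∎)
      where open ≡-Reasoning

    b : ℕ → ℕ → ℚ
    b = bin (p₀ k) (p₁ k)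

    0≤b : ∀ i j → 0ℚ ≤ b i j
    0≤b = bin-nonNeg (ℚ.<⇒≤ 0<p₀) (ℚ.<⇒≤ 0<p₁)

    b≤1 : ∀ i j → b i j ≤ 1ℚ
    b≤1 = bin≤1 (ℚ.<⇒≤ 0<p₀) (ℚ.<⇒≤ 0<p₁) p₀+p₁≡1

    0≤b² : ∀ i j → 0ℚ ≤ b i j * b i j
    0≤b² i j = *-nonNeg (0≤b i j) (0≤b i j)

    b²≤b : ∀ i j → b i j * b i j ≤ b i j
    b²≤b i j = r*p≤p (0≤b i j) (b≤1 i j)

    t u : ℚ
    t = (p₀ k - p₁ k) * (p₀ k - p₁ k)
    u = 4ℚ * (p₀ k * p₁ k)

    -- For `k = 0` both probabilities are `½` and `t` is 0, which is why the averaging argument has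
    -- to admit a first probability 0.
    0≤t : 0ℚ ≤ t
    0≤t with ℚ.≤-total (p₁ k) (p₀ k)
    ... | inj₁ y≤x = *-nonNeg (p≤q⇒0≤q-p y≤x) (p≤q⇒0≤q-p y≤x)
    ... | inj₂ x≤y = subst (0ℚ ≤_) (eq (p₀ k) (p₁ k)) (*-nonNeg (p≤q⇒0≤q-p x≤y) (p≤q⇒0≤q-p x≤y))
      where
      eq : ∀ x y → (y - x) * (y - x) ≡ (x - y) * (x - y)
      eq = RingSolver.solve-∀ ring

    0<u : 0ℚ < u
    0<u = *-pos (ℚ.positive⁻¹ 4ℚ) (*-pos 0<p₀ 0<p₁)

    t+u≡1 : t + u ≡ 1ℚ
    t+u≡1 = trans (eq (p₀ k) (p₁ k)) (cong (λ z → z * z) p₀+p₁≡1)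
      where
      eq : ∀ x y → (x - y) * (x - y) + 4ℚ * (x * y) ≡ (x + y) * (x + y)
      eq = RingSolver.solve-∀ ring

    S : ℕ → ℚ
    S n = D n λ i j → b i j * b i j

    w-regular : Regular w 1
    w-regular = Pairs.≈-resp (λ (m , n) → cong (w m * w m *_) (sym (ℚ.*-identityʳ (ι m))))
      (λ (m , n) → cong (w n * w n *_) (sym (ℚ.*-identityʳ (ι n)))) Δ-regular

    -- Here the mass is 1, and the average of `w` is `S n` by `D-bin²`.
    module Central = Averaging 0≤t 0<u t+u≡1 {A = bin t u}
      (bin-nonNeg 0≤t (ℚ.<⇒≤ 0<u)) (λ i j → ℚ.≤-refl) {c = 1ℚ} 0<1
      (1 , λ n 1≤n → subst (1ℚ ≤_) (trans (sym (ℚ.*-identityˡ (ι n))) (cong (_* ι n) (sym (D-bin n t u t+u≡1))))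
        (subst (_≤ ι n) ι-1 (ι-mono-≤ 1≤n)))
      {g = w} {r = 1} w-pos w≤1 w-regular

    S²-≈ : (λ n → S n * S n * (u * ι n)) ≈ Δ
    S²-≈ = ≈-resp
      (λ n → cong₂ (λ s m → s * s * m) (sym (D-bin² (p₀ k) (p₁ k) n)) (ℚ.*-identityʳ (u * ι n)))
      (λ n → trans (cong₂ (λ s m → s * s * (w n * w n * m)) (D-bin n t u t+u≡1) (ℚ.*-identityʳ (ι n)))
                   (trans (cong (_* Δ n) (ℚ.*-identityʳ 1ℚ)) (ℚ.*-identityˡ (Δ n))))
      Central.average²-≈

    S-nonNeg : ∀ n → 0ℚ ≤ S n
    S-nonNeg n = D-nonNeg n 0≤b²

    S≤1 : ∀ n → S n ≤ 1ℚ
    S≤1 n = subst (S n ≤_) (D-bin n (p₀ k) (p₁ k) p₀+p₁≡1) (D-mono n λ i j _ → b²≤b i j)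

    -- In `S²-≈` one factor `S n` and the factor `u` are bounded by 1. The true order of `S n` is
    -- the power -1/2 of `n`, but this weaker bound is all that `Averaging` asks for.
    S-mass : Eventually (λ n → n) λ n → ½ * Δ 1 ≤ S n * ι n
    S-mass = ev-zip bound ev-1≤ (S²-≈ (1ℚ + 1ℚ) (<-by 1ℚ 0<1 refl))
      where
      u≤1 : u ≤ 1ℚ
      u≤1 = ≤-by t 0≤t (trans (ℚ.+-comm u t) t+u≡1)
      eq : ∀ a → (1ℚ + 1ℚ) * (½ * a) ≡ a
      eq = RingSolver.solve-∀ ring
      bound : ∀ n → 1 ℕ.≤ n → Close (1ℚ + 1ℚ) (S n * S n * (u * ι n)) (Δ n) → ½ * Δ 1 ≤ S n * ι n
      bound n 1≤n c = *-cancelˡ-≤ (+-pos 0<1 0≤1) (begin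
        (1ℚ + 1ℚ) * (½ * Δ 1)                   ≡⟨ eq (Δ 1) ⟩
        Δ 1                                     ≤⟨ subst (λ m → Δ 1 ≤ Δ m) (ℕ.m+[n∸m]≡n 1≤n) (monotone Δ Δ-suc 1 (n ℕ.∸ 1)) ⟩
        Δ n                                     ≤⟨ ≥r* c ⟩
        (1ℚ + 1ℚ) * (S n * S n * (u * ι n))     ≤⟨ *-monoʳ-≤ (1ℚ + 1ℚ) (+-nonNeg 0≤1 0≤1)
                                                     (*-mono-≤ (*-nonNeg (S-nonNeg n) (S-nonNeg n)) (*-nonNeg (ℚ.<⇒≤ 0<u) (ι-nonNeg n))
                                                       (r*p≤p (S-nonNeg n) (S≤1 n)) (r*p≤p (ι-nonNeg n) u≤1)) ⟩
        (1ℚ + 1ℚ) * (S n * ι n)                 ∎)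
        where open ℚ.≤-Reasoning

  collision-pos : ∀ k n → 0ℚ < collision k n
  collision-pos zero    n = 0<1
  collision-pos (suc k) n = ℚ.<-≤-trans (*-pos (*-pos 0<b 0<b) (collision-pos k n))
    (D-single-≤ {λ i j → b i j * b i j * collision k j} (λ i j → *-nonNeg (0≤b² i j) (ℚ.<⇒≤ (collision-pos k j))) 0 n)
    where
    open Step k
    0<b : 0ℚ < b 0 n
    0<b = *-pos 0<1 (*-pos 0<1 (^-pos n 0<p₁))

  collision≤1 : ∀ k n → collision k n ≤ 1ℚ
  collision≤1 zero    n = ℚ.≤-refl
  collision≤1 (suc k) n = subst (collision (suc k) n ≤_) (D-bin n (p₀ k) (p₁ k) p₀+p₁≡1) (D-mono n λ i j _ →
      ℚ.≤-trans (subst (b i j * b i j * collision k j ≤_) (ℚ.*-identityʳ (b i j * b i j)) (*-monoʳ-≤ (b i j * b i j) (0≤b² i j) (collision≤1 k j)))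
        (b²≤b i j))
    where open Step k

  -- Since n wₙ² → 1/π, this is the square of the theorem for k + 1 letters.
  growth-≈ : ∀ k → (λ n → 4ℚ ^ k * weighted (collision k) k n) ≈ (λ n → ι (suc k) ^ suc k * Δ n ^ k)
  growth-≈ zero = ≈-resp (λ _ → refl) (λ _ → sym (cong (λ z → z * 1ℚ * 1ℚ) ι-1)) (constant 0<1)
  growth-≈ (suc k) = ≈-cancelˡ (0 , λ _ _ → 0<z) (≈-trans
      (≈-resp
        (λ n → trans (cong (λ m → 4ℚ * (4ℚ ^ k * (collision (suc k) n * collision (suc k) n * m) * (u * ι n))) (^-distrib-* (p₁ k) (ι n) k))
            (eq₂ 4ℚ (4ℚ ^ k) (collision (suc k) n) (p₁ k ^ k) (ι n) (ι n ^ k) u))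
        (λ n → eq₃ 4ℚ (4ℚ ^ k) (S n) (weighted (collision k) k n) (u * ι n))
        (≈-* (constant 0<4) (≈-* (≈-* (constant (^-pos k 0<4)) Letters.average²-≈) (≈-refl (1 , λ n 1≤n → *-pos 0<u (ι-pos 1≤n))))))
      (≈-resp (λ _ → refl) (λ n → trans (eq₄ 4ℚ (K′ ^ suc k) (Δ n) (Δ n ^ k)) (trans (cong (_* (Δ n * Δ n ^ k)) z≡)
          (ℚ.*-assoc z (K ^ suc (suc k)) (Δ n ^ suc k))))
        (≈-* (constant 0<4) (≈-* S²-≈ (growth-≈ k)))))
    where
    open Step k
    0<4 : 0ℚ < 4ℚ
    0<4 = ℚ.positive⁻¹ 4ℚ
    z = p₁ k ^ k * u
    0<z : 0ℚ < z
    0<z = *-pos (^-pos k 0<p₁) 0<u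
    -- The induction hypothesis expresses the weighted sequence by a power of `Δ`, whose regularity
    -- is known without its limit.
    regular : Regular (collision k) k
    regular = Pairs.≈-cancelˡ (0 , λ _ _ → ^-pos k 0<4) (Pairs.≈-trans (≈-proj₁ (growth-≈ k))
      (Pairs.≈-trans (Pairs.≈-* (Pairs.≈-refl (0 , λ _ _ → ^-pos (suc k) (ι-suc-pos k))) (Pairs.≈-^ k Δ-regular))
        (Pairs.≈-sym (≈-proj₂ (growth-≈ k)))))
    module Letters = Averaging (ℚ.<⇒≤ 0<p₀) 0<p₁ p₀+p₁≡1 {A = λ i j → b i j * b i j} 0≤b² b²≤b
      (½-pos (Δ-pos {1} ℕ.≤-refl)) S-mass {g = collision k} {r = k} (collision-pos k) (collision≤1 k) regular
    eq₂ : ∀ f g c y n m u → f * (g * (c * c * (y * m)) * (u * n)) ≡ y * u * (f * g * (c * c * (n * m)))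
    eq₂ = RingSolver.solve-∀ ring
    eq₃ : ∀ f g s c m → f * (g * (s * s * c) * m) ≡ f * (s * s * m * (g * c))
    eq₃ = RingSolver.solve-∀ ring
    eq₄ : ∀ f c d e → f * (d * (c * e)) ≡ f * c * (d * e)
    eq₄ = RingSolver.solve-∀ ring
    -- With `p₀ k = 1 / K` and `p₁ k = K′ / K`, the factor `z` is 4 K′ᵏ⁺¹ / Kᵏ⁺²; it turns the
    -- constant of the induction hypothesis into the next one.
    z≡ : 4ℚ * K′ ^ suc k ≡ z * K ^ suc (suc k)
    z≡ = begin
      4ℚ * (K′ * K′ ^ k)                               ≡⟨ cong (λ m → 4ℚ * (m * m ^ k)) Kp₁≡K′ ⟨
      4ℚ * (K * p₁ k * (K * p₁ k) ^ k)                   ≡⟨ cong (λ m → 4ℚ * (K * p₁ k * m)) (^-distrib-* K (p₁ k) k) ⟩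
      4ℚ * (K * p₁ k * (K ^ k * p₁ k ^ k))               ≡⟨ ℚ.*-identityˡ (4ℚ * (K * p₁ k * (K ^ k * p₁ k ^ k))) ⟨
      1ℚ * (4ℚ * (K * p₁ k * (K ^ k * p₁ k ^ k)))        ≡⟨ cong (_* (4ℚ * (K * p₁ k * (K ^ k * p₁ k ^ k)))) Kp₀≡1 ⟨
      K * p₀ k * (4ℚ * (K * p₁ k * (K ^ k * p₁ k ^ k)))   ≡⟨ eq 4ℚ K (p₀ k) (p₁ k) (K ^ k) (p₁ k ^ k) ⟩
      z * K ^ suc (suc k)                              ∎
      where
      open ≡-Reasoning
      eq : ∀ f K x y a b → K * x * (f * (K * y * (a * b))) ≡ b * (f * (x * y)) * (K * (K * a))
      eq = RingSolver.solve-∀ ring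

  -- Real powers along the approximating sequences

  ev-seq-pos : ∀ z → Eventually (λ m → m) λ m → 0ℚ < seq (val z) m
  ev-seq-pos z = let δ , 0<δ , N , h = pos z in N , λ m N≤m → ℚ.<-≤-trans 0<δ (h m N≤m)

  -- Exact, because the maximum with the lower bound of `z`, by which the inverse is defined, is
  -- eventually the sequence itself.
  seq-⁻¹ : ∀ z → Eventually (λ m → m) λ m → seq (val z) m * seq (val (z ⁻¹)) m ≡ 1ℚ
  seq-⁻¹ z = let δ , 0<δ , N , h = pos z in N , λ m N≤m →
    trans (cong (_* seq (val (z ⁻¹)) m) (sym (ℚ.p≥q⇒p⊔q≡p (h m N≤m))))
      (p*inv (seq (val z) m ⊔ δ) (ℚ.<-≤-trans 0<δ (ℚ.p≤q⊔p (seq (val z) m) δ)))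

  seq-^⁺ : ∀ z n m → seq (val (z ^⁺ n)) m ≡ seq (val z) m ^ n
  seq-^⁺ z zero    m = refl
  seq-^⁺ z (suc n) m = cong (seq (val z) m *_) (seq-^⁺ z n m)

  -- The approximation lies at most `1 / (m + 1)` below the root of the `m`-th term. As it is
  -- eventually bounded away from 0, this additive error amounts to a factor close to 1.
  seq-√ : ∀ z → (λ m → seq (val (√ z)) m * seq (val (√ z)) m) ≈ seq (val z)
  seq-√ z s 1<s =
    let t , 1<t , t²≤s = ∃-root 1<s
        h = t - 1ℚ
        0<h = p<q⇒0<q-p 1<t
        δ , 0<δ , N , δ≤ = pos (√ z)
        N′ , small = archimedean (h * δ) (*-pos 0<h 0<δ)
    in ev-zip (λ m 0<q (δ≤r , u<) → near t t²≤s (seq (val z) m) m 0<q (ℚ.<-≤-trans 0<δ δ≤r)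
           (ℚ.≤-trans (ℚ.<⇒≤ u<) (*-monoʳ-≤ h (ℚ.<⇒≤ 0<h) δ≤r)))
         (ev-seq-pos z) (ev-zip (λ m a b → a , b) (N , δ≤) (N′ , small))
    where
    near : ∀ t → t * t ≤ s → ∀ q m → let r = sqrtApprox q m in 0ℚ < q → 0ℚ < r → ℤ.+ 1 / suc m ≤ (t - 1ℚ) * r → Close s (r * r) q
    near t t²≤s q m 0<q 0<r u≤ = close (*-pos 0<r 0<r) 0<q
      (ℚ.≤-trans r²≤q (p≤r*p (ℚ.<⇒≤ 0<q) (ℚ.<⇒≤ 1<s)))
      (begin
        q                     ≡⟨ ℚ.0≤p⇒∣p∣≡p (ℚ.<⇒≤ 0<q) ⟨
        ∣ q ∣                 ≤⟨ ℚ.<⇒≤ (SqrtApprox.upper q m) ⟩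
        (r + u) * (r + u)     ≤⟨ *-mono-≤ 0≤r+u 0≤r+u r+u≤ r+u≤ ⟩
        t * r * (t * r)       ≡⟨ interchange t r t r ⟩
        t * t * (r * r)       ≤⟨ *-monoˡ-≤ (r * r) (ℚ.<⇒≤ (*-pos 0<r 0<r)) t²≤s ⟩
        s * (r * r)           ∎)
      where
      open ℚ.≤-Reasoning
      r = sqrtApprox q m
      u = ℤ.+ 1 / suc m
      0≤r+u = ℚ.<⇒≤ (+-pos 0<r (ℚ.<⇒≤ (1/suc-pos m)))
      r²≤q : r * r ≤ q
      r²≤q = subst (r * r ≤_) (ℚ.0≤p⇒∣p∣≡p (ℚ.<⇒≤ 0<q)) (SqrtApprox.lower q m)
      eq : ∀ r t → r + (t - 1ℚ) * r ≡ t * r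
      eq = RingSolver.solve-∀ ring
      r+u≤ : r + u ≤ t * r
      r+u≤ = ℚ.≤-trans (ℚ.+-monoʳ-≤ r u≤) (ℚ.≤-reflexive (eq r t))

  ≈-eventually-≡ : ∀ {p q : ℕ → ℚ} → Eventually (λ m → m) (λ m → 0ℚ < p m) → Eventually (λ m → m) (λ m → p m ≡ q m) → p ≈ q
  ≈-eventually-≡ {p} 0<p p≡q r 1<r = ev-zip (λ m 0<pm eq → subst (Close r (p m)) eq (close-refl (ℚ.<⇒≤ 1<r) 0<pm)) 0<p p≡q

  module _ (a z : ℝ⁺) (e p : ℕ) {f : ℚ} (0<f : 0ℚ < f) where

    quotientSeq : ℕ → ℚ
    quotientSeq m = f * seq (val ((((√ a) ^⁺ e) *⁺ (((√ z) ^⁺ p) ⁻¹)) ⁻¹)) m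

    ev-quotient-pos : Eventually (λ m → m) λ m → 0ℚ < quotientSeq m
    ev-quotient-pos = ev-map (λ m → *-pos 0<f) (ev-seq-pos ((((√ a) ^⁺ e) *⁺ (((√ z) ^⁺ p) ⁻¹)) ⁻¹))

    -- The sequence represents `f` divided by the real power of `a` with exponent `e/2` and that of
    -- `z` with exponent `-p/2`. Squaring removes the roots up to `≈`, while the inverses cancel
    -- exactly.
    quotient-≈ : (λ m → quotientSeq m * quotientSeq m * seq (val a) m ^ e) ≈ (λ m → f * f * seq (val z) m ^ p)
    quotient-≈ = ≈-trans
      (≈-* (≈-refl ev-quotient²-pos) (≈-^ e (≈-sym (seq-√ a))))
      (≈-trans (≈-eventually-≡ (ev-zip (λ m 0<y 0<r → *-pos 0<y (^-pos e (*-pos 0<r 0<r))) ev-quotient²-pos (ev-seq-pos (√ a)))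
          (ev-zip (λ m vt≡1 rvu≡1 → equal (R m) (V m) (U m) m (trans (cong (_* V m) (sym (seq-^⁺ (√ z) p m))) vt≡1)
              (trans (cong (λ w → w * V m * U m) (sym (seq-^⁺ (√ a) e m))) rvu≡1))
            (seq-⁻¹ ((√ z) ^⁺ p)) (seq-⁻¹ (((√ a) ^⁺ e) *⁺ (((√ z) ^⁺ p) ⁻¹)))))
        (≈-* (≈-refl (0 , λ _ _ → *-pos 0<f 0<f)) (≈-^ p (seq-√ z))))
      where
      ev-quotient²-pos = ev-map (λ m 0<y → *-pos 0<y 0<y) ev-quotient-pos
      R V U : ℕ → ℚ
      R = seq (val (√ a))
      V = seq (val (((√ z) ^⁺ p) ⁻¹))
      U = seq (val ((((√ a) ^⁺ e) *⁺ (((√ z) ^⁺ p) ⁻¹)) ⁻¹))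
      equal : ∀ r v u m → let t = seq (val (√ z)) m in t ^ p * v ≡ 1ℚ → r ^ e * v * u ≡ 1ℚ →
              f * u * (f * u) * (r * r) ^ e ≡ f * f * (t * t) ^ p
      equal r v u m tv≡1 rvu≡1 = begin
        f * u * (f * u) * (r * r) ^ e                          ≡⟨ cong (f * u * (f * u) *_) (^-distrib-* r r e) ⟩
        f * u * (f * u) * (r ^ e * r ^ e)                      ≡⟨ eq₁ f u (r ^ e) ⟩
        f * f * (r ^ e * u * (r ^ e * u))                      ≡⟨ cong (λ w → f * f * (w * w)) ru≡t ⟩
        f * f * (t ^ p * t ^ p)                                ≡⟨ cong (f * f *_) (^-distrib-* t t p) ⟨
        f * f * (t * t) ^ p                                    ∎
        where
        open ≡-Reasoning
        t = seq (val (√ z)) m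
        eq₁ : ∀ f u r → f * u * (f * u) * (r * r) ≡ f * f * (r * u * (r * u))
        eq₁ = RingSolver.solve-∀ ring
        eq₂ : ∀ r u t v → r * u * (t * v) ≡ r * v * u * t
        eq₂ = RingSolver.solve-∀ ring
        ru≡t : r ^ e * u ≡ t ^ p
        ru≡t = begin
          r ^ e * u                     ≡⟨ ℚ.*-identityʳ (r ^ e * u) ⟨
          r ^ e * u * 1ℚ                ≡⟨ cong (r ^ e * u *_) tv≡1 ⟨
          r ^ e * u * (t ^ p * v)       ≡⟨ eq₂ (r ^ e) u (t ^ p) v ⟩
          r ^ e * v * u * t ^ p         ≡⟨ cong (_* t ^ p) rvu≡1 ⟩
          1ℚ * t ^ p                    ≡⟨ ℚ.*-identityˡ (t ^ p) ⟩
          t ^ p                         ∎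

  -- Opaque, since unfolding the square root approximations is costly.
  opaque
    quotient : (a z : ℝ⁺) (e p : ℕ) (f : ℚ) → ℕ → ℚ
    quotient a z e p f m = f * seq (val ((((√ a) ^⁺ e) *⁺ (((√ z) ^⁺ p) ⁻¹)) ⁻¹)) m

    quotient-def : ∀ a z e p f m → quotient a z e p f m ≡ f * seq (val ((((√ a) ^⁺ e) *⁺ (((√ z) ^⁺ p) ⁻¹)) ⁻¹)) m
    quotient-def a z e p f m = refl

  quotient-pos : ∀ a z e p {f} → 0ℚ < f → Eventually (λ m → m) λ m → 0ℚ < quotient a z e p f m
  quotient-pos a z e p {f} 0<f = ev-map (λ m → subst (0ℚ <_) (sym (quotient-def a z e p f m))) (ev-quotient-pos a z e p 0<f)

  quotient²-≈ : ∀ a z e p {f} → 0ℚ < f → (λ m → quotient a z e p f m * quotient a z e p f m * seq (val a) m ^ e) ≈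
                                          (λ m → f * f * seq (val z) m ^ p)
  quotient²-≈ a z e p {f} 0<f = ≈-resp (λ m → cong (λ y → y * y * seq (val a) m ^ e) (sym (quotient-def a z e p f m))) (λ _ → refl)
    (quotient-≈ a z e p 0<f)

  -- Passage to limits of real numbers

  close-1 : ∀ {r q} → Close r q 1ℚ → ∣ q - 1ℚ ∣ ≤ r - 1ℚ
  close-1 {r} {q} (close 0<q _ q≤ ≤q) with ℚ.≤-total 1ℚ q
  ... | inj₁ 1≤q = subst (_≤ r - 1ℚ) (sym (ℚ.0≤p⇒∣p∣≡p (p≤q⇒0≤q-p 1≤q)))
    (ℚ.+-monoˡ-≤ (- 1ℚ) (subst (q ≤_) (ℚ.*-identityʳ r) q≤))
  ... | inj₂ q≤1 = subst (_≤ r - 1ℚ) (sym (trans (∣∣-swap q 1ℚ) (ℚ.0≤p⇒∣p∣≡p (p≤q⇒0≤q-p q≤1)))) (begin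
    1ℚ - q            ≤⟨ ℚ.+-monoˡ-≤ (- q) ≤q ⟩
    r * q - q         ≡⟨ eq r q ⟩
    (r - 1ℚ) * q      ≤⟨ *-monoʳ-≤ (r - 1ℚ) (p≤q⇒0≤q-p 1≤r) q≤1 ⟩
    (r - 1ℚ) * 1ℚ     ≡⟨ ℚ.*-identityʳ (r - 1ℚ) ⟩
    r - 1ℚ            ∎)
    where
    open ℚ.≤-Reasoning
    eq : ∀ r q → r * q - q ≡ (r - 1ℚ) * q
    eq = RingSolver.solve-∀ ring
    1≤r : 1ℚ ≤ r
    1≤r = *-cancelˡ-≤ 0<q (subst₂ _≤_ (sym (ℚ.*-identityʳ q)) (ℚ.*-comm r q) (ℚ.≤-trans q≤1 ≤q))

  within : ∀ {ε δ y} → δ ≤ ε → ∣ y - 1ℚ ∣ ≤ ½ * δ → ½ * δ ≤ ε - ∣ y - 1ℚ ∣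
  within {ε} {δ} {y} δ≤ε c = ≤-by (ε - δ + (½ * δ - ∣ y - 1ℚ ∣)) (+-nonNeg (p≤q⇒0≤q-p δ≤ε) (p≤q⇒0≤q-p c))
    (eq ε δ ∣ y - 1ℚ ∣)
    where
    eq : ∀ e d a → ½ * d + (e - d + (½ * d - a)) ≡ e - a
    eq = RingSolver.solve-∀ ring

  -- Half of the lower bound of `ε` covers the error; the other half witnesses strict positivity of
  -- the difference.
  <ℝ-intro : ∀ f G ε → (pos-ε : Pos ε) → let δ = proj₁ pos-ε in
    Eventually (λ m → m) (λ m → ∣ ι f * seq G m - 1ℚ ∣ ≤ ½ * δ) → ∣ fromℕ f *ℝ G -ℝ fromℕ 1 ∣ℝ <ℝ ε
  <ℝ-intro f G ε (δ , 0<δ , N , δ≤) ev = ½ * δ , ½-pos 0<δ ,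
    ev-zip (λ m δ≤ε c → subst (λ q → ½ * δ ≤ seq ε m - ∣ q * seq G m - 1ℚ ∣) (ι-def f) (within {y = ι f * seq G m} δ≤ε c)) (N , δ≤) ev

  ^[/2]-pos : ∀ x n → (√ x) ^⁺ n ≡ x ^[ ℤ.+ n /2]
  ^[/2]-pos x n = refl

  -- For `k = n + 2` letters the exponent `1 - k` evaluates to `-[1+ n ]`, hence to an inverse
  -- power.
  ^[/2]-neg : ∀ x n → ((√ x) ^⁺ suc n) ⁻¹ ≡ x ^[ ℤ.+ 1 ℤ.- ℤ.+ suc (suc n) /2]
  ^[/2]-neg x n = refl

  -- `balance` is the squared asymptotics with one threshold for `n` and `m` together. For each `n`
  -- beyond it, the approximation of the square roots adds a further threshold for `m`, which may
  -- depend on `n`.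
  module Ratio (a : ℝ⁺) (z : (n : ℕ) .{{_ : NonZero n}} → ℝ⁺) (e : ℕ → ℕ) (κ : ℕ)
    (f : ℕ → ℕ) (0<f : ∀ n → 0ℚ < ι (f n))
    (balance : ∀ {s} → 1ℚ < s → ∃[ N ] ∀ n .{{_ : NonZero n}} m → N ℕ.≤ n → N ℕ.≤ m →
      Close s (ι (f n) * ι (f n) * seq (val (z n)) m ^ (suc κ)) (seq (val a) m ^ e n)) where

    ratio : (n : ℕ) .{{_ : NonZero n}} → ℕ → ℚ
    ratio n = quotient a (z n) (e n) (suc κ) (ι (f n))

    ratio-close : ∀ {s ε} → 1ℚ < s → s * s ≤ 1ℚ + ε → ∃[ N ] ∀ n .{{_ : NonZero n}} → N ℕ.≤ n →
                  Eventually (λ m → m) λ m → ∣ ratio n m - 1ℚ ∣ ≤ ε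
    ratio-close {s} {ε} 1<s s²≤ = proj₁ (balance 1<s) , λ n N≤n → ev-zip
        (λ m 0<y (c , N≤m) → near {ratio n m} {seq (val a) m ^ e n} 0<y c (proj₂ (balance 1<s) n m N≤n N≤m))
        (quotient-pos a (z n) (e n) (suc κ) (0<f n))
        (ev-zip (λ m c N≤m → c , N≤m) (quotient²-≈ a (z n) (e n) (suc κ) (0<f n) s 1<s) (proj₁ (balance 1<s) , λ m N≤m → N≤m))
      where
      -- `t` is eliminated between the two relations; cancelling `q` leaves the square of `y` close
      -- to 1, and `close-sqrt` gives the same for `y`.
      near : ∀ {y q t} → 0ℚ < y → Close s (y * y * q) t → Close s t q → ∣ y - 1ℚ ∣ ≤ ε
      near {y} {q} 0<y c d = subst (∣ y - 1ℚ ∣ ≤_) (eq ε) (close-1 (close-sqrt 1≤1+ε 0<y 0<1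
          (close-cancelˡ (0<ʳ d) (subst₂ (Close (1ℚ + ε)) (ℚ.*-comm (y * y) q) (sym (ℚ.*-identityʳ q))
            (close-mono s²≤ (close-trans 0≤s 0≤s c d))))))
        where
        0≤s = ℚ.≤-trans 0≤1 (ℚ.<⇒≤ 1<s)
        1≤1+ε = ℚ.≤-trans (ℚ.≤-trans (ℚ.<⇒≤ 1<s) (p≤r*p 0≤s (ℚ.<⇒≤ 1<s))) s²≤
        eq : ∀ e → 1ℚ + e - 1ℚ ≡ e
        eq = RingSolver.solve-∀ ring

    fromℕ-∼ : (λ n → fromℕ (f n)) ∼ (λ n → (a ^[ ℤ.+ e n /2]) *⁺ (z n ^[ ℤ.+ 1 ℤ.- ℤ.+ suc (suc κ) /2]))
    fromℕ-∼ ε (δ , 0<δ , N₀ , δ≤) =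
      let s , 1<s , s²≤ = ∃-root (<-by {1ℚ} {1ℚ + ½ * δ} (½ * δ) (½-pos 0<δ) refl)
          N , h = ratio-close 1<s s²≤
      in N , λ n N≤n → subst (λ q → ∣ fromℕ (f n) *ℝ val (q ⁻¹) -ℝ fromℕ 1 ∣ℝ <ℝ ε)
        (cong₂ _*⁺_ (^[/2]-pos a (e n)) (^[/2]-neg (z n) κ))
        (<ℝ-intro (f n) (val ((((√ a) ^⁺ e n) *⁺ (((√ z n) ^⁺ suc κ) ⁻¹)) ⁻¹)) ε (δ , 0<δ , N₀ , δ≤)
          (ev-map (λ m → subst (λ q → ∣ q - 1ℚ ∣ ≤ ½ * δ) (quotient-def a (z n) (e n) (suc κ) (ι (f n)) m)) (h n N≤n)))

  -- The squared asymptotics along the partial sums of π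

  module Balance (p : ℕ) where

    squares-pos : ∀ n → 0ℚ < squares (suc p) n
    squares-pos n = subst (0ℚ <_) (sym (squares-collision p n))
      (*-pos (*-pos (^-pos n (ι-suc-pos p)) (^-pos n (ι-suc-pos p))) (collision-pos p n))

    -- `growth-≈` is multiplied by the `p`-th power of a partial sum, so that `wallis` replaces each
    -- `Δ n` by 1. The exponent `4 n + (p + 1)` is twice the exponent `2n + k/2` of the theorem for
    -- `k = p + 1`.
    squares-≈ : (λ (n , m) → squares (suc p) n * squares (suc p) n * (4ℚ * altSum leibniz m * ι n) ^ p) ≈₂ (λ (n , m) → ι (suc p) ^ (4 ℕ.* n ℕ.+ (suc p)))
    squares-≈ = Pairs.≈-trans
      (Pairs.≈-resp (λ (n , m) → left n (altSum leibniz m)) (λ _ → refl)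
        (Pairs.≈-* (Pairs.≈-* power-≈ (≈-proj₁ (growth-≈ p))) (Pairs.≈-^ p (Pairs.≈-refl (ev-proj₂ (1 , leibniz-pos))))))
      (Pairs.≈-resp (λ (n , m) → middle n (altSum leibniz m)) (λ (n , m) → right n)
        (Pairs.≈-* (Pairs.≈-* power-≈ (Pairs.≈-refl (0 , λ _ _ → ^-pos (suc p) 0<K))) (Pairs.≈-^ p wallis)))
      where
      0<K = ι-suc-pos p
      leibniz-pos : ∀ m → 1 ℕ.≤ m → 0ℚ < altSum leibniz m
      leibniz-pos m 1≤m = ℚ.<-≤-trans (proj₁ (proj₂ (pos π))) (proj₂ (proj₂ (proj₂ (pos π))) m 1≤m)
      Q : ℕ → ℚ
      Q n = ι (suc p) ^ n
      power-≈ : (λ (n , _) → Q n * Q n * (Q n * Q n)) ≈₂ (λ (n , _) → Q n * Q n * (Q n * Q n))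
      power-≈ = Pairs.≈-refl (0 , λ (n , _) _ → let 0<Q = ^-pos n 0<K in *-pos (*-pos 0<Q 0<Q) (*-pos 0<Q 0<Q))
      left : ∀ n s → Q n * Q n * (Q n * Q n) * (4ℚ ^ p * weighted (collision p) p n) * s ^ p ≡
                     squares (suc p) n * squares (suc p) n * (4ℚ * s * ι n) ^ p
      left n s = begin
        Q n * Q n * (Q n * Q n) * (4ℚ ^ p * (collision p n * collision p n * ι n ^ p)) * s ^ p
          ≡⟨ eq (Q n) (4ℚ ^ p) (collision p n) (ι n ^ p) (s ^ p) ⟩
        Q n * Q n * collision p n * (Q n * Q n * collision p n) * (4ℚ ^ p * s ^ p * ι n ^ p)
          ≡⟨ cong₂ (λ f g → f * f * g) (squares-collision p n) (trans (^-distrib-* (4ℚ * s) (ι n) p) (cong (_* ι n ^ p) (^-distrib-* 4ℚ s p))) ⟨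
        squares (suc p) n * squares (suc p) n * (4ℚ * s * ι n) ^ p ∎
        where
        open ≡-Reasoning
        eq : ∀ q f c n s → q * q * (q * q) * (f * (c * c * n)) * s ≡ q * q * c * (q * q * c) * (f * s * n)
        eq = RingSolver.solve-∀ ring
      middle : ∀ n s → Q n * Q n * (Q n * Q n) * ι (suc p) ^ (suc p) * (Δ n * s) ^ p ≡
                       Q n * Q n * (Q n * Q n) * (ι (suc p) ^ (suc p) * Δ n ^ p) * s ^ p
      middle n s = trans (cong (Q n * Q n * (Q n * Q n) * ι (suc p) ^ (suc p) *_) (^-distrib-* (Δ n) s p))
        (eq (Q n * Q n * (Q n * Q n)) (ι (suc p) ^ (suc p)) (Δ n ^ p) (s ^ p))
        where
        eq : ∀ q a d s → q * a * (d * s) ≡ q * (a * d) * s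
        eq = RingSolver.solve-∀ ring
      right : ∀ n → Q n * Q n * (Q n * Q n) * ι (suc p) ^ (suc p) * 1ℚ ^ p ≡ ι (suc p) ^ (4 ℕ.* n ℕ.+ (suc p))
      right n = begin
        Q n * Q n * (Q n * Q n) * ι (suc p) ^ (suc p) * 1ℚ ^ p        ≡⟨ cong (Q n * Q n * (Q n * Q n) * ι (suc p) ^ (suc p) *_) (1^ p) ⟩
        Q n * Q n * (Q n * Q n) * ι (suc p) ^ (suc p) * 1ℚ            ≡⟨ eq (Q n) (ι (suc p) ^ (suc p)) ⟩
        Q n * (Q n * (Q n * (Q n * 1ℚ))) * ι (suc p) ^ (suc p)        ≡⟨ cong (_* ι (suc p) ^ (suc p)) four ⟨
        ι (suc p) ^ (4 ℕ.* n) * ι (suc p) ^ (suc p)                         ≡⟨ ^-homo-* (ι (suc p)) (4 ℕ.* n) (suc p) ⟨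
        ι (suc p) ^ (4 ℕ.* n ℕ.+ (suc p))                             ∎
        where
        open ≡-Reasoning
        eq : ∀ q a → q * q * (q * q) * a * 1ℚ ≡ q * (q * (q * (q * 1ℚ))) * a
        eq = RingSolver.solve-∀ ring
        more : ∀ m {t} → ι (suc p) ^ m ≡ t → ι (suc p) ^ (n ℕ.+ m) ≡ Q n * t
        more m h = trans (^-homo-* (ι (suc p)) n m) (cong (Q n *_) h)
        four : ι (suc p) ^ (4 ℕ.* n) ≡ Q n * (Q n * (Q n * (Q n * 1ℚ)))
        four = more (3 ℕ.* n) (more (2 ℕ.* n) (more (1 ℕ.* n) (more 0 refl)))

    balance : ∀ {s} → 1ℚ < s → ∃[ N ] ∀ n .{{_ : NonZero n}} m → N ℕ.≤ n → N ℕ.≤ m →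
      Close s (squares (suc p) n * squares (suc p) n * seq (val (fromℕ⁺ 4 *⁺ π *⁺ fromℕ⁺ n)) m ^ p) (seq (val (fromℕ⁺ (suc p))) m ^ (4 ℕ.* n ℕ.+ (suc p)))
    -- Matching `n` as a successor lets `fromℕ⁺ n` reduce, so that the `m`-th term of 4πn is the
    -- product occurring in `squares-≈`.
    balance {s} 1<s = let N , h = squares-≈ s 1<s in N , λ { n@(suc _) m N≤n N≤m →
      subst₂ (λ u v → Close s (squares (suc p) n * squares (suc p) n * (4ℚ * altSum leibniz m * u) ^ p) (v ^ (4 ℕ.* n ℕ.+ (suc p))))
        (ι-def n) (ι-def (suc p)) (h (n , m) (ℕ.⊓-glb N≤n N≤m)) }

  asymptotics : ∀ κ .{{i : NonZero (suc (suc κ))}} → (λ n → fromℕ (abelianSquares (suc (suc κ)) n)) ∼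
    (λ n → (fromℕ⁺ (suc (suc κ)) {{i}} ^[ ℤ.+ (4 ℕ.* n ℕ.+ suc (suc κ)) /2]) *⁺ ((fromℕ⁺ 4 *⁺ π *⁺ fromℕ⁺ n) ^[ ℤ.+ 1 ℤ.- ℤ.+ suc (suc κ) /2]))
  asymptotics κ {{i}} = Ratio.fromℕ-∼ (fromℕ⁺ (suc (suc κ)) {{i}}) (λ n → fromℕ⁺ 4 *⁺ π *⁺ fromℕ⁺ n) (λ n → 4 ℕ.* n ℕ.+ suc (suc κ)) κ
    (abelianSquares (suc (suc κ))) (Balance.squares-pos (suc κ)) (Balance.balance (suc κ))

open import Data.Nat using (ℕ; zero; suc; s≤s; NonZero; _≤_; _+_; _*_)
open import Data.Integer using (+_; _-_)
open import Defs using (abelianSquares; fromℕ; fromℕ⁺; _*⁺_; _^[_/2]; π; _∼_)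

theorem4 : (k : ℕ) .{{_ : NonZero k}} → 2 ≤ k →
    (λ n → fromℕ (abelianSquares k n)) ∼ (λ n → (fromℕ⁺ k ^[ + (4 * n + k) /2]) *⁺ ((fromℕ⁺ 4 *⁺ π *⁺ fromℕ⁺ n) ^[ + 1 - + k /2]))
theorem4 (suc zero)    (s≤s ())
theorem4 (suc (suc κ)) {{i}} _ = Estimates.asymptotics κ {{i}}
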